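{- Let $0<\epsilon <1/2$ and let $U,V$ be finite subsets of $\mathbb{Z}$ with $N=\min \{|U|, |V|\}\ge 3$ and $M=\max\{|U|,|V|\}\geq 2/\sqrt{\epsilon}$. Let $\Gamma \subset U\times V$ with $|\Gamma|\ge (1-\epsilon)|U||V|$ and write $|U\stackrel{\Gamma}{+} V|= |U|+|V|+r$. If \[r<\frac{N}{2}-13\sqrt{\epsilon}M,\] then there are arithmetic progressions $P$ and $Q$ with the same common difference and lengths $|P|\le |U|+r+5\sqrt{\epsilon}M$, $|Q|\le |V|+r+5\sqrt{\epsilon}M$, such that $|P\cap U|\ge (1-\sqrt{\epsilon})|U|$ and $|Q\cap V|\ge (1-\sqrt{\epsilon})|V|$.
   Context: For $U,V$ subsets of an abelian group and $\Gamma\subset U\times V$, the restricted sumset is $U\stackrel{\Gamma}{+} V=\{u+v: (u,v)\in \Gamma\}$.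
   Formalization: The parameter ε is taken to be rational rather than real; inequalities involving √ε are expressed exactly by comparing squares. -}

module Defs where

open import Data.Nat using (ℕ; _⊔_; _⊓_)
open import Data.Integer as ℤ using (ℤ; +_)
import Data.Integer.Properties as ℤP
open import Data.Rational using (ℚ; _/_; _≤_; _<_; _*_; _+_; _-_; 0ℚ)
open import Data.List using (List; map; length; upTo; filter; deduplicate)
open import Data.List.Membership.DecPropositional ℤP._≟_ using (_∈?_)
open import Data.Product using (_×_; _,_)
open import Data.Sum using (_⊎_)

ℤ→ℚ : ℤ → ℚ
ℤ→ℚ z = z / 1

ℕ→ℚ : ℕ → ℚ
ℕ→ℚ n = (+ n) / 1

-- finite subsets of ℤ are duplicate-free lists; |S| = length S

restrictedSumset : List (ℤ × ℤ) → List ℤ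
restrictedSumset Γ = deduplicate ℤP._≟_ (map (λ p → Data.Product.proj₁ p ℤ.+ Data.Product.proj₂ p) Γ)
  where import Data.Product

AP : ℤ → ℕ → ℕ → List ℤ
AP a d L = map (λ i → a ℤ.+ (+ i) ℤ.* (+ d)) (upTo L)

inter : List ℤ → List ℤ → List ℤ
inter P U = filter (_∈? P) U

-- a ≤ √ε · b   (for b ≥ 0, ε ≥ 0), expressed without square roots
_≤√_·_ : ℚ → ℚ → ℚ → Set
a ≤√ ε · b = (a ≤ 0ℚ) ⊎ (a * a ≤ ε * (b * b))

-- √ε · b < c   (for b ≥ 0, ε ≥ 0), expressed without square roots
√_·_<_ : ℚ → ℚ → ℚ → Set
√ ε · b < c = (0ℚ < c) × (ε * (b * b) < c * c)

{-# OPTIONS --safe #-}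

-- Write e for the integer part of √ε M. All but √ε|U| elements of U miss at most √ε|V| partners, and
-- similarly for V, so we may pass to sets A, B of such typical elements: then every row and column of
-- A × B misses at most e pairs and fewer than (e + 1)² pairs are missing altogether.
--
-- If ℓ is the length of the hull of A, the sumset has at most |S| − |B| + 2e residues modulo ℓ, because
-- almost all b contribute two congruent sums, with the two ends of A. On the other hand, a residue with more
-- than e representations a + b is a sum, with at most e exceptions. So ℓ + |B| ≤ |S| + 3e as soon as all
-- residues have more than e representations, and it remains to find these representations.
--
-- When |A| = |B|, let ℓ be the length of the longer hull. As |S| is small, every difference of B is modulo ℓ
-- a difference of A in more than |A|/2 ways, and conversely. Hence A − A and B − B are the same subgroup dℤ/ℓ,
-- whose order is less than 2|A|, and the pigeonhole principle provides the representations.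
--
-- In general let |B| ≤ |A|. Every segment of |B| consecutive elements of A satisfies the previous case together
-- with B, because the other elements of A contribute sums of their own. After rescaling by d this makes B and
-- every such segment of A dense in an interval, and density again provides the representations modulo
-- the hulls of A and of B.
module Submission where

open import Defs
open import Data.Nat using (ℕ; _⊔_; _⊓_; zero; suc; s≤s; z≤n)
import Data.Nat as ℕ
import Data.Nat.Properties as ℕP
open import Data.Nat.Tactic.RingSolver using () renaming (solve-∀ to ℕ-solve)
open import Data.List using (List; cartesianProduct; []; _∷_; length; map; filter; _++_; upTo)
open import Data.List.Properties using (length-++; length-map; length-upTo)
open import Data.List.Relation.Unary.Unique.Propositional using (Unique)
import Data.List.Relation.Unary.Unique.Propositional.Properties as Uniq
open import Data.List.Relation.Unary.AllPairs using ([]; _∷_)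
open import Data.List.Relation.Unary.All as All using (All; []; _∷_)
import Data.List.Relation.Unary.All.Properties as AllP
open import Data.List.Relation.Unary.Any using (Any; here; there; any?)
open import Data.List.Membership.Propositional using (_∈_; find; lose)
open import Data.List.Membership.Propositional.Properties using (∈-cartesianProduct⁺; ∈-deduplicate⁺; ∈-filter⁺; ∈-filter⁻; ∈-map⁺; ∈-map⁻; ∈-++⁺ˡ; ∈-++⁺ʳ; ∈-++⁻; ∈-upTo⁺; ∈-upTo⁻)
open import Data.Product using (_×_; _,_; ∃-syntax; proj₁; proj₂; uncurry)
open import Data.Sum using (_⊎_; inj₁; inj₂)
open import Data.Empty using (⊥; ⊥-elim)
open import Function using (_∘_; id)
open import Relation.Nullary using (¬_; Dec; yes; no; contradiction)
open import Relation.Nullary.Decidable as Dec using (¬?; _×-dec_; toWitness)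
open import Relation.Unary using (Decidable)
open import Relation.Binary.PropositionalEquality using (module ≡-Reasoning; _≡_; _≢_; refl; sym; trans; cong; cong₂; subst; subst₂)
open import Data.Integer as ℤ using (ℤ; +_; 0ℤ; ∣_∣)
import Data.Integer.Properties as ℤP
open import Data.Integer.Tactic.RingSolver using () renaming (solve-∀ to ℤ-solve)
open import Data.Integer.Divisibility.Signed using (_∣_; divides; _∣?_; ∣⇒∣ᵤ; ∣ᵤ⇒∣; ∣m∣n⇒∣m+n; ∣m⇒∣-m; ∣n⇒∣m*n; ∣-refl; ∣-trans)
import Data.Nat.Divisibility as ℕD
open import Data.List.Membership.DecPropositional ℤP._≟_ using (_∈?_)
open import Algebra.Properties.AbelianGroup ℤP.+-0-abelianGroup using () renaming (∙-cancelˡ to ℤ-cancelˡ; ∙-cancelʳ to ℤ-cancelʳ)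
open import Data.Integer.DivMod using (_%ℕ_; _/ℕ_; n%ℕd<d; a≡a%ℕn+[a/ℕn]*n)
open import Data.Nat.GCD using (gcd; gcd-GCD; gcd[m,n]∣m; gcd[m,n]∣n; module Bézout)
import Data.Nat.DivMod as ℕDM
open import Data.Product.Properties using (≡-dec)
open import Data.Unit using (tt)
import Data.Rational.Properties as ℚP
open import Data.Rational.Solver using (module +-*-Solver)
open import Data.Rational.Unnormalised using (mkℚᵘ; _≃_; *≡*; *≤*)
import Data.Rational.Unnormalised.Properties as ℚᵘP
import Data.Rational.Unnormalised as ℚᵘ
import Data.Nat.Coprimality as Coprime

-- The argument for equal sizes cannot be run on `A` and `B` directly. Modulo the hull of `A` it
-- finds a difference of `A` inside `B` only about 3|B| - |S| times, which is vacuous once |A|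
-- reaches 2|B|. Cutting `A` down to |B| elements restores the count, because the bound on the
-- sumset falls by almost as much. The price is that each segment comes with its own common
-- difference; two elements of `B` at distance d, adjacent after rescaling, force all these
-- differences to agree.
--
-- A small total of missing pairs would not be enough: the estimates use single rows and columns,
-- such as those at the ends of the hulls, so each of them must be nearly full.
--
-- All losses are multiples of e, which is positive by the hypothesis on M and therefore absorbs
-- rounding as well. Clearing the half in N/2 turns 13 into 26e; passing to typical elements leaves
-- 21e, passing to a segment leaves 17e. In the conclusion, 3e comes from the hull bound, e from the
-- atypical elements, and a last e from the extra term that a progression has beyond its number of
-- steps.

-- Counting

-- A linear-arithmetic certificate: b − a = (R − L) + k, written without subtraction.
lin : ∀ {a b L R} k → L ℕ.≤ R → a ℕ.+ R ℕ.+ k ≡ b ℕ.+ L → a ℕ.≤ b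
lin {a} {b} {L} {R} k h eq = ℕP.+-cancelʳ-≤ R a b (begin
  a ℕ.+ R          ≤⟨ ℕP.m≤m+n (a ℕ.+ R) k ⟩
  a ℕ.+ R ℕ.+ k    ≡⟨ eq ⟩
  b ℕ.+ L          ≤⟨ ℕP.+-monoʳ-≤ b h ⟩
  b ℕ.+ R          ∎)
  where open ℕP.≤-Reasoning

infixl 6 _⊕_
_⊕_ : ∀ {a b c d} → a ℕ.≤ b → c ℕ.≤ d → a ℕ.+ c ℕ.≤ b ℕ.+ d
_⊕_ = ℕP.+-mono-≤

infixr 7 _⊛_
_⊛_ : ∀ {a b} k → a ℕ.≤ b → k ℕ.* a ℕ.≤ k ℕ.* b
k ⊛ h = ℕP.*-monoʳ-≤ k h

-- Upper bounds on cardinality are stated for predicates, so that sets given by congruences or by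
-- missing pairs need neither be decided nor enumerated.
AtMost : {X : Set} → ℕ → (X → Set) → Set
AtMost k P = ∀ xs → Unique xs → All P xs → length xs ℕ.≤ k

module _ {X : Set} where

  InjectiveOn : {Y : Set} → (X → Y) → List X → Set
  InjectiveOn f xs = ∀ {x y} → x ∈ xs → y ∈ xs → f x ≡ f y → x ≡ y

  map-unique : {Y : Set} (f : X → Y) (xs : List X) → InjectiveOn f xs → Unique xs → Unique (map f xs)
  map-unique f [] inj [] = []
  map-unique f (x ∷ xs) inj (x∉ ∷ u) =
    AllP.map⁺ (All.tabulate λ y∈ fx≡fy → All.lookup x∉ y∈ (inj (here refl) (there y∈) fx≡fy))
    ∷ map-unique f xs (λ p q → inj (there p) (there q)) u

module _ {X : Set} where

  AtMost-map : {Y : Set} {k : ℕ} {P : X → Set} {Q : Y → Set} (f : X → Y) →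
    (∀ {x y} → f x ≡ f y → x ≡ y) → (∀ {x} → P x → Q (f x)) → AtMost k Q → AtMost k P
  AtMost-map f inj pq h xs u all =
    subst (ℕ._≤ _) (length-map f xs) (h (map f xs) (Uniq.map⁺ inj u) (AllP.map⁺ (All.map pq all)))

  AtMost-⊆ : {k : ℕ} {P Q : X → Set} → (∀ {x} → P x → Q x) → AtMost k Q → AtMost k P
  AtMost-⊆ = AtMost-map id id

  ++-unique : {xs ys : List X} → Unique xs → Unique ys → (∀ {x} → x ∈ xs → x ∈ ys → ⊥) → Unique (xs ++ ys)
  ++-unique u v disj = Uniq.++⁺ u v (uncurry disj)

  filter-split : {P : X → Set} (P? : Decidable P) (xs : List X) →
    length xs ≡ length (filter P? xs) ℕ.+ length (filter (¬? ∘ P?) xs)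
  filter-split P? [] = refl
  filter-split P? (x ∷ xs) with P? x
  ... | yes _ = cong suc (filter-split P? xs)
  ... | no  _ = trans (cong suc (filter-split P? xs)) (sym (ℕP.+-suc _ _))

  filter-unique : {P : X → Set} (P? : Decidable P) {xs : List X} → Unique xs → Unique (filter P? xs)
  filter-unique P? = Uniq.filter⁺ P?

  filter-all : {P : X → Set} (P? : Decidable P) (xs : List X) → All (λ x → x ∈ xs × P x) (filter P? xs)
  filter-all P? xs = All.tabulate (∈-filter⁻ P?)

  filter-most : {P : X → Set} (P? : Decidable P) {k : ℕ} {xs : List X} → Unique xs →
    AtMost k (λ x → x ∈ xs × ¬ P x) → length xs ℕ.≤ length (filter P? xs) ℕ.+ k
  filter-most P? {k} {xs} u h = begin
    length xs                                                      ≡⟨ filter-split P? xs ⟩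
    length (filter P? xs) ℕ.+ length (filter (¬? ∘ P?) xs)         ≤⟨ ℕP.+-monoʳ-≤ _ (h _ (filter-unique (¬? ∘ P?) u) (filter-all (¬? ∘ P?) xs)) ⟩
    length (filter P? xs) ℕ.+ k                                    ∎
    where open ℕP.≤-Reasoning

  choosePairs : {Y : Set} {R : X → Y → Set} {xs : List X} → Unique xs → (∀ {x} → x ∈ xs → ∃[ y ] R x y) →
    ∃[ ps ] (Unique ps × length ps ≡ length xs × All (λ p → proj₁ p ∈ xs × R (proj₁ p) (proj₂ p)) ps)
  choosePairs [] h = [] , [] , refl , []
  choosePairs {xs = x ∷ xs} (x∉ ∷ u) h with choosePairs u (h ∘ there) | h (here refl)
  ... | ps , up , lp , ap | y , r =
    (x , y) ∷ ps
    , All.map (λ q eq → All.lookup x∉ (proj₁ q) (cong proj₁ eq)) ap ∷ up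
    , cong suc lp
    , (here refl , r) ∷ All.map (λ (a , b) → there a , b) ap

  -- A relation takes the place of a map because images are often mere witnesses, such as some
  -- leader in a residue class; injectivity is then the condition that no `y` serves two elements.
  pigeonhole : {Y : Set} {k : ℕ} {Q : Y → Set} (R : X → Y → Set) {xs : List X} → Unique xs →
    (∀ {x} → x ∈ xs → ∃[ y ] (R x y × Q y)) →
    (∀ {x x′ y} → x ∈ xs → x′ ∈ xs → R x y → R x′ y → x ≡ x′) →
    AtMost k Q → length xs ℕ.≤ k
  pigeonhole R {xs} u h inj q with choosePairs u h
  ... | ps , up , lp , ap = subst (ℕ._≤ _) (trans (length-map proj₂ ps) lp)
    (q (map proj₂ ps) (map-unique proj₂ ps inj′ up) (AllP.map⁺ (All.map (proj₂ ∘ proj₂) ap)))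
    where
    inj′ : ∀ {p p′} → p ∈ ps → p′ ∈ ps → proj₂ p ≡ proj₂ p′ → p ≡ p′
    inj′ {x , y} {x′ , .y} p∈ p′∈ refl with All.lookup ap p∈ | All.lookup ap p′∈
    ... | x∈ , r , _ | x′∈ , r′ , _ = cong (_, y) (inj x∈ x′∈ r r′)

  AtMost-∈ : (ys : List X) → AtMost (length ys) (_∈ ys)
  AtMost-∈ ys [] u all = z≤n
  AtMost-∈ [] (x ∷ xs) u (() ∷ all)
  AtMost-∈ ys (x ∷ xs) (x∉ ∷ u) (x∈ ∷ all) =
    ℕP.≤-trans (s≤s (AtMost-∈ (remove x∈) xs u (keep x∈ x∉ all))) (ℕP.≤-reflexive (length-remove x∈))
    where
    remove : ∀ {x ys} → x ∈ ys → List X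
    remove {ys = _ ∷ ys} (here _) = ys
    remove {ys = y ∷ _} (there p) = y ∷ remove p
    length-remove : ∀ {x ys} (p : x ∈ ys) → suc (length (remove p)) ≡ length ys
    length-remove (here _) = refl
    length-remove (there p) = cong suc (length-remove p)
    keep₁ : ∀ {x y ys} (p : x ∈ ys) → x ≢ y → y ∈ ys → y ∈ remove p
    keep₁ (here refl) ne (here refl) = ⊥-elim (ne refl)
    keep₁ (here refl) ne (there q) = q
    keep₁ (there p) ne (here refl) = here refl
    keep₁ (there p) ne (there q) = there (keep₁ p ne q)
    keep : ∀ {x ys xs} (p : x ∈ ys) → All (x ≢_) xs → All (_∈ ys) xs → All (_∈ remove p) xs
    keep p [] [] = []
    keep p (ne ∷ nes) (q ∷ qs) = keep₁ p ne q ∷ keep p nes qs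

  length-⊆ : {xs ys : List X} → Unique xs → (∀ {x} → x ∈ xs → x ∈ ys) → length xs ℕ.≤ length ys
  length-⊆ u sub = AtMost-∈ _ _ u (All.tabulate sub)

module _ {X : Set} where

  doubleCounting : {Y : Set} {k ρ : ℕ} {Q : Y → Set} (R : X → Y → Set) {xs : List X} → Unique xs →
    (∀ {x} → x ∈ xs → ∃[ ys ] (Unique ys × ρ ℕ.≤ length ys × All (λ y → R x y × Q y) ys)) →
    (∀ {x x′ y} → x ∈ xs → x′ ∈ xs → R x y → R x′ y → x ≡ x′) →
    AtMost k Q → length xs ℕ.* ρ ℕ.≤ k
  doubleCounting {Y} {k} {ρ} {Q} R {xs} u h inj q with gather u h inj
    where
    gather : ∀ {xs} → Unique xs →
      (∀ {x} → x ∈ xs → ∃[ ys ] (Unique ys × ρ ℕ.≤ length ys × All (λ y → R x y × Q y) ys)) →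
      (∀ {x x′ y} → x ∈ xs → x′ ∈ xs → R x y → R x′ y → x ≡ x′) →
      ∃[ ys ] (Unique ys × length xs ℕ.* ρ ℕ.≤ length ys × All (λ y → (∃[ x ] (x ∈ xs × R x y)) × Q y) ys)
    gather {[]} [] h inj = [] , [] , z≤n , []
    gather {x ∷ xs} (x∉ ∷ u) h inj with gather u (h ∘ there) (λ p q → inj (there p) (there q)) | h (here refl)
    ... | ys , uy , ly , ay | zs , uz , lz , az =
      zs ++ ys
      , ++-unique uz uy disj
      , subst (_ ℕ.≤_) (sym (length-++ zs)) (ℕP.+-mono-≤ lz ly)
      , AllP.++⁺ (All.map (λ (r , p) → (x , here refl , r) , p) az)
                 (All.map (λ ((x′ , m , r) , p) → (x′ , there m , r) , p) ay)
      where
      disj : ∀ {y} → y ∈ zs → y ∈ ys → ⊥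
      disj y∈zs y∈ys with All.lookup az y∈zs | All.lookup ay y∈ys
      ... | r , _ | (x′ , m , r′) , _ = All.lookup x∉ m (inj (here refl) (there m) r r′)
  ... | ys , uy , ly , ay = ℕP.≤-trans ly (q ys uy (All.map proj₂ ay))

AtMost-< : ∀ n → AtMost n (ℕ._< n)
AtMost-< n xs u all = subst (length xs ℕ.≤_) (length-upTo n)
  (length-⊆ u (λ x∈ → ∈-upTo⁺ (All.lookup all x∈)))

filter-∩ : {X : Set} {P Q : X → Set} (P? : Decidable P) (Q? : Decidable Q) {xs : List X} → Unique xs →
  length xs ℕ.< length (filter P? xs) ℕ.+ length (filter Q? xs) → ∃[ x ] (x ∈ xs × P x × Q x)
filter-∩ P? Q? {xs} u h with filter (λ x → P? x ×-dec Q? x) xs in eq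
... | x ∷ ys = let m , p , q = ∈-filter⁻ (λ x → P? x ×-dec Q? x) (subst (x ∈_) (sym eq) (here refl)) in x , m , p , q
... | [] = contradiction h (ℕP.≤⇒≯ (begin
    length (filter P? xs) ℕ.+ length (filter Q? xs) ≡⟨ sym (length-++ (filter P? xs)) ⟩
    length (filter P? xs ++ filter Q? xs) ≤⟨ length-⊆ (++-unique (filter-unique P? u) (filter-unique Q? u) disj) sub ⟩
    length xs ∎))
  where
  open ℕP.≤-Reasoning
  disj : ∀ {x} → x ∈ filter P? xs → x ∈ filter Q? xs → ⊥
  disj {x} a b with ∈-filter⁻ P? {xs = xs} a | ∈-filter⁻ Q? {xs = xs} b
  ... | m , p | _ , q with subst (x ∈_) eq (∈-filter⁺ (λ x → P? x ×-dec Q? x) m (p , q))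
  ... | ()
  sub : ∀ {x} → x ∈ filter P? xs ++ filter Q? xs → x ∈ xs
  sub m with ∈-++⁻ (filter P? xs) m
  ... | inj₁ a = proj₁ (∈-filter⁻ P? a)
  ... | inj₂ b = proj₁ (∈-filter⁻ Q? b)

module IntegerSumsets where
  open import Data.Integer using (_+_; _-_; _*_; -_)

  -- Residues of restricted sumsets

  infix 4 _≈[_]_
  -- Wrapping the divisibility in a record keeps both sides visible to unification, which could not
  -- in general recover them from the difference.
  record _≈[_]_ (x ℓ y : ℤ) : Set where
    constructor congruent
    field difference : ℓ ∣ x - y
  open _≈[_]_

  ≈-dec : ∀ ℓ x y → Dec (x ≈[ ℓ ] y)
  ≈-dec ℓ x y = Dec.map′ congruent difference (ℓ ∣? (x - y))

  ≈-reflexive : ∀ {ℓ x y} → x ≡ y → x ≈[ ℓ ] y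
  ≈-reflexive {ℓ} {x} refl = congruent (divides 0ℤ (ℤP.+-inverseʳ x))

  ≈-refl : ∀ {ℓ} x → x ≈[ ℓ ] x
  ≈-refl x = ≈-reflexive {x = x} refl

  ≈-sym : ∀ {ℓ x y} → x ≈[ ℓ ] y → y ≈[ ℓ ] x
  ≈-sym {ℓ} {x} {y} (congruent p) = congruent (subst (ℓ ∣_) (identity x y) (∣m⇒∣-m p))
    where
    identity : ∀ x y → - (x - y) ≡ y - x
    identity = ℤ-solve

  ≈-trans : ∀ {ℓ x y z} → x ≈[ ℓ ] y → y ≈[ ℓ ] z → x ≈[ ℓ ] z
  ≈-trans {ℓ} {x} {y} {z} (congruent p) (congruent q) = congruent (subst (ℓ ∣_) (identity x y z) (∣m∣n⇒∣m+n p q))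
    where
    identity : ∀ x y z → (x - y) + (y - z) ≡ x - z
    identity = ℤ-solve

  ≈-+ : ∀ {ℓ x y z w} → x ≈[ ℓ ] y → z ≈[ ℓ ] w → x + z ≈[ ℓ ] y + w
  ≈-+ {ℓ} {x} {y} {z} {w} (congruent p) (congruent q) = congruent (subst (ℓ ∣_) (identity x y z w) (∣m∣n⇒∣m+n p q))
    where
    identity : ∀ x y z w → (x - y) + (z - w) ≡ (x + z) - (y + w)
    identity = ℤ-solve

  ≈-neg : ∀ {ℓ x y} → x ≈[ ℓ ] y → - x ≈[ ℓ ] - y
  ≈-neg {ℓ} {x} {y} (congruent p) = congruent (subst (ℓ ∣_) (identity x y) (∣m⇒∣-m p))
    where
    identity : ∀ x y → - (x - y) ≡ - x - - y
    identity = ℤ-solve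

  ≈-∸ : ∀ {ℓ x y z w} → x ≈[ ℓ ] y → z ≈[ ℓ ] w → x - z ≈[ ℓ ] y - w
  ≈-∸ p q = ≈-+ p (≈-neg q)

  ≈-shift : ∀ {ℓ x y x′ y′} → x ≈[ ℓ ] y → x - y ≡ x′ - y′ → x′ ≈[ ℓ ] y′
  ≈-shift {ℓ} (congruent p) eq = congruent (subst (ℓ ∣_) eq p)

  index : ∀ {x z L} → x ℤ.≤ z → z ℤ.< x + + L → ∃[ i ] (i ℕ.< L × z ≡ x + + i)
  index {x} {z} {L} x≤z z<x+L = ∣ z - x ∣ , ℤP.drop‿+<+ (subst₂ ℤ._<_ (sym pos) (cancel x (+ L)) (ℤP.+-monoˡ-< (- x) z<x+L))
    , trans (sym (cancel′ x z)) (cong (_+_ x) (sym pos))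
    where
    pos : + ∣ z - x ∣ ≡ z - x
    pos = ℤP.0≤i⇒+∣i∣≡i (ℤP.i≤j⇒0≤j-i x≤z)
    cancel : ∀ x y → x + y - x ≡ y
    cancel = ℤ-solve
    cancel′ : ∀ x z → x + (z - x) ≡ z
    cancel′ = ℤ-solve

  ≈-small : ∀ {L i j} x → i ℕ.< L → j ℕ.< L → x + + i ≈[ + L ] x + + j → i ≡ j
  ≈-small {L} {i} {j} x i<L j<L p = ℤP.+-injective (ℤP.i-j≡0⇒i≡j (+ i) (+ j) (ℤP.∣i∣≡0⇒i≡0 zero-abs))
    where
    cancel : ∀ x y z → (x + y) - (x + z) ≡ y - z
    cancel = ℤ-solve
    small : ∣ + i - + j ∣ ℕ.< L
    small = ℕP.≤-<-trans (subst (λ z → ∣ z ∣ ℕ.≤ i ℕ.⊔ j) (sym (ℤP.[+m]-[+n]≡m⊖n i j)) (ℤP.∣m⊝n∣≤m⊔n i j)) (ℕP.⊔-lub i<L j<L)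
    zero-abs : ∣ + i - + j ∣ ≡ 0
    zero-abs with ∣ + i - + j ∣ | small | ∣⇒∣ᵤ (subst (+ L ∣_) (cancel x (+ i) (+ j)) (difference p))
    ... | zero  | _ | _ = refl
    ... | suc k | k<L | L∣k = contradiction (ℕD.∣⇒≤ L∣k) (ℕP.<⇒≱ k<L)

  ≈-multiples : ∀ q d z₀ {k k′} → 0 ℕ.< q ℕ.* d → k ℕ.< q → k′ ℕ.< q →
    z₀ + + (k ℕ.* d) ≈[ + (q ℕ.* d) ] z₀ + + (k′ ℕ.* d) → k ≡ k′
  ≈-multiples q d z₀ {k} {k′} qd>0 k< k′< p = ℕP.*-cancelʳ-≡ k k′ d
    (≈-small z₀ (ℕP.*-monoˡ-< d k<) (ℕP.*-monoˡ-< d k′<) p)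
    where
    instance
      d≢0 : ℕ.NonZero d
      d≢0 = ℕP.m*n≢0⇒n≢0 q {{ℕ.>-nonZero qd>0}}

  ≈-window : ∀ {L x y z} → x ℤ.≤ y → y ℤ.< x + + L → x ℤ.≤ z → z ℤ.< x + + L → y ≈[ + L ] z → y ≡ z
  ≈-window {L} {x} a b c d p with index a b | index c d
  ... | i , i<L , refl | j , j<L , refl = cong (λ k → x + + k) (≈-small x i<L j<L p)

  AtMost-window : ∀ x L → AtMost L (λ z → x ℤ.≤ z × z ℤ.< x + + L)
  AtMost-window x L zs u all = pigeonhole (λ z i → z ≡ x + + i) u
    (λ z∈ → let (a , b) = All.lookup all z∈ ; (i , i<L , eq) = index a b in i , eq , i<L)
    (λ _ _ p q → trans p (sym q)) (AtMost-< L)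

  -- `S` need only contain the sums along `G`. This makes the notion stable under exchanging the
  -- sets, restricting `A` to a segment and rescaling.
  record Config : Set₁ where
    field
      e s : ℕ
      A B : List ℤ
      uniqueA : Unique A
      uniqueB : Unique B
      G : ℤ → ℤ → Set
      G? : ∀ a b → Dec (G a b)
      S : ℤ → Set
      S? : ∀ z → Dec (S z)
      sums : ∀ {a b} → a ∈ A → b ∈ B → G a b → S (a + b)
      sizeS : AtMost s S
      missA : ∀ {a} → a ∈ A → AtMost e (λ b → b ∈ B × ¬ G a b)
      missB : ∀ {b} → b ∈ B → AtMost e (λ a → a ∈ A × ¬ G a b)
      -- e (2 + e) = (e + 1)² − 1
      missing : AtMost (e ℕ.* (2 ℕ.+ e)) (λ (p : ℤ × ℤ) → proj₁ p ∈ A × proj₂ p ∈ B × ¬ G (proj₁ p) (proj₂ p))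

  flip : Config → Config
  flip C = record
    { e = e ; s = s ; A = B ; B = A ; uniqueA = uniqueB ; uniqueB = uniqueA
    ; G = λ b a → G a b ; G? = λ b a → G? a b ; S = S ; S? = S?
    ; sums = λ {b} {a} b∈ a∈ g → subst S (ℤP.+-comm a b) (sums a∈ b∈ g)
    ; sizeS = sizeS ; missA = missB ; missB = missA
    ; missing = AtMost-map (λ (b , a) → a , b) (λ { refl → refl }) (λ (x , y , z) → y , x , z) missing }
    where open Config C

  module _ (C : Config) where
    open Config C

    -- Every residue class that meets the finite set `S` contains such an element, so a bound on
    -- leaders is a bound on the classes met by `S`.
    Lead : ℤ → ℤ → Set
    Lead ℓ z = S z × ¬ S (z - ℓ)

    -- `Y` is a parameter because the bound obtained from the hull of `A` is also used after the
    -- roles of the two sets are exchanged, with the same list.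
    LeadBound : ℤ → List ℤ → Set
    LeadBound ℓ Y = ∀ zs → Unique zs → All (Lead ℓ) zs → length zs ℕ.+ length Y ℕ.≤ s ℕ.+ 2 ℕ.* e

    -- All but 2e elements b of B give a sum aR + b which is not a leader, since aL + b is also a sum.
    lead-bound : ∀ {aL aR} → aL ∈ A → aR ∈ A → LeadBound (aR - aL) B
    lead-bound {aL} {aR} aL∈ aR∈ zs u all =
      lin 0 (bound ⊕ g₁≤ ⊕ g₂≤) (arith (length zs) (length B) s e (length good₁) (length good))
      where
      good₁ = filter (G? aL) B
      good = filter (G? aR) good₁
      arith : ∀ z b s e g₁ g → z ℕ.+ b ℕ.+ (s ℕ.+ (g₁ ℕ.+ e) ℕ.+ (g ℕ.+ e)) ℕ.+ 0 ≡ s ℕ.+ 2 ℕ.* e ℕ.+ (z ℕ.+ g ℕ.+ b ℕ.+ g₁)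
      arith = ℕ-solve
      g₁≤ : length B ℕ.≤ length good₁ ℕ.+ e
      g₁≤ = filter-most (G? aL) uniqueB (missA aL∈)
      g₂≤ : length good₁ ℕ.≤ length good ℕ.+ e
      g₂≤ = filter-most (G? aR) (filter-unique (G? aL) uniqueB)
        (AtMost-⊆ (λ (m , n) → proj₁ (∈-filter⁻ (G? aL) m) , n) (missA aR∈))
      good-G : ∀ {b} → b ∈ good → b ∈ B × G aL b × G aR b
      good-G m = let m₁ , r = ∈-filter⁻ (G? aR) m ; m₂ , l = ∈-filter⁻ (G? aL) m₁ in m₂ , l , r
      all-shift : All S (map (_+_ aR) good)
      all-shift = AllP.map⁺ (All.tabulate λ m → let b∈ , _ , r = good-G m in sums aR∈ b∈ r)
      shift : ∀ aL aR b → aL + b ≡ (aR + b) - (aR - aL)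
      shift = ℤ-solve
      disj : ∀ {z} → z ∈ zs → z ∈ map (_+_ aR) good → ⊥
      disj z∈ z∈′ with ∈-map⁻ (_+_ aR) z∈′
      ... | b , b∈ , refl = proj₂ (All.lookup all z∈)
        (subst S (shift aL aR b) (let m , l , _ = good-G b∈ in sums aL∈ m l))
      bound : length zs ℕ.+ length good ℕ.≤ s
      bound = subst (ℕ._≤ s) (trans (length-++ zs) (cong (length zs ℕ.+_) (length-map (_+_ aR) good)))
        (sizeS (zs ++ map (_+_ aR) good)
          (++-unique u (Uniq.map⁺ (ℤ-cancelˡ aR _ _) (filter-unique (G? aR) (filter-unique (G? aL) uniqueB))) disj)
          (AllP.++⁺ (All.map proj₁ all) all-shift))

    -- Subtract `L` until `S` is left. The elements visited are distinct members of `S`, so `s` is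
    -- enough fuel.
    lead-exists : ∀ {L z} → 0 ℕ.< L → S z → ∃[ y ] (Lead (+ L) y × y ≈[ + L ] z)
    lead-exists {L} {z} L>0 Sz = descend s z [] [] [] [] (ℕP.≤-reflexive (sym (ℕP.+-identityʳ s))) Sz (≈-reflexive refl)
      where
      identity : ∀ y z L → y - z + - (+ 1) * L ≡ (y - L) - z
      identity = ℤ-solve
      below : ∀ y → y - + L ℤ.< y
      below y = subst (y - + L ℤ.<_) (ℤP.+-identityʳ y) (ℤP.+-monoʳ-< y (ℤP.neg-mono-< (ℤ.+<+ L>0)))
      descend : ∀ f y zs → Unique zs → All S zs → All (y ℤ.<_) zs → s ℕ.≤ f ℕ.+ length zs → S y → y ≈[ + L ] z →
        ∃[ y ] (Lead (+ L) y × y ≈[ + L ] z)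
      descend f y zs u all lt s≤ Sy y≈z with S? (y - + L)
      ... | no ¬S = y , (Sy , ¬S) , y≈z
      ... | yes S′ with f
      ...   | zero = contradiction (sizeS (y ∷ zs) (All.map ℤP.<⇒≢ lt ∷ u) (Sy ∷ all)) (ℕP.<⇒≱ (s≤s s≤))
      ...   | suc f = descend f (y - + L) (y ∷ zs) (All.map ℤP.<⇒≢ lt ∷ u) (Sy ∷ all)
                        (below y ∷ All.map (ℤP.<-trans (below y)) lt)
                        (ℕP.≤-trans s≤ (ℕP.≤-reflexive (sym (ℕP.+-suc f _)))) S′
                        (congruent (subst (+ L ∣_) (identity y z (+ L)) (∣m∣n⇒∣m+n (difference y≈z) (∣n⇒∣m*n (- (+ 1)) ∣-refl))))

    Representations : ℤ → ℤ → ℕ → Set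
    Representations ℓ z k = ∃[ ps ] (Unique ps × k ℕ.≤ length ps ×
      All (λ p → proj₁ p ∈ A × proj₂ p ∈ B × proj₁ p + proj₂ p ≈[ ℓ ] z) ps)

    -- A class without a sum carries e + 1 missing pairs, so there are at most e such classes.
    class-count : ∀ {aL aR} q d z₀ → aL ∈ A → aR ∈ A → aR - aL ≡ + (q ℕ.* d) → 0 ℕ.< q ℕ.* d →
      (∀ k → k ℕ.< q → Representations (+ (q ℕ.* d)) (z₀ + + (k ℕ.* d)) (suc e)) →
      q ℕ.+ length B ℕ.≤ s ℕ.+ 3 ℕ.* e
    class-count {aL} {aR} q d z₀ aL∈ aR∈ hull qd>0 reps =
      lin 0 (hits≤ ⊕ misses≤ ⊕ ℕP.≤-reflexive q≡)
        (arith q (length B) s e (length hits) (length misses))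
      where
      arith : ∀ q b s e h m → q ℕ.+ b ℕ.+ (s ℕ.+ 2 ℕ.* e ℕ.+ e ℕ.+ (h ℕ.+ m)) ℕ.+ 0 ≡ s ℕ.+ 3 ℕ.* e ℕ.+ (h ℕ.+ b ℕ.+ m ℕ.+ q)
      arith = ℕ-solve
      ℓ = + (q ℕ.* d)
      z : ℕ → ℤ
      z k = z₀ + + (k ℕ.* d)
      Hit : ℕ → Set
      Hit k = Any (λ p → proj₁ p ∈ A × proj₂ p ∈ B × G (proj₁ p) (proj₂ p) × proj₁ p + proj₂ p ≈[ ℓ ] z k)
                  (cartesianProduct A B)
      Hit? : ∀ k → Dec (Hit k)
      Hit? k = any? (λ p → (proj₁ p ∈? A) ×-dec (proj₂ p ∈? B) ×-dec G? (proj₁ p) (proj₂ p) ×-dec ≈-dec ℓ _ _) _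
      hits = filter Hit? (upTo q)
      misses = filter (¬? ∘ Hit?) (upTo q)
      q≡ : q ≡ length hits ℕ.+ length misses
      q≡ = trans (sym (length-upTo q)) (filter-split Hit? (upTo q))
      distinct : ∀ {k k′ w} → k ℕ.< q → k′ ℕ.< q → w ≈[ ℓ ] z k → w ≈[ ℓ ] z k′ → k ≡ k′
      distinct k< k′< p p′ = ≈-multiples q d z₀ qd>0 k< k′< (≈-trans (≈-sym p) p′)
      unq = Uniq.upTo⁺ q
      hit-bound : ∀ zs → Unique zs → All (Lead ℓ) zs → length zs ℕ.≤ s ℕ.+ 2 ℕ.* e ℕ.∸ length B
      hit-bound zs u all = ℕP.m+n≤o⇒m≤o∸n (length zs) (lead-bound aL∈ aR∈ zs u (subst (λ ℓ → All (Lead ℓ) zs) (sym hull) all))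
      hits≤ : length hits ℕ.+ length B ℕ.≤ s ℕ.+ 2 ℕ.* e
      -- Applied to the empty list, `lead-bound` says that the truncated difference in `hit-bound`
      -- is a genuine one.
      hits≤ = ℕP.m≤o∸n⇒m+n≤o (length hits) (lead-bound aL∈ aR∈ [] [] [])
        (pigeonhole (λ k y → y ≈[ ℓ ] z k) (filter-unique Hit? unq) lead
          (λ k∈ k′∈ → distinct (∈-upTo⁻ (proj₁ (∈-filter⁻ Hit? k∈))) (∈-upTo⁻ (proj₁ (∈-filter⁻ Hit? k′∈)))) hit-bound)
        where
        lead : ∀ {k} → k ∈ hits → ∃[ y ] (y ≈[ ℓ ] z k × Lead ℓ y)
        lead k∈ with find (proj₂ (∈-filter⁻ Hit? {xs = upTo q} k∈))
        ... | _ , _ , a∈ , b∈ , g , p with lead-exists qd>0 (sums a∈ b∈ g)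
        ... | y , ly , y≈ = y , ≈-trans y≈ p , ly
      missed : ∀ {k} → k ∈ misses → ∃[ ps ] (Unique ps × suc e ℕ.≤ length ps ×
        All (λ p → (proj₁ p + proj₂ p ≈[ ℓ ] z k) × (proj₁ p ∈ A × proj₂ p ∈ B × ¬ G (proj₁ p) (proj₂ p))) ps)
      missed {k} k∈ with ∈-filter⁻ (¬? ∘ Hit?) {xs = upTo q} k∈
      ... | k∈′ , ¬hit with reps k (∈-upTo⁻ k∈′)
      ... | ps , u , l , all = ps , u , l , All.map (λ (a∈ , b∈ , c) → c , a∈ , b∈ ,
            λ g → ¬hit (lose (∈-cartesianProduct⁺ a∈ b∈) (a∈ , b∈ , g , c))) all
      misses≤ : length misses ℕ.≤ e
      misses≤ with length misses ℕP.≤? e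
      ... | yes h = h
      ... | no ¬h = contradiction
        (ℕP.≤-trans (ℕP.*-monoˡ-≤ (suc e) (ℕP.≰⇒> ¬h))
          (doubleCounting (λ k p → proj₁ p + proj₂ p ≈[ ℓ ] z k) (filter-unique (¬? ∘ Hit?) unq) missed
            (λ k∈ k′∈ → distinct (∈-upTo⁻ (proj₁ (∈-filter⁻ (¬? ∘ Hit?) k∈))) (∈-upTo⁻ (proj₁ (∈-filter⁻ (¬? ∘ Hit?) k′∈))))
            missing))
        (ℕP.<⇒≱ (ℕP.≤-reflexive (square e)))
        where
        square : ∀ e → suc (e ℕ.* (2 ℕ.+ e)) ≡ suc e ℕ.* suc e
        square = ℕ-solve

  -- Overlaps of residue classes and popular differences

  Incongruent : ℤ → List ℤ → Set
  Incongruent ℓ xs = ∀ {x y} → x ∈ xs → y ∈ xs → x ≈[ ℓ ] y → x ≡ y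

  incongruent-window : ∀ {L x xs} → (∀ {z} → z ∈ xs → x ℤ.≤ z × z ℤ.< x + + L) → Incongruent (+ L) xs
  incongruent-window h y∈ z∈ = ≈-window (proj₁ (h y∈)) (proj₂ (h y∈)) (proj₁ (h z∈)) (proj₂ (h z∈))

  AtMost-× : {X Y : Set} (xs : List X) (ys : List Y) →
    AtMost (length xs ℕ.* length ys) (λ p → proj₁ p ∈ xs × proj₂ p ∈ ys)
  AtMost-× xs ys ps u all = subst (length ps ℕ.≤_) (length-cartesianProduct xs)
    (length-⊆ u (λ p∈ → let a , b = All.lookup all p∈ in ∈-cartesianProduct⁺ a b))
    where
    length-cartesianProduct : ∀ xs → length (cartesianProduct xs ys) ≡ length xs ℕ.* length ys
    length-cartesianProduct [] = refl
    length-cartesianProduct (x ∷ xs) = trans (length-++ (map (x ,_) ys))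
      (cong₂ ℕ._+_ (length-map (x ,_) ys) (length-cartesianProduct xs))

  -- Inclusion and exclusion for residue classes: the elements of `xs` congruent to no `f y`,
  -- together with `map f ys`, are pairwise incongruent, and each is congruent to its own element of
  -- `Q`. With the leaders as `Q` this produces popular differences, with a system of residues as
  -- `Q` it produces representations.
  class-overlap : ∀ {ℓ k} (f : ℤ → ℤ) {Q : ℤ → Set} {xs ys : List ℤ} → Unique xs → Unique ys →
    Incongruent ℓ xs → (∀ {y y′} → y ∈ ys → y′ ∈ ys → f y ≈[ ℓ ] f y′ → y ≡ y′) →
    (∀ {x} → x ∈ xs → ∃[ w ] (x ≈[ ℓ ] w × Q w)) → (∀ {y} → y ∈ ys → ∃[ w ] (f y ≈[ ℓ ] w × Q w)) →
    AtMost k Q →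
    length xs ℕ.+ length ys ℕ.≤ length (filter (λ x → any? (λ y → ≈-dec ℓ x (f y)) ys) xs) ℕ.+ k
  class-overlap {ℓ} {k} f {Q} {xs} {ys} u v incx incy cx cy q = begin
    length xs ℕ.+ length ys                              ≡⟨ cong (ℕ._+ length ys) (filter-split F? xs) ⟩
    length F ℕ.+ length N ℕ.+ length ys                  ≡⟨ ℕP.+-assoc (length F) _ _ ⟩
    length F ℕ.+ (length N ℕ.+ length ys)                ≡⟨ cong (length F ℕ.+_) (cong (length N ℕ.+_) (sym (length-map f ys))) ⟩
    length F ℕ.+ (length N ℕ.+ length (map f ys))        ≡⟨ cong (length F ℕ.+_) (sym (length-++ N)) ⟩
    length F ℕ.+ length (N ++ map f ys)                  ≤⟨ ℕP.+-monoʳ-≤ (length F) bound ⟩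
    length F ℕ.+ k                                       ∎
    where
    open ℕP.≤-Reasoning
    F? : Decidable (λ x → Any (λ y → x ≈[ ℓ ] f y) ys)
    F? x = any? (λ y → ≈-dec ℓ x (f y)) ys
    F = filter F? xs
    N = filter (¬? ∘ F?) xs
    N⁻ : ∀ {x} → x ∈ N → x ∈ xs × ¬ Any (λ y → x ≈[ ℓ ] f y) ys
    N⁻ = ∈-filter⁻ (¬? ∘ F?)
    disj : ∀ {x} → x ∈ N → x ∈ map f ys → ⊥
    disj x∈ x∈′ with ∈-map⁻ f x∈′
    ... | y , y∈ , refl = proj₂ (N⁻ x∈) (lose y∈ (≈-reflexive refl))
    fy-inj : InjectiveOn f ys
    fy-inj y∈ y′∈ eq = incy y∈ y′∈ (≈-reflexive eq)
    unique : Unique (N ++ map f ys)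
    unique = ++-unique (filter-unique (¬? ∘ F?) u) (map-unique f ys fy-inj v) disj
    cover : ∀ {x} → x ∈ N ++ map f ys → ∃[ w ] (x ≈[ ℓ ] w × Q w)
    cover m with ∈-++⁻ N m
    ... | inj₁ a = cx (proj₁ (N⁻ a))
    ... | inj₂ b with ∈-map⁻ f b
    ...   | y , y∈ , refl = cy y∈
    inj : ∀ {x x′ w} → x ∈ N ++ map f ys → x′ ∈ N ++ map f ys → x ≈[ ℓ ] w → x′ ≈[ ℓ ] w → x ≡ x′
    inj m m′ p p′ with ∈-++⁻ N m | ∈-++⁻ N m′
    ... | inj₁ a | inj₁ a′ = incx (proj₁ (N⁻ a)) (proj₁ (N⁻ a′)) (≈-trans p (≈-sym p′))
    ... | inj₁ a | inj₂ b′ with ∈-map⁻ f b′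
    ...   | y , y∈ , refl = ⊥-elim (proj₂ (N⁻ a) (lose y∈ (≈-trans p (≈-sym p′))))
    inj m m′ p p′ | inj₂ b | inj₁ a′ with ∈-map⁻ f b
    ...   | y , y∈ , refl = ⊥-elim (proj₂ (N⁻ a′) (lose y∈ (≈-trans p′ (≈-sym p))))
    inj m m′ p p′ | inj₂ b | inj₂ b′ with ∈-map⁻ f b | ∈-map⁻ f b′
    ...   | y , y∈ , refl | y′ , y′∈ , refl = cong f (incy y∈ y′∈ (≈-trans p (≈-sym p′)))
    bound : length (N ++ map f ys) ℕ.≤ k
    bound = pigeonhole (λ x w → x ≈[ ℓ ] w) unique cover inj q

  -- By Bézout a set closed under differences contains the gcd of any finite list of its elements.
  -- The subgroup is thus replaced by the multiples of one of its own elements, although membership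
  -- in `D` is not decided.
  generator : (D : ℤ → Set) → D 0ℤ → (∀ {x y} → D x → D y → D (x - y)) → (xs : List ℤ) → All D xs →
    ∃[ g ] (D (+ g) × All (+ g ∣_) xs)
  generator D D0 sub [] [] = 0 , D0 , []
  generator D D0 sub (x ∷ xs) (Dx ∷ all) with generator D D0 sub xs all
  ... | g , Dg , g∣ = h , Dh (Bézout.identity (gcd-GCD ∣ x ∣ g)) , ∣ᵤ⇒∣ (gcd[m,n]∣m ∣ x ∣ g) ∷ All.map (∣-trans (∣ᵤ⇒∣ (gcd[m,n]∣n ∣ x ∣ g))) g∣
    where
    h = gcd ∣ x ∣ g
    neg : ∀ {y} → D y → D (- y)
    neg {y} Dy = subst D (ℤP.+-identityˡ (- y)) (sub D0 Dy)
    add : ∀ {y z} → D y → D z → D (y + z)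
    add {y} {z} Dy Dz = subst D (cong (_+_ y) (ℤP.neg-involutive z)) (sub Dy (neg Dz))
    abs : ∀ y → D y → D (+ ∣ y ∣)
    abs (+ _) Dy = Dy
    abs y@(ℤ.-[1+ _ ]) Dy = neg Dy
    multiple : ∀ {y} k → D (+ y) → D (+ (k ℕ.* y))
    multiple zero Dy = D0
    multiple (suc k) Dy = add Dy (multiple k Dy)
    cancel : ∀ x y z → x ℕ.+ y ≡ z → D (+ y) → D (+ z) → D (+ x)
    cancel x y z refl Dy Dz = subst D (identity (+ x) (+ y)) (sub Dz Dy)
      where
      identity : ∀ x y → (x + y) - y ≡ x
      identity = ℤ-solve
    Dh : Bézout.Identity h ∣ x ∣ g → D (+ h)
    Dh (Bézout.+- i j eq) = cancel h (j ℕ.* g) (i ℕ.* ∣ x ∣) eq (multiple j Dg) (multiple i (abs x Dx))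
    Dh (Bézout.-+ i j eq) = cancel h (i ℕ.* ∣ x ∣) (j ℕ.* g) eq (multiple i (abs x Dx)) (multiple j Dg)

  residue : ∀ q d {w z₀} .{{_ : ℕ.NonZero q}} → w ≈[ + d ] z₀ →
    ∃[ j ] (j ℕ.< q × w ≈[ + (q ℕ.* d) ] z₀ + + (j ℕ.* d))
  residue q d {w} {z₀} (congruent (divides t eq)) = t %ℕ q , n%ℕd<d t q , congruent (divides (t /ℕ q) (begin
    w - (z₀ + + (t %ℕ q ℕ.* d))                            ≡⟨ cong (λ k → w - (z₀ + k)) (ℤP.pos-* (t %ℕ q) d) ⟩
    w - (z₀ + + (t %ℕ q) * + d)                            ≡⟨ regroup w z₀ (+ (t %ℕ q) * + d) ⟩
    (w - z₀) - + (t %ℕ q) * + d                            ≡⟨ cong (_- + (t %ℕ q) * + d) (trans eq (cong (_* + d) (a≡a%ℕn+[a/ℕn]*n t q))) ⟩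
    (+ (t %ℕ q) + (t /ℕ q) * + q) * + d - + (t %ℕ q) * + d ≡⟨ simplify (+ (t %ℕ q)) (t /ℕ q) (+ q) (+ d) ⟩
    (t /ℕ q) * (+ q * + d)                                 ≡⟨ cong (_*_ (t /ℕ q)) (sym (ℤP.pos-* q d)) ⟩
    (t /ℕ q) * + (q ℕ.* d)                                 ∎))
    where
    open ≡-Reasoning
    regroup : ∀ w z k → w - (z + k) ≡ (w - z) - k
    regroup = ℤ-solve
    simplify : ∀ r u q d → (r + u * q) * d - r * d ≡ u * (q * d)
    simplify = ℤ-solve

  AtMost-progression : ∀ l d q → AtMost q (λ w → ∃[ j ] (j ℕ.< q × w ≡ l + + (j ℕ.* d)))
  AtMost-progression l d q ws u all = pigeonhole (λ w j → w ≡ l + + (j ℕ.* d)) u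
    (λ w∈ → let j , j< , eq = All.lookup all w∈ in j , eq , j<) (λ _ _ p r → trans p (sym r)) (AtMost-< q)

  module _ (C : Config) where
    open Config C

    -- Each class common to `xs` and to the reflection `z - ys` gives a pair with sum congruent to
    -- `z`. If both sets fall into `k` classes, the excess of their total size over `k` counts such
    -- pairs.
    representations : ∀ {ℓ k z} {Q : ℤ → Set} {xs ys : List ℤ} → Unique xs → Unique ys →
      (∀ {x} → x ∈ xs → x ∈ A) → (∀ {y} → y ∈ ys → y ∈ B) →
      Incongruent ℓ xs → Incongruent ℓ ys →
      (∀ {x} → x ∈ xs → ∃[ w ] (x ≈[ ℓ ] w × Q w)) → (∀ {y} → y ∈ ys → ∃[ w ] (z - y ≈[ ℓ ] w × Q w)) →
      AtMost k Q → suc e ℕ.+ k ℕ.≤ length xs ℕ.+ length ys → Representations C ℓ z (suc e)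
    representations {ℓ} {k} {z} {Q} {xs} {ys} u v ⊆A ⊆B incx incy cx cy q large
      with choosePairs {R = λ x y → y ∈ ys × x ≈[ ℓ ] z - y} (filter-unique F? u) pick
      where
      F? : Decidable (λ x → Any (λ y → x ≈[ ℓ ] z - y) ys)
      F? x = any? (λ y → ≈-dec ℓ x (z - y)) ys
      pick : ∀ {x} → x ∈ filter F? xs → ∃[ y ] (y ∈ ys × x ≈[ ℓ ] z - y)
      pick m = find (proj₂ (∈-filter⁻ F? {xs = xs} m))
    ... | ps , up , lp , ap = ps , up
        , ℕP.≤-trans (ℕP.+-cancelʳ-≤ k _ _ (ℕP.≤-trans large (class-overlap (_-_ z) u v incx incy′ cx cy q))) (ℕP.≤-reflexive (sym lp))
        , All.map (λ {r} (x∈ , y∈ , p) → ⊆A (proj₁ (∈-filter⁻ _ x∈)) , ⊆B y∈ , ≈-shift p (move (proj₁ r) (proj₂ r) z)) ap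
      where
      move : ∀ x y z → x - (z - y) ≡ (x + y) - z
      move = ℤ-solve
      flip-sign : ∀ y y′ z → (z - y) - (z - y′) ≡ y′ - y
      flip-sign = ℤ-solve
      incy′ : ∀ {y y′} → y ∈ ys → y′ ∈ ys → z - y ≈[ ℓ ] z - y′ → y ≡ y′
      incy′ {y} {y′} y∈ y′∈ p = sym (incy y′∈ y∈ (≈-shift p (flip-sign y y′ z)))

    -- Equivalently `x′ - x` is congruent to `b₁ - b₂`: the element `x` starts a representation of
    -- this difference inside `xs`. The additive form compares two sums directly.
    Translated : ℤ → List ℤ → ℤ → ℤ → ℤ → Set
    Translated ℓ xs b₁ b₂ x = Any (λ x′ → x + b₁ ≈[ ℓ ] x′ + b₂) xs

    translated? : ∀ ℓ xs b₁ b₂ x → Dec (Translated ℓ xs b₁ b₂ x)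
    translated? ℓ xs b₁ b₂ x = any? (λ x′ → ≈-dec ℓ (x + b₁) (x′ + b₂)) xs

    -- Both xs + b₁ and xs + b₂ lie in the sumset up to e elements each.
    popular : ∀ {L Y xs b₁ b₂} → 0 ℕ.< L → LeadBound C (+ L) Y → Unique xs → (∀ {x} → x ∈ xs → x ∈ A) →
      Incongruent (+ L) xs → b₁ ∈ B → b₂ ∈ B →
      2 ℕ.* length xs ℕ.+ length Y ℕ.≤ length (filter (translated? (+ L) xs b₁ b₂) xs) ℕ.+ (s ℕ.+ 4 ℕ.* e)
    popular {L} {Y} {xs} {b₁} {b₂} L>0 bound u ⊆A inc b₁∈ b₂∈ =
      lin 0 (most b₁∈ ⊕ most b₂∈ ⊕ both ⊕ F≤ ⊕ ℕP.≤-reflexive K-def)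
        (arith (length xs) (length Y) s e (length (X b₁)) (length (X b₂)) (length F′) K (length F))
      where
      ℓ = + L
      arith : ∀ n y s e x₁ x₂ f′ k f →
        2 ℕ.* n ℕ.+ y ℕ.+ (x₁ ℕ.+ e ℕ.+ (x₂ ℕ.+ e) ℕ.+ (f′ ℕ.+ k) ℕ.+ f ℕ.+ (s ℕ.+ 2 ℕ.* e)) ℕ.+ 0
        ≡ f ℕ.+ (s ℕ.+ 4 ℕ.* e) ℕ.+ (n ℕ.+ n ℕ.+ (x₁ ℕ.+ x₂) ℕ.+ f′ ℕ.+ (k ℕ.+ y))
      arith = ℕ-solve
      X : ℤ → List ℤ
      X b = filter (λ a → G? a b) xs
      X⁻ : ∀ {b a} → a ∈ X b → a ∈ xs × G a b
      X⁻ {b} = ∈-filter⁻ (λ a → G? a b)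
      X-unique : ∀ b → Unique (X b)
      X-unique b = filter-unique (λ a → G? a b) u
      most : ∀ {b} → b ∈ B → length xs ℕ.≤ length (X b) ℕ.+ e
      most {b} b∈ = filter-most (λ a → G? a b) u (AtMost-⊆ (λ (m , n) → ⊆A m , n) (missB b∈))
      K = s ℕ.+ 2 ℕ.* e ℕ.∸ length Y
      K-def : K ℕ.+ length Y ≡ s ℕ.+ 2 ℕ.* e
      K-def = ℕP.m∸n+n≡m (bound [] [] [])
      X₁ = map (_+ b₁) (X b₁)
      F?′ : Decidable (λ x → Any (λ y → x ≈[ ℓ ] y + b₂) (X b₂))
      F?′ x = any? (λ y → ≈-dec ℓ x (y + b₂)) (X b₂)
      F′ = filter F?′ X₁
      F = filter (translated? ℓ xs b₁ b₂) xs
      cancel : ∀ {x y} b → x + b ≈[ ℓ ] y + b → x ≈[ ℓ ] y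
      cancel {x} {y} b p = ≈-shift p (identity x y b)
        where
        identity : ∀ x y b → (x + b) - (y + b) ≡ x - y
        identity = ℤ-solve
      lead : ∀ {a b} → a ∈ X b → b ∈ B → ∃[ w ] (a + b ≈[ ℓ ] w × Lead C ℓ w)
      lead a∈ b∈ with lead-exists C L>0 (sums (⊆A (proj₁ (X⁻ a∈))) b∈ (proj₂ (X⁻ a∈)))
      ... | w , lw , p = w , ≈-sym p , lw
      incX₁ : Incongruent ℓ X₁
      incX₁ m m′ p with ∈-map⁻ (_+ b₁) m | ∈-map⁻ (_+ b₁) m′
      ... | a , a∈ , refl | a′ , a′∈ , refl = cong (_+ b₁) (inc (proj₁ (X⁻ a∈)) (proj₁ (X⁻ a′∈)) (cancel b₁ p))
      X₁-unique : Unique X₁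
      X₁-unique = Uniq.map⁺ (ℤ-cancelʳ b₁ _ _) (X-unique b₁)
      coverX₁ : ∀ {x} → x ∈ X₁ → ∃[ w ] (x ≈[ ℓ ] w × Lead C ℓ w)
      coverX₁ m with ∈-map⁻ (_+ b₁) m
      ... | a , a∈ , refl = lead a∈ b₁∈
      both : length (X b₁) ℕ.+ length (X b₂) ℕ.≤ length F′ ℕ.+ K
      both = subst (λ k → k ℕ.+ length (X b₂) ℕ.≤ length F′ ℕ.+ K) (length-map (_+ b₁) (X b₁))
        (class-overlap (_+ b₂) X₁-unique (X-unique b₂) incX₁
          (λ y∈ y′∈ p → inc (proj₁ (X⁻ y∈)) (proj₁ (X⁻ y′∈)) (cancel b₂ p))
          coverX₁ (λ y∈ → lead y∈ b₂∈)
          (λ zs v all → ℕP.m+n≤o⇒m≤o∸n (length zs) (bound zs v all)))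
      F≤ : length F′ ℕ.≤ length F
      F≤ = pigeonhole (λ x a → x ≡ a + b₁) (filter-unique F?′ X₁-unique) back (λ _ _ p q → trans p (sym q)) (AtMost-∈ F)
        where
        back : ∀ {x} → x ∈ F′ → ∃[ a ] (x ≡ a + b₁ × a ∈ F)
        back m with ∈-filter⁻ F?′ {xs = X₁} m
        ... | m₁ , any with ∈-map⁻ (_+ b₁) m₁ | find any
        ... | a , a∈ , refl | a′ , a′∈ , p =
          a , refl , ∈-filter⁺ (translated? ℓ xs b₁ b₂) (proj₁ (X⁻ a∈)) (lose (proj₁ (X⁻ a′∈)) p)

  -- Sets of equal size

  record Hull (X : List ℤ) (l r : ℤ) : Set where
    field
      left : l ∈ X
      right : r ∈ X
      lower : ∀ {x} → x ∈ X → l ℤ.≤ x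
      upper : ∀ {x} → x ∈ X → x ℤ.≤ r

  -- Dropping the right end makes the residues modulo the length of the hull distinct.
  trim : ℤ → List ℤ → List ℤ
  trim r = filter (λ x → ¬? (x ℤP.≟ r))

  trim⁻ : ∀ {r X x} → x ∈ trim r X → x ∈ X × x ≢ r
  trim⁻ {r} = ∈-filter⁻ (λ x → ¬? (x ℤP.≟ r))

  trim-unique : ∀ {r X} → Unique X → Unique (trim r X)
  trim-unique {r} = filter-unique (λ x → ¬? (x ℤP.≟ r))

  trim-length : ∀ {r X} → Unique X → length X ℕ.≤ length (trim r X) ℕ.+ 1
  trim-length {r} {X} u = filter-most (λ x → ¬? (x ℤP.≟ r)) u
    (AtMost-⊆ (λ {x} (_ , ¬¬eq) → here (Dec.decidable-stable (x ℤP.≟ r) ¬¬eq)) (AtMost-∈ (r ∷ [])))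

  trim-≤ : ∀ {r X} → Unique X → length (trim r X) ℕ.≤ length X
  trim-≤ {r} {X} u = length-⊆ {ys = X} (trim-unique {r} {X} u) (proj₁ ∘ trim⁻ {r} {X})

  trim-window : ∀ {X l r x} L → Hull X l r → r ℤ.≤ l + + L → x ∈ trim r X → l ℤ.≤ x × x ℤ.< l + + L
  trim-window L h r≤ m = let x∈ , x≢r = trim⁻ m in
    lower x∈ , ℤP.<-≤-trans (ℤP.≤∧≢⇒< (upper x∈) x≢r) r≤
    where open Hull h

  private
    -- So `f` exceeds half of `n`. Of the `17 e`, `8 e` pay for twice the loss in `popular`; the
    -- trimmed point costs 4, one of which is returned by the hypothesis on `s`.
    popular-arith : ∀ n n′ s e f → n ℕ.≤ n′ ℕ.+ 1 → 2 ℕ.* s ℕ.+ 17 ℕ.* e ℕ.+ 1 ℕ.≤ 5 ℕ.* n →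
      2 ℕ.* n′ ℕ.+ n ℕ.≤ f ℕ.+ (s ℕ.+ 4 ℕ.* e) → n ℕ.+ 9 ℕ.* e ℕ.≤ 2 ℕ.* f ℕ.+ 3
    popular-arith n n′ s e f h₁ h₂ h₃ = lin 0 (4 ⊛ h₁ ⊕ h₂ ⊕ 2 ⊛ h₃) (identity n n′ s e f)
      where
      identity : ∀ n n′ s e f → n ℕ.+ 9 ℕ.* e ℕ.+ (4 ℕ.* (n′ ℕ.+ 1) ℕ.+ 5 ℕ.* n ℕ.+ 2 ℕ.* (f ℕ.+ (s ℕ.+ 4 ℕ.* e))) ℕ.+ 0
        ≡ 2 ℕ.* f ℕ.+ 3 ℕ.+ (4 ℕ.* n ℕ.+ (2 ℕ.* s ℕ.+ 17 ℕ.* e ℕ.+ 1) ℕ.+ 2 ℕ.* (2 ℕ.* n′ ℕ.+ n))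
      identity = ℕ-solve

    -- As `2 ρ` is at least `n + 9 e - 3`, the product bound gives q (n + 9e - 3) ≤ 2n², and
    -- `16 e ≤ n` keeps such a `q` below `2 n` by the required margin.
    period-arith : ∀ n e ρ q → 1 ℕ.≤ e → 16 ℕ.* e ℕ.≤ n → n ℕ.+ 9 ℕ.* e ℕ.≤ 2 ℕ.* ρ ℕ.+ 3 → q ℕ.* ρ ℕ.≤ n ℕ.* n →
      q ℕ.+ e ℕ.+ 3 ℕ.≤ 2 ℕ.* n
    period-arith n (suc u) ρ q 1≤e 16e≤n ρ-large qρ with ℕP.m≤n⇒∃[o]m+o≡n 16e≤n
    ... | t , refl with q ℕ.+ suc u ℕ.+ 3 ℕP.≤? 2 ℕ.* (16 ℕ.* suc u ℕ.+ t)
    ...   | yes h = h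
    ...   | no ¬h = ⊥-elim (ℕP.<-irrefl refl (lin {1} {0} (125 ℕ.+ 383 ℕ.* u ℕ.+ 263 ℕ.* u ℕ.* u ℕ.+ 9 ℕ.* t ℕ.+ 17 ℕ.* u ℕ.* t) (w ⊛ small ⊕ q ⊛ ρ-large ⊕ 2 ⊛ qρ) (id₂ q u t ρ)))
      where
      id₂ : ∀ q u t ρ → 1 ℕ.+ ((22 ℕ.+ 25 ℕ.* u ℕ.+ t) ℕ.* (q ℕ.+ u ℕ.+ 3) ℕ.+ q ℕ.* (2 ℕ.* ρ ℕ.+ 3)
          ℕ.+ 2 ℕ.* ((16 ℕ.* suc u ℕ.+ t) ℕ.* (16 ℕ.* suc u ℕ.+ t)))
          ℕ.+ (125 ℕ.+ 383 ℕ.* u ℕ.+ 263 ℕ.* u ℕ.* u ℕ.+ 9 ℕ.* t ℕ.+ 17 ℕ.* u ℕ.* t)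
        ≡ 0 ℕ.+ ((22 ℕ.+ 25 ℕ.* u ℕ.+ t) ℕ.* (2 ℕ.* (16 ℕ.* suc u ℕ.+ t)) ℕ.+ q ℕ.* (16 ℕ.* suc u ℕ.+ t ℕ.+ 9 ℕ.* suc u) ℕ.+ 2 ℕ.* (q ℕ.* ρ))
      id₂ = ℕ-solve
      -- This is n + 9e - 3 for e = u + 1 and n = 16e + t. Multiplying the negated claim by it gives
      -- a lower bound for q (n + 9e - 3) that exceeds 2n².
      w = 22 ℕ.+ 25 ℕ.* u ℕ.+ t
      small : 2 ℕ.* (16 ℕ.* suc u ℕ.+ t) ℕ.≤ q ℕ.+ u ℕ.+ 3
      small = lin 0 (ℕP.≰⇒> ¬h) (id₁ q u t)
        where
        id₁ : ∀ q u t → 2 ℕ.* (16 ℕ.* suc u ℕ.+ t) ℕ.+ (q ℕ.+ suc u ℕ.+ 3) ℕ.+ 0 ≡ q ℕ.+ u ℕ.+ 3 ℕ.+ suc (2 ℕ.* (16 ℕ.* suc u ℕ.+ t))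
        id₁ = ℕ-solve

  Progressions : Config → (aL aR bL bR : ℤ) → Set
  Progressions C aL aR bL bR = ∃[ d ] ∃[ q ] (0 ℕ.< d
    × (∀ {a} → a ∈ A → a ≈[ + d ] aL) × (∀ {b} → b ∈ B → b ≈[ + d ] bL)
    × aR ℤ.≤ aL + + (q ℕ.* d) × bR ℤ.≤ bL + + (q ℕ.* d)
    × q ℕ.+ length B ℕ.≤ s ℕ.+ 3 ℕ.* e)
    where open Config C

  -- Freiman's 3/2 argument modulo the longer hull: every difference of B is a difference of A in more
  -- than |A|/2 ways and conversely, so the two difference sets agree and form a subgroup.
  equal-size-structure-long : (C : Config) (n L : ℕ) {aL aR bL bR : ℤ} → let open Config C in
    length A ≡ n → length B ≡ n → 1 ℕ.≤ e → 16 ℕ.* e ℕ.≤ n → 2 ℕ.* s ℕ.+ 17 ℕ.* e ℕ.+ 1 ℕ.≤ 5 ℕ.* n →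
    Hull A aL aR → Hull B bL bR → 0 ℕ.< L → aR - aL ≡ + L → bR ℤ.≤ bL + + L → Progressions C aL aR bL bR
  equal-size-structure-long C n L {aL} {aR} {bL} {bR} lenA lenB 1≤e 16e≤n small hA hB L>0 aR-aL bR≤ =
    conclusion (generator D D0 D-sub differences D-all)
    where
    open Config C
    module hA = Hull hA
    module hB = Hull hB
    ℓ = + L
    aR≡ : aR ≡ aL + ℓ
    aR≡ = trans (identity aL aR) (cong (_+_ aL) aR-aL)
      where
      identity : ∀ x y → y ≡ x + (y - x)
      identity = ℤ-solve
    A° = trim aR A
    B° = trim bR B
    uA° : Unique A°
    uA° = trim-unique uniqueA
    uB° : Unique B°
    uB° = trim-unique uniqueB
    A°⊆ : ∀ {x} → x ∈ A° → x ∈ A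
    A°⊆ = proj₁ ∘ trim⁻ {aR} {A}
    B°⊆ : ∀ {x} → x ∈ B° → x ∈ B
    B°⊆ = proj₁ ∘ trim⁻ {bR} {B}
    n≤A° : n ℕ.≤ length A° ℕ.+ 1
    n≤A° = subst (ℕ._≤ length A° ℕ.+ 1) lenA (trim-length uniqueA)
    n≤B° : n ℕ.≤ length B° ℕ.+ 1
    n≤B° = subst (ℕ._≤ length B° ℕ.+ 1) lenB (trim-length uniqueB)
    A°≤n : length A° ℕ.≤ n
    A°≤n = subst (length A° ℕ.≤_) lenA (trim-≤ {aR} {A} uniqueA)
    B°≤n : length B° ℕ.≤ n
    B°≤n = subst (length B° ℕ.≤_) lenB (trim-≤ {bR} {B} uniqueB)
    incA° : Incongruent ℓ A°
    incA° = incongruent-window (trim-window L hA (ℤP.≤-reflexive aR≡))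
    incB° : Incongruent ℓ B°
    incB° = incongruent-window (trim-window L hB bR≤)
    bound : LeadBound C ℓ B
    bound = subst (λ ℓ → LeadBound C ℓ B) aR-aL (lead-bound C hA.left hA.right)
    FA : ℤ → ℤ → List ℤ
    FA b₁ b₂ = filter (translated? C ℓ A° b₁ b₂) A°
    FB : ℤ → ℤ → List ℤ
    FB a₁ a₂ = filter (translated? (flip C) ℓ B° a₁ a₂) B°
    popA₀ : ∀ {b₁ b₂} → b₁ ∈ B → b₂ ∈ B → 2 ℕ.* length A° ℕ.+ n ℕ.≤ length (FA b₁ b₂) ℕ.+ (s ℕ.+ 4 ℕ.* e)
    popA₀ {b₁} {b₂} b₁∈ b₂∈ = subst (λ k → 2 ℕ.* length A° ℕ.+ k ℕ.≤ length (FA b₁ b₂) ℕ.+ (s ℕ.+ 4 ℕ.* e)) lenB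
      (popular C {Y = B} L>0 bound uA° A°⊆ incA° b₁∈ b₂∈)
    popA : ∀ {b₁ b₂} → b₁ ∈ B → b₂ ∈ B → n ℕ.+ 9 ℕ.* e ℕ.≤ 2 ℕ.* length (FA b₁ b₂) ℕ.+ 3
    popA {b₁} {b₂} b₁∈ b₂∈ = popular-arith n (length A°) s e (length (FA b₁ b₂)) n≤A° small (popA₀ b₁∈ b₂∈)
    popB : ∀ {a₁ a₂} → a₁ ∈ A → a₂ ∈ A → n ℕ.+ 9 ℕ.* e ℕ.≤ 2 ℕ.* length (FB a₁ a₂) ℕ.+ 3
    popB {a₁} {a₂} a₁∈ a₂∈ = popular-arith n (length B°) s e (length (FB a₁ a₂)) n≤B° small
      (subst (λ k → 2 ℕ.* length B° ℕ.+ k ℕ.≤ length (FB a₁ a₂) ℕ.+ (s ℕ.+ 4 ℕ.* e)) lenB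
        (popular (flip C) {Y = B} L>0 bound uB° B°⊆ incB° a₁∈ a₂∈))
    common : ∀ f g → n ℕ.+ 9 ℕ.* e ℕ.≤ 2 ℕ.* f ℕ.+ 3 → n ℕ.+ 9 ℕ.* e ℕ.≤ 2 ℕ.* g ℕ.+ 3 → n ℕ.< f ℕ.+ g
    common f g p q = ℕP.*-cancelˡ-≤ 2 (lin 10 (p ⊕ q ⊕ 18 ⊛ 1≤e) (identity n e f g))
      where
      identity : ∀ n e f g → 2 ℕ.* suc n ℕ.+ (2 ℕ.* f ℕ.+ 3 ℕ.+ (2 ℕ.* g ℕ.+ 3) ℕ.+ 18 ℕ.* e) ℕ.+ 10
        ≡ 2 ℕ.* (f ℕ.+ g) ℕ.+ (n ℕ.+ 9 ℕ.* e ℕ.+ (n ℕ.+ 9 ℕ.* e) ℕ.+ 18)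
      identity = ℕ-solve
    D : ℤ → Set
    D x = ∃[ a ] ∃[ a′ ] (a ∈ A × a′ ∈ A × x ≈[ ℓ ] a - a′)
    D′ : ℤ → Set
    D′ x = ∃[ b ] ∃[ b′ ] (b ∈ B × b′ ∈ B × x ≈[ ℓ ] b - b′)
    swap : ∀ a a′ b b′ → a + b ≈[ ℓ ] a′ + b′ → b - b′ ≈[ ℓ ] a′ - a
    swap a a′ b b′ p = ≈-shift p (identity a a′ b b′)
      where
      identity : ∀ a a′ b b′ → (a + b) - (a′ + b′) ≡ (b - b′) - (a′ - a)
      identity = ℤ-solve
    D′⇒D : ∀ {x} → D′ x → D x
    -- Intersecting the set of starting points with itself merely shows that it is nonempty, its
    -- double count exceeding the size of `A°`.
    D′⇒D {x} (b , b′ , b∈ , b′∈ , p) = shared (filter-∩ (translated? C ℓ A° b b′) (translated? C ℓ A° b b′) uA°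
        (ℕP.≤-<-trans A°≤n (common (length (FA b b′)) (length (FA b b′)) (popA b∈ b′∈) (popA b∈ b′∈))))
      where
      shared : ∃[ a ] (a ∈ A° × Translated C ℓ A° b b′ a × Translated C ℓ A° b b′ a) → D x
      shared (a , a∈ , any , _) = let a′ , a′∈ , r = find any in
        a′ , a , A°⊆ a′∈ , A°⊆ a∈ , ≈-trans p (swap a a′ b b′ r)
    D⇒D′ : ∀ {x} → D x → D′ x
    D⇒D′ {x} (a , a′ , a∈ , a′∈ , p) = shared (filter-∩ (translated? (flip C) ℓ B° a a′) (translated? (flip C) ℓ B° a a′) uB°
        (ℕP.≤-<-trans B°≤n (common (length (FB a a′)) (length (FB a a′)) (popB a∈ a′∈) (popB a∈ a′∈))))
      where
      shared : ∃[ b ] (b ∈ B° × Translated (flip C) ℓ B° a a′ b × Translated (flip C) ℓ B° a a′ b) → D′ x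
      shared (b , b∈ , any , _) = let b′ , b′∈ , r = find any in
        b′ , b , B°⊆ b′∈ , B°⊆ b∈ , ≈-trans p (swap b b′ a a′ r)
    D′-sub : ∀ {x y} → D′ x → D′ y → D (x - y)
    -- Each difference has starting points in more than half of `A`, so both have a common one `a`.
    -- Subtracting `a″ - a` from `a′ - a` leaves a difference of two elements of `A`.
    D′-sub {x} {y} (b₁ , b₂ , b₁∈ , b₂∈ , p) (b₃ , b₄ , b₃∈ , b₄∈ , p′) =
      shared (filter-∩ (translated? C ℓ A° b₁ b₂) (translated? C ℓ A° b₃ b₄) uA°
        (ℕP.≤-<-trans A°≤n (common (length (FA b₁ b₂)) (length (FA b₃ b₄)) (popA b₁∈ b₂∈) (popA b₃∈ b₄∈))))
      where
      identity : ∀ a a′ a″ → (a′ - a) - (a″ - a) ≡ a′ - a″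
      identity = ℤ-solve
      shared : ∃[ a ] (a ∈ A° × Translated C ℓ A° b₁ b₂ a × Translated C ℓ A° b₃ b₄ a) → D (x - y)
      shared (a , a∈ , any , any′) = let a′ , a′∈ , r = find any ; a″ , a″∈ , r′ = find any′ in
        a′ , a″ , A°⊆ a′∈ , A°⊆ a″∈ ,
        ≈-trans (≈-∸ (≈-trans p (swap a a′ b₁ b₂ r)) (≈-trans p′ (swap a a″ b₃ b₄ r′))) (≈-reflexive (identity a a′ a″))
    D-sub : ∀ {x y} → D x → D y → D (x - y)
    D-sub x y = D′-sub (D⇒D′ x) (D⇒D′ y)
    D0 : D 0ℤ
    D0 = aL , aL , hA.left , hA.left , ≈-reflexive (sym (ℤP.+-inverseʳ aL))
    differences : List ℤ
    -- Including `ℓ` makes `d` a divisor of `L`, so that the multiples of `d` close up modulo the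
    -- hull and `d` is nonzero.
    differences = ℓ ∷ map (_- aL) A ++ map (_- bL) B
    D-all : All D differences
    D-all = (aR , aL , hA.right , hA.left , ≈-reflexive (sym aR-aL))
      ∷ AllP.++⁺ (AllP.map⁺ (All.tabulate λ a∈ → _ , aL , a∈ , hA.left , ≈-reflexive refl))
                 (AllP.map⁺ (All.tabulate λ b∈ → D′⇒D (_ , bL , b∈ , hB.left , ≈-reflexive refl)))
    conclude : ∀ d q → D (+ d) → All (+ d ∣_) (map (_- aL) A ++ map (_- bL) B) → L ≡ q ℕ.* d → Progressions C aL aR bL bR
    conclude d q Dd d∣ L≡qd = d , q , d>0 , a≈ , b≈
          , ℤP.≤-reflexive (trans aR≡ (cong (λ k → aL + + k) L≡qd))
          , subst (λ k → bR ℤ.≤ bL + + k) L≡qd bR≤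
          , class-count C q d (aL + bL) hA.left hA.right (trans aR-aL (cong +_ L≡qd)) qd>0 reps
      where
      qd>0 : 0 ℕ.< q ℕ.* d
      qd>0 = subst (0 ℕ.<_) L≡qd L>0
      instance
        q≢0 : ℕ.NonZero q
        q≢0 = ℕP.m*n≢0⇒m≢0 q {d} {{ℕ.>-nonZero qd>0}}
      d>0 : 0 ℕ.< d
      d>0 = ℕ.>-nonZero⁻¹ d {{ℕP.m*n≢0⇒n≢0 q {d} {{ℕ.>-nonZero qd>0}}}}
      a≈ : ∀ {a} → a ∈ A → a ≈[ + d ] aL
      a≈ a∈ = congruent (All.lookup d∣ (∈-++⁺ˡ (∈-map⁺ (_- aL) a∈)))
      b≈ : ∀ {b} → b ∈ B → b ≈[ + d ] bL
      b≈ b∈ = congruent (All.lookup d∣ (∈-++⁺ʳ (map (_- aL) A) (∈-map⁺ (_- bL) b∈)))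
      multiple : ∀ k → D (+ (k ℕ.* d))
      multiple zero = D0
      multiple (suc k) = subst D (identity (+ d) (+ (k ℕ.* d))) (D-sub Dd (D-sub D0 (multiple k)))
        where
        identity : ∀ x y → x - (0ℤ - y) ≡ x + y
        identity = ℤ-solve
      -- This is the number of representations that `popular` guarantees. The `q` multiples of `d`
      -- are distinct modulo `ℓ`, so their representations are disjoint sets of pairs in A° × A°,
      -- whence q ρ ≤ n².
      ρ = 2 ℕ.* length A° ℕ.+ n ℕ.∸ (s ℕ.+ 4 ℕ.* e)
      ρ-large : n ℕ.+ 9 ℕ.* e ℕ.≤ 2 ℕ.* ρ ℕ.+ 3
      ρ-large = popular-arith n (length A°) s e ρ n≤A° small (subst (2 ℕ.* length A° ℕ.+ n ℕ.≤_) (ℕP.+-comm (s ℕ.+ 4 ℕ.* e) ρ) (ℕP.m≤n+m∸n (2 ℕ.* length A° ℕ.+ n) (s ℕ.+ 4 ℕ.* e)))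
      ways : ∀ k → ∃[ ps ] (Unique ps × ρ ℕ.≤ length ps ×
        All (λ p → (proj₁ p + + (k ℕ.* d) ≈[ ℓ ] proj₂ p) × proj₁ p ∈ A° × proj₂ p ∈ A°) ps)
      ways k = let b₁ , b₂ , b₁∈ , b₂∈ , p = D⇒D′ (multiple k) in translates b₁ b₂ b₁∈ b₂∈ p
        where
        identity : ∀ x y → x + (y - x) ≡ y
        identity = ℤ-solve
        translates : ∀ b₁ b₂ → b₁ ∈ B → b₂ ∈ B → + (k ℕ.* d) ≈[ ℓ ] b₁ - b₂ → ∃[ ps ] (Unique ps × ρ ℕ.≤ length ps ×
          All (λ p → (proj₁ p + + (k ℕ.* d) ≈[ ℓ ] proj₂ p) × proj₁ p ∈ A° × proj₂ p ∈ A°) ps)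
        translates b₁ b₂ b₁∈ b₂∈ p =
          let ps , up , lp , ap = choosePairs {R = λ a a′ → a′ ∈ A° × a + b₁ ≈[ ℓ ] a′ + b₂}
                (filter-unique (translated? C ℓ A° b₁ b₂) uA°)
                (λ m → find (proj₂ (∈-filter⁻ (translated? C ℓ A° b₁ b₂) {xs = A°} m)))
          in ps , up
            , subst (ρ ℕ.≤_) (sym lp) (ℕP.m≤n+o⇒m∸n≤o (2 ℕ.* length A° ℕ.+ n) (s ℕ.+ 4 ℕ.* e)
                (subst (2 ℕ.* length A° ℕ.+ n ℕ.≤_) (ℕP.+-comm (length (FA b₁ b₂)) (s ℕ.+ 4 ℕ.* e)) (popA₀ b₁∈ b₂∈)))
            , All.map (λ {x} (m , m′ , r) →
                ≈-trans (≈-+ (≈-refl (proj₁ x)) (≈-trans p (swap (proj₁ x) (proj₂ x) b₁ b₂ r))) (≈-reflexive (identity (proj₁ x) (proj₂ x)))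
                , proj₁ (∈-filter⁻ (translated? C ℓ A° b₁ b₂) {xs = A°} m) , m′) ap
      qρ : q ℕ.* ρ ℕ.≤ n ℕ.* n
      qρ = ℕP.≤-trans (subst (λ k → k ℕ.* ρ ℕ.≤ length A° ℕ.* length A°) (length-upTo q)
          (doubleCounting (λ k p → proj₁ p + + (k ℕ.* d) ≈[ ℓ ] proj₂ p) (Uniq.upTo⁺ q) (λ {k} _ → ways k) (λ {_} {_} {p} → distinct {p = p}) (AtMost-× A° A°)))
        (ℕP.*-mono-≤ A°≤n A°≤n)
        where
        distinct : ∀ {k k′} {p : ℤ × ℤ} → k ∈ upTo q → k′ ∈ upTo q → proj₁ p + + (k ℕ.* d) ≈[ ℓ ] proj₂ p →
          proj₁ p + + (k′ ℕ.* d) ≈[ ℓ ] proj₂ p → k ≡ k′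
        distinct {k} {k′} {a , _} k∈ k′∈ r r′ = ≈-multiples q d a qd>0 (∈-upTo⁻ k∈) (∈-upTo⁻ k′∈)
          (subst (λ L → a + + (k ℕ.* d) ≈[ + L ] a + + (k′ ℕ.* d)) L≡qd (≈-trans r (≈-sym r′)))
      q-small : q ℕ.+ e ℕ.+ 3 ℕ.≤ 2 ℕ.* n
      q-small = period-arith n e ρ q 1≤e 16e≤n ρ-large qρ
      Q : ℤ → Set
      Q w = ∃[ j ] (j ℕ.< q × w ≡ aL + + (j ℕ.* d))
      class : ∀ {w} → w ≈[ + d ] aL → ∃[ v ] (w ≈[ + (q ℕ.* d) ] v × Q v)
      class w≈ = let j , j< , r = residue q d w≈ in _ , r , j , j< , refl
      reps : ∀ k → k ℕ.< q → Representations C (+ (q ℕ.* d)) (aL + bL + + (k ℕ.* d)) (suc e)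
      -- The target is congruent to `aL + bL` modulo `d`, so `A°` and the reflected `B°` both fall
      -- into the `q` classes modulo `q d` above the class of `aL`. The margin `e + 3` consists of
      -- `e + 1` representations and the two trimmed ends.
      reps k k<q = representations C uA° uB° A°⊆ B°⊆
        (subst (λ L → Incongruent (+ L) A°) L≡qd incA°) (subst (λ L → Incongruent (+ L) B°) L≡qd incB°)
        (λ a∈ → class (a≈ (A°⊆ a∈))) (λ b∈ → class (target (b≈ (B°⊆ b∈)))) (AtMost-progression aL d q)
        (lin 0 (q-small ⊕ n≤A° ⊕ n≤B°) (arith q e n (length A°) (length B°)))
        where
        arith : ∀ q e n a b → suc e ℕ.+ q ℕ.+ (2 ℕ.* n ℕ.+ (a ℕ.+ 1) ℕ.+ (b ℕ.+ 1)) ℕ.+ 0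
          ≡ a ℕ.+ b ℕ.+ (q ℕ.+ e ℕ.+ 3 ℕ.+ n ℕ.+ n)
        arith = ℕ-solve
        target : ∀ {b} → b ≈[ + d ] bL → aL + bL + + (k ℕ.* d) - b ≈[ + d ] aL
        target {b} b≈ = ≈-trans (≈-∸ (≈-refl (aL + bL + + (k ℕ.* d))) b≈)
          (congruent (divides (+ k) (trans (collect aL bL (+ (k ℕ.* d))) (ℤP.pos-* k d))))
          where
          collect : ∀ a b m → a + b + m - b - a ≡ m
          collect = ℤ-solve
    conclusion : ∃[ d ] (D (+ d) × All (+ d ∣_) differences) → Progressions C aL aR bL bR
    conclusion (d , Dd , d∣ℓ ∷ d∣) = conclude d (ℕD.quotient d∣L) Dd d∣ (ℕD._∣_.equality d∣L)
      where
      d∣L : d ℕD.∣ L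
      d∣L = ∣⇒∣ᵤ d∣ℓ

  module _ {_≼_ : ℤ → ℤ → Set} (≼-refl : ∀ {x} → x ≼ x) (≼-trans : ∀ {x y z} → x ≼ y → y ≼ z → x ≼ z)
           (≼-total : ∀ x y → x ≼ y ⊎ y ≼ x) where

    extremum : (X : List ℤ) → 0 ℕ.< length X → ∃[ m ] (m ∈ X × (∀ {x} → x ∈ X → m ≼ x))
    extremum (x ∷ []) _ = x , here refl , λ { (here refl) → ≼-refl }
    extremum (x ∷ X@(_ ∷ _)) _ with extremum X (s≤s z≤n)
    ... | m , m∈ , least with ≼-total x m
    ... | inj₁ x≼m = x , here refl , λ { (here refl) → ≼-refl ; (there y∈) → ≼-trans x≼m (least y∈) }
    ... | inj₂ m≼x = m , there m∈ , λ { (here refl) → m≼x ; (there y∈) → least y∈ }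

  minimum : (X : List ℤ) → 0 ℕ.< length X → ∃[ m ] (m ∈ X × (∀ {x} → x ∈ X → m ℤ.≤ x))
  minimum = extremum ℤP.≤-refl ℤP.≤-trans ℤP.≤-total

  maximum : (X : List ℤ) → 0 ℕ.< length X → ∃[ m ] (m ∈ X × (∀ {x} → x ∈ X → x ℤ.≤ m))
  maximum = extremum {λ x y → y ℤ.≤ x} ℤP.≤-refl (λ p q → ℤP.≤-trans q p) (λ x y → ℤP.≤-total y x)

  ∈-length : {X : Set} {x : X} {xs : List X} → x ∈ xs → 0 ℕ.< length xs
  ∈-length (here _) = s≤s z≤n
  ∈-length (there _) = s≤s z≤n

  hull : (X : List ℤ) → 0 ℕ.< length X → ∃[ l ] ∃[ r ] Hull X l r
  hull X ne with minimum X ne | maximum X ne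
  ... | l , l∈ , l≤ | r , r∈ , ≤r = l , r , record { left = l∈ ; right = r∈ ; lower = l≤ ; upper = ≤r }

  hull-gap : ∀ {X l r} → Hull X l r → ∃[ L ] (r - l ≡ + L)
  hull-gap {l = l} {r} h = ∣ r - l ∣ , sym (ℤP.0≤i⇒+∣i∣≡i (ℤP.i≤j⇒0≤j-i (Hull.lower h (Hull.right h))))

  add-gap : ∀ {l r k} → r - l ≡ k → r ≡ l + k
  add-gap {l} {r} eq = trans (identity l r) (cong (_+_ l) eq)
    where
    identity : ∀ x y → y ≡ x + (y - x)
    identity = ℤ-solve

  <-window : ∀ {x} y L → x ℤ.≤ y + + L → x ℤ.< y + + suc L
  <-window y L h = ℤP.≤-<-trans h (ℤP.+-monoʳ-< y (ℤ.+<+ (ℕP.n<1+n L)))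

  hull-length : ∀ {X l r L} → Unique X → Hull X l r → r - l ≡ + L → length X ℕ.≤ suc L
  hull-length {X} {l} {r} {L} u h eq = AtMost-window l (suc L) X u
    (All.tabulate λ x∈ → Hull.lower h x∈ , <-window l L (subst (_ ℤ.≤_) (add-gap eq) (Hull.upper h x∈)))

  progression-index : ∀ {d q l x} → 0 ℕ.< d → l ℤ.≤ x → x ℤ.≤ l + + (q ℕ.* d) → x ≈[ + d ] l →
    ∃[ j ] (j ℕ.< suc q × x ≡ l + + (j ℕ.* d))
  progression-index {d} {q} {l} {x} d>0 l≤x x≤ (congruent d∣) = steps (index l≤x (<-window l (q ℕ.* d) x≤))
    where
    cancel : ∀ x y → x + y - x ≡ y
    cancel = ℤ-solve
    steps : ∃[ i ] (i ℕ.< suc (q ℕ.* d) × x ≡ l + + i) → ∃[ j ] (j ℕ.< suc q × x ≡ l + + (j ℕ.* d))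
    steps (i , s≤s i≤ , refl) with ∣⇒∣ᵤ (subst (+ d ∣_) (cancel l (+ i)) d∣)
    ... | ℕD.divides j refl = j , s≤s (ℕP.*-cancelʳ-≤ j q d {{ℕ.>-nonZero d>0}} i≤) , refl

  -- Otherwise `X` and its translate by `d` would be disjoint subsets of a progression with `2 + q`
  -- terms.
  consecutive : ∀ {X l r d q} → Unique X → Hull X l r → 0 ℕ.< d → r ℤ.≤ l + + (q ℕ.* d) →
    (∀ {x} → x ∈ X → x ≈[ + d ] l) → 2 ℕ.+ q ℕ.< 2 ℕ.* length X → ∃[ x ] (x ∈ X × x + + d ∈ X)
  consecutive {X} {l} {r} {d} {q} u h d>0 r≤ cong-l dense with any? (λ x → x + + d ∈? X) X
  ... | yes p = find p
  ... | no ¬p = contradiction dense (ℕP.≤⇒≯ (subst (ℕ._≤ 2 ℕ.+ q) len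
      (AtMost-progression l d (2 ℕ.+ q) (X ++ map (_+ + d) X) (++-unique u (Uniq.map⁺ (ℤ-cancelʳ (+ d) _ _) u) disj)
        (AllP.++⁺ (All.tabulate (proj₁ ∘ places)) (AllP.map⁺ (All.tabulate (proj₂ ∘ places)))))))
    where
    len : length (X ++ map (_+ + d) X) ≡ 2 ℕ.* length X
    len = trans (length-++ X) (cong (length X ℕ.+_) (trans (length-map (_+ + d) X) (sym (ℕP.+-identityʳ _))))
    disj : ∀ {x} → x ∈ X → x ∈ map (_+ + d) X → ⊥
    disj x∈ m with ∈-map⁻ (_+ + d) m
    ... | y , y∈ , refl = ¬p (lose y∈ x∈)
    step : ∀ l i d → l + i + d ≡ l + (d + i)
    step = ℤ-solve
    places : ∀ {x} → x ∈ X → (∃[ j ] (j ℕ.< 2 ℕ.+ q × x ≡ l + + (j ℕ.* d))) × (∃[ j ] (j ℕ.< 2 ℕ.+ q × x + + d ≡ l + + (j ℕ.* d)))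
    places x∈ with progression-index d>0 (Hull.lower h x∈) (ℤP.≤-trans (Hull.upper h x∈) r≤) (cong-l x∈)
    ... | j , j< , refl = (j , ℕP.m<n⇒m<1+n j< , refl) , (suc j , s≤s j< , step l (+ (j ℕ.* d)) (+ d))

  equal-size-structure : (C : Config) (n : ℕ) {aL aR bL bR : ℤ} → let open Config C in
    length A ≡ n → length B ≡ n → 1 ℕ.≤ e → 16 ℕ.* e ℕ.≤ n → 2 ℕ.* s ℕ.+ 17 ℕ.* e ℕ.+ 1 ℕ.≤ 5 ℕ.* n →
    Hull A aL aR → Hull B bL bR → Progressions C aL aR bL bR
  equal-size-structure C n {aL} {aR} {bL} {bR} lenA lenB 1≤e 16e≤n small hA hB =
    compare (hull-gap hA) (hull-gap hB)
    where
    open Config C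
    positive : ∀ {X l r L} → Unique X → length X ≡ n → Hull X l r → r - l ≡ + L → 0 ℕ.< L
    positive {L = L} u len h eq = ℕP.≤-pred (ℕP.≤-trans (lin 14 (16 ⊛ 1≤e ⊕ 16e≤n) (identity e n)) (subst (ℕ._≤ suc L) len (hull-length u h eq)))
      where
      identity : ∀ e n → 2 ℕ.+ (16 ℕ.* e ℕ.+ n) ℕ.+ 14 ≡ n ℕ.+ (16 ℕ.+ 16 ℕ.* e)
      identity = ℕ-solve
    within : ∀ {l r K L} → r - l ≡ + K → K ℕ.≤ L → r ℤ.≤ l + + L
    within {l} eq K≤L = subst (ℤ._≤ _) (sym (add-gap eq)) (ℤP.+-monoʳ-≤ l (ℤ.+≤+ K≤L))
    compare : ∃[ K ] (aR - aL ≡ + K) → ∃[ L ] (bR - bL ≡ + L) → Progressions C aL aR bL bR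
    compare (K , eqA) (L , eqB) with ℕP.≤-total L K
    ... | inj₁ L≤K = equal-size-structure-long C n K lenA lenB 1≤e 16e≤n small hA hB (positive uniqueA lenA hA eqA) eqA (within eqB L≤K)
    ... | inj₂ K≤L =
      let d , q , d>0 , b≈ , a≈ , bR≤ , aR≤ , q≤ = equal-size-structure-long (flip C) n L lenB lenA 1≤e 16e≤n small hB hA
                                                     (positive uniqueB lenB hB eqB) eqB (within eqA K≤L)
      in d , q , d>0 , a≈ , b≈ , aR≤ , bR≤ , subst (λ k → q ℕ.+ k ℕ.≤ s ℕ.+ 3 ℕ.* e) (trans lenA (sym lenB)) q≤

  -- Sets of different sizes

  module _ (C : Config) {aL aR bL bR : ℤ} (hA : Hull (Config.A C) aL aR) (hB : Hull (Config.B C) bL bR) where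
    open Config C

    private
      module hA = Hull hA
      module hB = Hull hB

    column : ∀ {a} → a ∈ A → ∃[ bs ] (Unique bs × length B ℕ.≤ length bs ℕ.+ e ℕ.+ 1 × (∀ {b} → b ∈ bs → b ∈ B × bL ℤ.< b × G a b))
    column {a} a∈ = filter (G? a) (trim bL B) , filter-unique (G? a) (trim-unique uniqueB)
      , ℕP.≤-trans (trim-length {bL} uniqueB)
          (ℕP.+-monoˡ-≤ 1 (filter-most (G? a) (trim-unique {bL} uniqueB) (AtMost-⊆ (λ (m , n) → proj₁ (trim⁻ {bL} {B} m) , n) (missA a∈))))
      , λ m → let m′ , g = ∈-filter⁻ (G? a) {xs = trim bL B} m ; b∈ , b≢ = trim⁻ {bL} {B} m′ in
              b∈ , ℤP.≤∧≢⇒< (hB.lower b∈) (b≢ ∘ sym) , g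

    -- This is the classical chain `A + bL` followed by `aR + B`, whose parts meet only in
    -- `aR + bL`; missing pairs cost `e` in each part. The origin of each sum is kept so that
    -- `same-class` can show that a third translate is disjoint from the chain.
    staircase : ∃[ zs ] (Unique zs × All S zs × length A ℕ.+ length B ℕ.≤ length zs ℕ.+ 2 ℕ.* e ℕ.+ 1
      × (∀ {z} → z ∈ zs → (∃[ a ] (a ∈ A × z ≡ a + bL)) ⊎ (∃[ b ] (b ∈ B × z ≡ aR + b))))
    staircase = map (_+ bL) X ++ map (_+_ aR) Y
      , ++-unique (Uniq.map⁺ (ℤ-cancelʳ bL _ _) (filter-unique (λ a → G? a bL) uniqueA)) (Uniq.map⁺ (ℤ-cancelˡ aR _ _) uY) disj
      , AllP.++⁺ (AllP.map⁺ (All.tabulate λ m → let a∈ , g = X⁻ m in sums a∈ hB.left g))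
                 (AllP.map⁺ (All.tabulate λ m → let b∈ , _ , g = Y⁻ m in sums hA.right b∈ g))
      , subst (λ k → length A ℕ.+ length B ℕ.≤ k ℕ.+ 2 ℕ.* e ℕ.+ 1) (sym len)
          (lin 0 (X-long ⊕ Y-long) (arith (length A) (length B) (length X) (length Y) e))
      , origin
      where
      X = filter (λ a → G? a bL) A
      Y = proj₁ (column hA.right)
      uY = proj₁ (proj₂ (column hA.right))
      Y-long = proj₁ (proj₂ (proj₂ (column hA.right)))
      Y⁻ : ∀ {b} → b ∈ Y → b ∈ B × bL ℤ.< b × G aR b
      Y⁻ = proj₂ (proj₂ (proj₂ (column hA.right)))
      X⁻ : ∀ {a} → a ∈ X → a ∈ A × G a bL
      X⁻ = ∈-filter⁻ (λ a → G? a bL)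
      X-long : length A ℕ.≤ length X ℕ.+ e
      X-long = filter-most (λ a → G? a bL) uniqueA (missB hB.left)
      arith : ∀ m n x y e → m ℕ.+ n ℕ.+ (x ℕ.+ e ℕ.+ (y ℕ.+ e ℕ.+ 1)) ℕ.+ 0 ≡ x ℕ.+ y ℕ.+ 2 ℕ.* e ℕ.+ 1 ℕ.+ (m ℕ.+ n)
      arith = ℕ-solve
      len : length (map (_+ bL) X ++ map (_+_ aR) Y) ≡ length X ℕ.+ length Y
      len = trans (length-++ (map (_+ bL) X)) (cong₂ ℕ._+_ (length-map (_+ bL) X) (length-map (_+_ aR) Y))
      disj : ∀ {z} → z ∈ map (_+ bL) X → z ∈ map (_+_ aR) Y → ⊥
      disj m m′ with ∈-map⁻ (_+ bL) m | ∈-map⁻ (_+_ aR) m′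
      ... | a , a∈ , refl | b , b∈ , eq = ℤP.<-irrefl eq (ℤP.+-mono-≤-< (hA.upper (proj₁ (X⁻ a∈))) (proj₁ (proj₂ (Y⁻ b∈))))
      origin : ∀ {z} → z ∈ map (_+ bL) X ++ map (_+_ aR) Y → (∃[ a ] (a ∈ A × z ≡ a + bL)) ⊎ (∃[ b ] (b ∈ B × z ≡ aR + b))
      origin m with ∈-++⁻ (map (_+ bL) X) m
      ... | inj₁ p with ∈-map⁻ (_+ bL) p
      ...   | a , a∈ , eq = inj₁ (a , proj₁ (X⁻ a∈) , eq)
      origin m | inj₂ p with ∈-map⁻ (_+_ aR) p
      ...   | b , b∈ , eq = inj₂ (b , proj₁ (Y⁻ b∈) , eq)

    sumset-lower-bound : length A ℕ.+ length B ℕ.≤ s ℕ.+ 2 ℕ.* e ℕ.+ 1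
    sumset-lower-bound with staircase
    ... | zs , u , all , long , _ = ℕP.≤-trans long (ℕP.+-monoˡ-≤ 1 (ℕP.+-monoˡ-≤ (2 ℕ.* e) (sizeS zs u all)))

    -- If A met a second class modulo d, the largest element a₁ outside the class of aR would
    -- contribute a third translate of B to the sumset.
    same-class : ∀ d → (∀ {b} → b ∈ B → b ≈[ + d ] bL) → s ℕ.+ 3 ℕ.* e ℕ.+ 2 ℕ.< length A ℕ.+ 2 ℕ.* length B →
      ∀ {a} → a ∈ A → a ≈[ + d ] aR
    same-class d b≈ few {a} a∈ with ≈-dec (+ d) a aR
    ... | yes a≈ = a≈
    ... | no a≉ = ⊥-elim (absurd (maximum bad (∈-length (∈-filter⁺ bad? a∈ a≉))))
      where
      bad? : Decidable (λ a → ¬ a ≈[ + d ] aR)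
      bad? a = ¬? (≈-dec (+ d) a aR)
      bad = filter bad? A
      absurd : ∃[ m ] (m ∈ bad × (∀ {x} → x ∈ bad → x ℤ.≤ m)) → ⊥
      absurd (a₁ , a₁∈bad , largest) with ∈-filter⁻ bad? {xs = A} a₁∈bad
      ... | a₁∈ , a₁≉ with staircase | column a₁∈
      ... | zs , u , all , long , origin | bs , v , long′ , bs⁻ = ℕP.<-irrefl refl (ℕP.<-≤-trans few
          (lin 0 (long ⊕ long′ ⊕ total) (arith (length A) (length B) (length zs) (length bs) s e)))
        where
        arith : ∀ m n z b s e → m ℕ.+ 2 ℕ.* n ℕ.+ (z ℕ.+ 2 ℕ.* e ℕ.+ 1 ℕ.+ (b ℕ.+ e ℕ.+ 1) ℕ.+ s) ℕ.+ 0
          ≡ s ℕ.+ 3 ℕ.* e ℕ.+ 2 ℕ.+ (m ℕ.+ n ℕ.+ n ℕ.+ (z ℕ.+ b))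
        arith = ℕ-solve
        disj : ∀ {z} → z ∈ zs → z ∈ map (_+_ a₁) bs → ⊥
        disj z∈ m with ∈-map⁻ (_+_ a₁) m
        ... | b , b∈ , refl with origin z∈ | bs⁻ b∈
        ...   | inj₁ (a , a∈ , eq) | b∈B , bL<b , _ = 
          ℤP.<⇒≱ a₁<a (largest (∈-filter⁺ bad? a∈ (λ a≈ → a₁≉ (≈-trans a₁≈a a≈))))
          where
          a₁≈a : a₁ ≈[ + d ] a
          a₁≈a = ≈-trans (≈-reflexive (identity a₁ b a bL eq)) (≈-trans (≈-∸ (≈-refl (a + bL)) (b≈ b∈B)) (≈-reflexive (cancel a bL)))
            where
            cancel : ∀ a b → a + b - b ≡ a
            cancel = ℤ-solve
            identity : ∀ a₁ b a bL → a₁ + b ≡ a + bL → a₁ ≡ a + bL - b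
            identity a₁ b a bL eq = trans (sym (cancel a₁ b)) (cong (_- b) eq)
          a₁<a : a₁ ℤ.< a
          a₁<a = ℤP.≰⇒> λ a≤a₁ → ℤP.<-irrefl (sym eq) (ℤP.≤-<-trans (ℤP.+-monoˡ-≤ bL a≤a₁) (ℤP.+-monoʳ-< a₁ bL<b))
        ...   | inj₂ (b′ , b′∈ , eq) | b∈B , bL<b , _ = a₁≉ (≈-trans (≈-reflexive (identity a₁ b b′ aR eq))
                  (≈-trans (≈-∸ (≈-refl (aR + b′)) (≈-trans (b≈ b∈B) (≈-sym (b≈ b′∈)))) (≈-reflexive (cancel aR b′))))
          where
          cancel : ∀ a b → a + b - b ≡ a
          cancel = ℤ-solve
          identity : ∀ a₁ b b′ aR → a₁ + b ≡ aR + b′ → a₁ ≡ aR + b′ - b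
          identity a₁ b b′ aR eq = trans (sym (cancel a₁ b)) (cong (_- b) eq)
        total : length zs ℕ.+ length bs ℕ.≤ s
        total = subst (ℕ._≤ s) (trans (length-++ zs) (cong (length zs ℕ.+_) (length-map (_+_ a₁) bs)))
          (sizeS (zs ++ map (_+_ a₁) bs) (++-unique u (Uniq.map⁺ (ℤ-cancelˡ a₁ _ _) v) disj)
            (AllP.++⁺ all (AllP.map⁺ (All.tabulate λ m → let b∈ , _ , g = bs⁻ m in sums a₁∈ b∈ g))))

  -- Segments of the larger set

  segment : List ℤ → ℤ → ℤ → List ℤ
  segment X p q = filter (λ x → (p ℤP.≤? x) ×-dec (x ℤP.≤? q)) X

  segment⁻ : ∀ {X p q x} → x ∈ segment X p q → x ∈ X × p ℤ.≤ x × x ℤ.≤ q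
  segment⁻ {X} {p} {q} = ∈-filter⁻ (λ x → (p ℤP.≤? x) ×-dec (x ℤP.≤? q)) {xs = X}

  segment⁺ : ∀ {X p q x} → x ∈ X → p ℤ.≤ x → x ℤ.≤ q → x ∈ segment X p q
  segment⁺ {X} {p} {q} x∈ p≤ ≤q = ∈-filter⁺ (λ x → (p ℤP.≤? x) ×-dec (x ℤP.≤? q)) x∈ (p≤ , ≤q)

  segment-unique : ∀ {X p q} → Unique X → Unique (segment X p q)
  segment-unique {X} {p} {q} = filter-unique (λ x → (p ℤP.≤? x) ×-dec (x ℤP.≤? q))

  segment-hull : ∀ {X p q} → p ∈ X → q ∈ X → p ℤ.≤ q → Hull (segment X p q) p q
  segment-hull {X} {p} {q} p∈ q∈ p≤q = record
    { left = segment⁺ p∈ ℤP.≤-refl p≤q ; right = segment⁺ q∈ p≤q ℤP.≤-refl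
    ; lower = proj₁ ∘ proj₂ ∘ segment⁻ {X} {p} {q} ; upper = proj₂ ∘ proj₂ ∘ segment⁻ {X} {p} {q} }

  module _ (C : Config) {bL bR : ℤ} (hB : Hull (Config.B C) bL bR) (p q : ℤ) where
    open Config C

    private
      module hB = Hull hB
      -- Cutting `S` at these ends separates the block from the rest: below `p` the sums `a + bL`
      -- fall short of the range, and above `q` the sums `a + bR` pass beyond it.
      BlockSum : ℤ → Set
      BlockSum z = S z × p + bL ℤ.≤ z × z ℤ.≤ q + bR

    -- The elements a of A outside the segment still contribute the sums a + bL or a + bR.
    block-sums : ∀ zs → Unique zs → All BlockSum zs →
      length zs ℕ.+ length A ℕ.≤ s ℕ.+ 2 ℕ.* e ℕ.+ length (segment A p q)
    block-sums zs u all = lin 0 (total ⊕ good-length below uBelow below⊆ hB.left ⊕ good-length above uAbove above⊆ hB.right ⊕ ℕP.≤-reflexive A-split)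
      (arith (length zs) (length A) s e (length (segment A p q)) (length below) (length above) (length (good bL below)) (length (good bR above)))
      where
      arith : ∀ z a s e n b c g h →
        z ℕ.+ a ℕ.+ (s ℕ.+ (g ℕ.+ e) ℕ.+ (h ℕ.+ e) ℕ.+ (n ℕ.+ (b ℕ.+ c))) ℕ.+ 0
        ≡ s ℕ.+ 2 ℕ.* e ℕ.+ n ℕ.+ (z ℕ.+ (g ℕ.+ h) ℕ.+ b ℕ.+ c ℕ.+ a)
      arith = ℕ-solve
      inside? : Decidable (λ x → p ℤ.≤ x × x ℤ.≤ q)
      inside? x = (p ℤP.≤? x) ×-dec (x ℤP.≤? q)
      outside = filter (¬? ∘ inside?) A
      below = filter (ℤP._<? p) outside
      above = filter (¬? ∘ (ℤP._<? p)) outside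
      uOutside = filter-unique (¬? ∘ inside?) uniqueA
      uBelow : Unique below
      uBelow = filter-unique (ℤP._<? p) uOutside
      uAbove : Unique above
      uAbove = filter-unique (¬? ∘ (ℤP._<? p)) uOutside
      A-split : length A ≡ length (segment A p q) ℕ.+ (length below ℕ.+ length above)
      A-split = trans (filter-split inside? A) (cong (length (segment A p q) ℕ.+_) (filter-split (ℤP._<? p) outside))
      below⁻ : ∀ {a} → a ∈ below → a ∈ A × a ℤ.< p
      below⁻ m = let m′ , lt = ∈-filter⁻ (ℤP._<? p) {xs = outside} m in proj₁ (∈-filter⁻ (¬? ∘ inside?) {xs = A} m′) , lt
      above⁻ : ∀ {a} → a ∈ above → a ∈ A × q ℤ.< a
      above⁻ m = let m′ , nlt = ∈-filter⁻ (¬? ∘ (ℤP._<? p)) {xs = outside} m ; a∈ , out = ∈-filter⁻ (¬? ∘ inside?) {xs = A} m′ in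
        a∈ , ℤP.≰⇒> (λ a≤q → out (ℤP.≮⇒≥ nlt , a≤q))
      below⊆ : ∀ {a} → a ∈ below → a ∈ A
      below⊆ = proj₁ ∘ below⁻
      above⊆ : ∀ {a} → a ∈ above → a ∈ A
      above⊆ = proj₁ ∘ above⁻
      good : ℤ → List ℤ → List ℤ
      good b = filter (λ a → G? a b)
      good⁻ : ∀ {b} X {a} → a ∈ good b X → a ∈ X × G a b
      good⁻ {b} X = ∈-filter⁻ (λ a → G? a b) {xs = X}
      good-length : ∀ {b} X → Unique X → (∀ {a} → a ∈ X → a ∈ A) → b ∈ B → length X ℕ.≤ length (good b X) ℕ.+ e
      good-length {b} X uX X⊆ b∈ = filter-most (λ a → G? a b) uX (AtMost-⊆ (λ (m , n) → X⊆ m , n) (missB b∈))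
      low = map (_+ bL) (good bL below)
      high = map (_+ bR) (good bR above)
      disj₁ : ∀ {z} → z ∈ low → z ∈ high → ⊥
      disj₁ m m′ with ∈-map⁻ (_+ bL) m | ∈-map⁻ (_+ bR) m′
      ... | a , a∈ , refl | a′ , a′∈ , eq with below⁻ (proj₁ (good⁻ below a∈)) | ∈-filter⁻ (¬? ∘ (ℤP._<? p)) {xs = outside} (proj₁ (good⁻ above a′∈))
      ...   | _ , a<p | _ , a′≮p = ℤP.<-irrefl eq (ℤP.+-mono-<-≤ (ℤP.<-≤-trans a<p (ℤP.≮⇒≥ a′≮p)) (hB.lower hB.right))
      disj₂ : ∀ {z} → z ∈ zs → z ∈ low ++ high → ⊥
      disj₂ z∈ m with All.lookup all z∈ | ∈-++⁻ low m
      ... | _ , lo , _ | inj₁ m₁ with ∈-map⁻ (_+ bL) m₁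
      ...   | a , a∈ , refl = ℤP.<⇒≱ (ℤP.+-monoˡ-< bL (proj₂ (below⁻ (proj₁ (good⁻ below a∈))))) lo
      disj₂ z∈ m | _ , _ , hi | inj₂ m₂ with ∈-map⁻ (_+ bR) m₂
      ...   | a , a∈ , refl = ℤP.<⇒≱ (ℤP.+-monoˡ-< bR (proj₂ (above⁻ (proj₁ (good⁻ above a∈))))) hi
      total : length zs ℕ.+ (length (good bL below) ℕ.+ length (good bR above)) ℕ.≤ s
      total = subst (ℕ._≤ s) (trans (length-++ zs) (cong (length zs ℕ.+_)
          (trans (length-++ low) (cong₂ ℕ._+_ (length-map (_+ bL) (good bL below)) (length-map (_+ bR) (good bR above))))))
        (sizeS (zs ++ low ++ high)
          (++-unique u (++-unique (Uniq.map⁺ (ℤ-cancelʳ bL _ _) (filter-unique (λ a → G? a bL) uBelow))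
                                  (Uniq.map⁺ (ℤ-cancelʳ bR _ _) (filter-unique (λ a → G? a bR) uAbove)) disj₁) disj₂)
          (AllP.++⁺ (All.map proj₁ all) (AllP.++⁺
            (AllP.map⁺ (All.tabulate λ m → let a∈ , g = good⁻ below m in sums (below⊆ a∈) hB.left g))
            (AllP.map⁺ (All.tabulate λ m → let a∈ , g = good⁻ above m in sums (above⊆ a∈) hB.right g)))))

    block : Config
    block = record
      { e = e ; s = s ℕ.+ 2 ℕ.* e ℕ.+ length (segment A p q) ℕ.∸ length A ; A = segment A p q ; B = B
      ; uniqueA = segment-unique uniqueA ; uniqueB = uniqueB ; G = G ; G? = G?
      ; S = BlockSum ; S? = λ z → S? z ×-dec (p + bL ℤP.≤? z) ×-dec (z ℤP.≤? q + bR)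
      ; sums = λ a∈ b∈ g → let a∈A , p≤ , ≤q = segment⁻ a∈ in
          sums a∈A b∈ g , ℤP.+-mono-≤ p≤ (hB.lower b∈) , ℤP.+-mono-≤ ≤q (hB.upper b∈)
      ; sizeS = λ zs u all → ℕP.m+n≤o⇒m≤o∸n (length zs) (block-sums zs u all)
      ; missA = λ a∈ → missA (proj₁ (segment⁻ a∈))
      ; missB = λ b∈ → AtMost-⊆ (λ (m , n) → proj₁ (segment⁻ m) , n) (missB b∈)
      ; missing = AtMost-⊆ (λ (m , r) → proj₁ (segment⁻ m) , r) missing }

  rescale : ∀ d l X → (∀ {x} → x ∈ X → x ≈[ + d ] l) → ∃[ X′ ] (map (λ t → l + t * + d) X′ ≡ X)
  rescale d l [] h = [] , refl
  rescale d l (x ∷ X) h with rescale d l X (h ∘ there) | h (here refl)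
  ... | X′ , eq | congruent (divides t eqt) = t ∷ X′ , cong₂ _∷_ (sym (add-gap eqt)) eq

  affine-injective : ∀ d l {x y} → 0 ℕ.< d → l + x * + d ≡ l + y * + d → x ≡ y
  affine-injective (suc d) l {x} {y} d>0 eq = ℤP.*-cancelʳ-≡ x y (+ suc d) (ℤ-cancelˡ l _ _ eq)

  scale : (C : Config) (d : ℕ) (aL bL : ℤ) (A′ B′ : List ℤ) → 0 ℕ.< d →
    map (λ t → aL + t * + d) A′ ≡ Config.A C → map (λ t → bL + t * + d) B′ ≡ Config.B C → Config
  scale C d aL bL A′ B′ d>0 eqA eqB = record
    { e = e ; s = s ; A = A′ ; B = B′
    ; uniqueA = unmap f A′ (subst Unique (sym eqA) uniqueA) ; uniqueB = unmap g B′ (subst Unique (sym eqB) uniqueB)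
    ; G = λ t u → G (f t) (g u) ; G? = λ t u → G? (f t) (g u)
    ; S = λ z → S (aL + bL + z * + d) ; S? = λ z → S? (aL + bL + z * + d)
    ; sums = λ {t} {u} t∈ u∈ r → subst S (identity aL bL t u (+ d)) (sums (toA t∈) (toB u∈) r)
    ; sizeS = AtMost-map (λ z → aL + bL + z * + d) (affine-injective d (aL + bL) d>0) id sizeS
    ; missA = λ t∈ → AtMost-map g (affine-injective d bL d>0) (λ (u∈ , n) → toB u∈ , n) (missA (toA t∈))
    ; missB = λ u∈ → AtMost-map f (affine-injective d aL d>0) (λ (t∈ , n) → toA t∈ , n) (missB (toB u∈))
    ; missing = AtMost-map (λ (t , u) → f t , g u)
        (λ eq → cong₂ _,_ (affine-injective d aL d>0 (cong proj₁ eq)) (affine-injective d bL d>0 (cong proj₂ eq)))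
        (λ (t∈ , u∈ , n) → toA t∈ , toB u∈ , n) missing }
    where
    open Config C
    f g : ℤ → ℤ
    f t = aL + t * + d
    g t = bL + t * + d
    unmap : (h : ℤ → ℤ) (X : List ℤ) → Unique (map h X) → Unique X
    unmap h [] [] = []
    unmap h (x ∷ X) (x∉ ∷ u) = All.map (λ ne eq → ne (cong h eq)) (AllP.map⁻ x∉) ∷ unmap h X u
    toA : ∀ {t} → t ∈ A′ → f t ∈ A
    toA {t} t∈ = subst (f t ∈_) eqA (∈-map⁺ f t∈)
    toB : ∀ {t} → t ∈ B′ → g t ∈ B
    toB {t} t∈ = subst (g t ∈_) eqB (∈-map⁺ g t∈)
    identity : ∀ a b t u d → (a + t * d) + (b + u * d) ≡ a + b + (t + u) * d
    identity = ℤ-solve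

  length-equal : {X : Set} {xs ys : List X} → Unique xs → Unique ys →
    (∀ {x} → x ∈ xs → x ∈ ys) → (∀ {x} → x ∈ ys → x ∈ xs) → length xs ≡ length ys
  length-equal u v sub sup = ℕP.≤-antisym (length-⊆ u sub) (length-⊆ v sup)

  extend-right : ∀ {X p q} → Unique X → p ℤ.≤ q → Any (q ℤ.<_) X →
    ∃[ r ] (r ∈ X × q ℤ.< r × length (segment X p r) ≡ suc (length (segment X p q)))
  extend-right {X} {p} {q} u p≤q some with minimum (filter (q ℤP.<?_) X) (∈-length (let _ , m , lt = find some in ∈-filter⁺ (q ℤP.<?_) m lt))
  ... | r , r∈ , least with ∈-filter⁻ (q ℤP.<?_) {xs = X} r∈
  ... | r∈X , q<r = r , r∈X , q<r , length-equal (segment-unique u)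
        (All.tabulate (λ m eq → ℤP.<⇒≱ q<r (subst (ℤ._≤ q) (sym eq) (proj₂ (proj₂ (segment⁻ {X} {p} {q} m))))) ∷ segment-unique u) sub sup
    where
    sub : ∀ {x} → x ∈ segment X p r → x ∈ r ∷ segment X p q
    sub {x} m with segment⁻ {X} {p} {r} m | x ℤP.≤? q
    ... | x∈ , p≤ , _ | yes x≤q = there (segment⁺ x∈ p≤ x≤q)
    ... | x∈ , p≤ , x≤r | no x≰q = here (ℤP.≤-antisym x≤r (least (∈-filter⁺ (q ℤP.<?_) x∈ (ℤP.≰⇒> x≰q))))
    sup : ∀ {x} → x ∈ r ∷ segment X p q → x ∈ segment X p r
    sup (here refl) = segment⁺ r∈X (ℤP.≤-trans p≤q (ℤP.<⇒≤ q<r)) ℤP.≤-refl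
    sup (there m) = let x∈ , p≤ , ≤q = segment⁻ {X} {p} {q} m in segment⁺ x∈ p≤ (ℤP.≤-trans ≤q (ℤP.<⇒≤ q<r))

  extend-left : ∀ {X p q} → Unique X → p ℤ.≤ q → Any (ℤ._< p) X →
    ∃[ r ] (r ∈ X × r ℤ.< p × length (segment X r q) ≡ suc (length (segment X p q)))
  extend-left {X} {p} {q} u p≤q some with maximum (filter (ℤP._<? p) X) (∈-length (let _ , m , lt = find some in ∈-filter⁺ (ℤP._<? p) m lt))
  ... | r , r∈ , greatest with ∈-filter⁻ (ℤP._<? p) {xs = X} r∈
  ... | r∈X , r<p = r , r∈X , r<p , length-equal (segment-unique u)
        (All.tabulate (λ m eq → ℤP.<⇒≱ r<p (subst (p ℤ.≤_) (sym eq) (proj₁ (proj₂ (segment⁻ {X} {p} {q} m))))) ∷ segment-unique u) sub sup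
    where
    sub : ∀ {x} → x ∈ segment X r q → x ∈ r ∷ segment X p q
    sub {x} m with segment⁻ {X} {r} {q} m | p ℤP.≤? x
    ... | x∈ , _ , ≤q | yes p≤x = there (segment⁺ x∈ p≤x ≤q)
    ... | x∈ , r≤x , _ | no p≰x = here (ℤP.≤-antisym (greatest (∈-filter⁺ (ℤP._<? p) x∈ (ℤP.≰⇒> p≰x))) r≤x)
    sup : ∀ {x} → x ∈ r ∷ segment X p q → x ∈ segment X r q
    sup (here refl) = segment⁺ r∈X ℤP.≤-refl (ℤP.≤-trans (ℤP.<⇒≤ r<p) p≤q)
    sup (there m) = let x∈ , p≤ , ≤q = segment⁻ {X} {p} {q} m in segment⁺ x∈ (ℤP.≤-trans (ℤP.<⇒≤ r<p) p≤) ≤q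

  -- Elements are added one at a time, on the right as long as possible. If none remains on either
  -- side, the segment is all of `X`, which contradicts the room still available.
  extend-segment : ∀ {X} f {p q} → Unique X → p ∈ X → q ∈ X → p ℤ.≤ q → f ℕ.+ length (segment X p q) ℕ.≤ length X →
    ∃[ p′ ] ∃[ q′ ] (p′ ∈ X × q′ ∈ X × p′ ℤ.≤ p × q ℤ.≤ q′ × length (segment X p′ q′) ≡ f ℕ.+ length (segment X p q))
  extend-segment zero {p} {q} u p∈ q∈ p≤q fits = p , q , p∈ , q∈ , ℤP.≤-refl , ℤP.≤-refl , refl
  extend-segment {X} (suc f) {p} {q} u p∈ q∈ p≤q fits with any? (q ℤP.<?_) X | any? (ℤP._<? p) X
  ... | yes some | _ with extend-right u p≤q some
  ...   | r , r∈ , q<r , len with extend-segment f {p} {r} u p∈ r∈ (ℤP.≤-trans p≤q (ℤP.<⇒≤ q<r))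
                                   (subst (ℕ._≤ length X) (trans (sym (ℕP.+-suc f _)) (cong (f ℕ.+_) (sym len))) fits)
  ...     | p′ , q′ , p′∈ , q′∈ , p′≤ , ≤q′ , len′ = p′ , q′ , p′∈ , q′∈ , p′≤ , ℤP.≤-trans (ℤP.<⇒≤ q<r) ≤q′
            , trans len′ (trans (cong (f ℕ.+_) len) (ℕP.+-suc f _))
  extend-segment {X} (suc f) {p} {q} u p∈ q∈ p≤q fits | no _ | yes some with extend-left u p≤q some
  ...   | r , r∈ , r<p , len with extend-segment f {r} {q} u r∈ q∈ (ℤP.≤-trans (ℤP.<⇒≤ r<p) p≤q)
                                   (subst (ℕ._≤ length X) (trans (sym (ℕP.+-suc f _)) (cong (f ℕ.+_) (sym len))) fits)
  ...     | p′ , q′ , p′∈ , q′∈ , p′≤ , ≤q′ , len′ = p′ , q′ , p′∈ , q′∈ , ℤP.≤-trans p′≤ (ℤP.<⇒≤ r<p) , ≤q′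
            , trans len′ (trans (cong (f ℕ.+_) len) (ℕP.+-suc f _))
  extend-segment {X} (suc f) {p} {q} u p∈ q∈ p≤q fits | no none₁ | no none₂ = contradiction fits (ℕP.<⇒≱ (s≤s (ℕP.≤-trans
    (length-⊆ {ys = segment X p q} u (λ x∈ → segment⁺ x∈ (ℤP.≮⇒≥ (λ lt → none₂ (lose x∈ lt))) (ℤP.≮⇒≥ (λ lt → none₁ (lose x∈ lt)))))
    (ℕP.m≤n+m _ f))))

  -- Density of windows

  -- Windows are half-open, so that the elements of one window are incongruent modulo its length and
  -- abutting windows are disjoint.
  window : List ℤ → ℤ → ℕ → List ℤ
  window X x L = filter (λ a → (x ℤP.≤? a) ×-dec (a ℤP.<? x + + L)) X

  window⁻ : ∀ {X x L a} → a ∈ window X x L → a ∈ X × x ℤ.≤ a × a ℤ.< x + + L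
  window⁻ {X} {x} {L} = ∈-filter⁻ (λ a → (x ℤP.≤? a) ×-dec (a ℤP.<? x + + L)) {xs = X}

  window⁺ : ∀ {X x L a} → a ∈ X → x ℤ.≤ a → a ℤ.< x + + L → a ∈ window X x L
  window⁺ {X} {x} {L} a∈ x≤ a< = ∈-filter⁺ (λ a → (x ℤP.≤? a) ×-dec (a ℤP.<? x + + L)) a∈ (x≤ , a<)

  window-unique : ∀ {X x L} → Unique X → Unique (window X x L)
  window-unique {X} {x} {L} = filter-unique (λ a → (x ℤP.≤? a) ×-dec (a ℤP.<? x + + L))

  -- If the window has at most n − 2 elements, the elements of A next to it extend to a segment with exactly n elements.
  dense-windows : ∀ {A aL aR} n Q → Unique A → Hull A aL aR → n ℕ.≤ length A →
    (∀ {p q} → p ∈ A → q ∈ A → p ℤ.≤ q → length (segment A p q) ≡ n → q ℤ.≤ p + + Q) →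
    ∀ x L → aL ℤ.≤ x → x + + L ℤ.≤ aR → n ℕ.≤ length (window A x (suc L)) ℕ.+ 1 ⊎
      suc L ℕ.+ n ℕ.≤ length (window A x (suc L)) ℕ.+ suc Q
  dense-windows {A} {aL} {aR} n Q u h n≤ short x L aL≤x ≤aR with n ℕP.≤? length (window A x (suc L)) ℕ.+ 1
  ... | yes n≤c = inj₁ n≤c
  ... | no n≰c = inj₂ (around (maximum (filter (ℤP._≤? x) A) (∈-length (∈-filter⁺ (ℤP._≤? x) (Hull.left h) aL≤x)))
                              (minimum (filter (x + + L ℤP.≤?_) A) (∈-length (∈-filter⁺ (x + + L ℤP.≤?_) (Hull.right h) ≤aR))))
    where
    W = window A x (suc L)
    around : ∃[ p ] (p ∈ filter (ℤP._≤? x) A × (∀ {a} → a ∈ filter (ℤP._≤? x) A → a ℤ.≤ p)) →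
      ∃[ q ] (q ∈ filter (x + + L ℤP.≤?_) A × (∀ {a} → a ∈ filter (x + + L ℤP.≤?_) A → q ℤ.≤ a)) →
      suc L ℕ.+ n ℕ.≤ length W ℕ.+ suc Q
    around (p , p∈f , p-max) (q , q∈f , q-min) = enclosing
      (extend-segment (n ℕ.∸ length (segment A p q)) u p∈ q∈ (ℤP.≤-trans p≤x (ℤP.≤-trans x≤y y≤q))
        (subst (ℕ._≤ length A) (sym n-eq) n≤))
      where
      p∈ = proj₁ (∈-filter⁻ (ℤP._≤? x) {xs = A} p∈f)
      p≤x = proj₂ (∈-filter⁻ (ℤP._≤? x) {xs = A} p∈f)
      q∈ = proj₁ (∈-filter⁻ (x + + L ℤP.≤?_) {xs = A} q∈f)
      y≤q = proj₂ (∈-filter⁻ (x + + L ℤP.≤?_) {xs = A} q∈f)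
      x≤y : x ℤ.≤ x + + L
      x≤y = ℤP.i≤i+j x (+ L)
      sub : ∀ {a} → a ∈ segment A p q → a ∈ p ∷ q ∷ W
      sub {a} m with segment⁻ {A} {p} {q} m | a ℤP.≤? x | x + + L ℤP.≤? a
      ... | a∈ , p≤a , _ | yes a≤x | _ = here (ℤP.≤-antisym (p-max (∈-filter⁺ (ℤP._≤? x) a∈ a≤x)) p≤a)
      ... | a∈ , _ , a≤q | no _ | yes y≤a = there (here (ℤP.≤-antisym a≤q (q-min (∈-filter⁺ (x + + L ℤP.≤?_) a∈ y≤a))))
      ... | a∈ , _ , _ | no a≰x | no y≰a = there (there (window⁺ a∈ (ℤP.<⇒≤ (ℤP.≰⇒> a≰x)) (<-window x L (ℤP.<⇒≤ (ℤP.≰⇒> y≰a)))))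
      few : length (segment A p q) ℕ.≤ n
      few = ℕP.≤-trans (length-⊆ (segment-unique u) sub)
        (subst (ℕ._≤ n) (cong suc (ℕP.+-comm (length W) 1)) (ℕP.≰⇒> n≰c))
      n-eq : n ℕ.∸ length (segment A p q) ℕ.+ length (segment A p q) ≡ n
      n-eq = ℕP.m∸n+n≡m few
      enclosing : ∃[ p′ ] ∃[ q′ ] (p′ ∈ A × q′ ∈ A × p′ ℤ.≤ p × q ℤ.≤ q′ ×
        length (segment A p′ q′) ≡ n ℕ.∸ length (segment A p q) ℕ.+ length (segment A p q)) → suc L ℕ.+ n ℕ.≤ length W ℕ.+ suc Q
      enclosing (p′ , q′ , p′∈ , q′∈ , p′≤p , q≤q′ , len) =
        lin 0 (total ⊕ inner-few ⊕ ℕP.≤-reflexive inner-split) (arith L n Q (length W) (length inner) (length outer))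
        where
        arith : ∀ L n Q w i o → suc L ℕ.+ n ℕ.+ (suc Q ℕ.+ w ℕ.+ (i ℕ.+ o)) ℕ.+ 0 ≡ w ℕ.+ suc Q ℕ.+ (suc L ℕ.+ o ℕ.+ i ℕ.+ n)
        arith = ℕ-solve
        block-list = segment A p′ q′
        q′≤ : q′ ℤ.≤ p′ + + Q
        q′≤ = short p′∈ q′∈ (ℤP.≤-trans p′≤p (ℤP.≤-trans p≤x (ℤP.≤-trans x≤y (ℤP.≤-trans y≤q q≤q′)))) (trans len n-eq)
        inside? : Decidable (λ a → x ℤ.≤ a × a ℤ.< x + + suc L)
        inside? a = (x ℤP.≤? a) ×-dec (a ℤP.<? x + + suc L)
        inner = filter inside? block-list
        outer = filter (¬? ∘ inside?) block-list
        inner-split : n ≡ length inner ℕ.+ length outer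
        inner-split = trans (sym (trans len n-eq)) (filter-split inside? block-list)
        inner-few : length inner ℕ.≤ length W
        inner-few = length-⊆ (filter-unique inside? (segment-unique u))
          (λ m → let m′ , lo , hi = ∈-filter⁻ inside? {xs = block-list} m in window⁺ (proj₁ (segment⁻ {A} {p′} {q′} m′)) lo hi)
        interval = map (λ i → x + + i) (upTo (suc L))
        interval⁻ : ∀ {z} → z ∈ interval → x ℤ.≤ z × z ℤ.< x + + suc L
        interval⁻ m with ∈-map⁻ (λ i → x + + i) m
        ... | i , i∈ , refl = ℤP.i≤i+j x (+ i) , ℤP.+-monoʳ-< x (ℤ.+<+ (∈-upTo⁻ i∈))
        disj : ∀ {z} → z ∈ interval → z ∈ outer → ⊥
        disj z∈ m = proj₂ (∈-filter⁻ (¬? ∘ inside?) {xs = block-list} m) (interval⁻ z∈)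
        p′≤x = ℤP.≤-trans p′≤p p≤x
        within-interval : ∀ {z} → z ∈ interval → p′ ℤ.≤ z × z ℤ.< p′ + + suc Q
        within-interval m = ℤP.≤-trans p′≤x (proj₁ (interval⁻ m)) ,
          <-window p′ Q (ℤP.≤-trans (below-end m) (ℤP.≤-trans y≤q (ℤP.≤-trans q≤q′ q′≤)))
          where
          below-end : ∀ {z} → z ∈ interval → z ℤ.≤ x + + L
          below-end m with ∈-map⁻ (λ i → x + + i) m
          ... | i , i∈ , refl = ℤP.+-monoʳ-≤ x (ℤ.+≤+ (ℕP.≤-pred (∈-upTo⁻ i∈)))
        within-outer : ∀ {z} → z ∈ outer → p′ ℤ.≤ z × z ℤ.< p′ + + suc Q
        within-outer m = let _ , lo , hi = segment⁻ {A} {p′} {q′} (proj₁ (∈-filter⁻ (¬? ∘ inside?) {xs = block-list} m)) in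
          lo , <-window p′ Q (ℤP.≤-trans hi q′≤)
        -- The integers of the window and the block elements outside it share an interval of `suc Q`
        -- integers. Since the block has `n` elements, at least `n - length W` of them are outside.
        total : suc L ℕ.+ length outer ℕ.≤ suc Q
        total = subst (ℕ._≤ suc Q) (trans (length-++ interval) (cong (ℕ._+ length outer) (trans (length-map (λ i → x + + i) (upTo (suc L))) (length-upTo (suc L)))))
          (AtMost-window p′ (suc Q) (interval ++ outer)
            (++-unique (Uniq.map⁺ (λ eq → ℤP.+-injective (ℤ-cancelˡ x _ _ eq)) (Uniq.upTo⁺ (suc L)))
                       (filter-unique (¬? ∘ inside?) (segment-unique u)) disj)
            (AllP.++⁺ (All.tabulate within-interval) (All.tabulate within-outer)))

  private
    -- Each segment has its own number of steps, while `dense-windows` needs one bound for all; the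
    -- largest integer allowed by the common inequality serves.
    half-bound : ∀ c t → c ℕ.≤ t → ∃[ Q ] (2 ℕ.* Q ℕ.+ c ℕ.≤ t × (∀ q → 2 ℕ.* q ℕ.+ c ℕ.≤ t → q ℕ.≤ Q))
    half-bound c t c≤t = Q
      , ℕP.m≤o∸n⇒m+n≤o (2 ℕ.* Q) c≤t (subst (ℕ._≤ t ℕ.∸ c) (ℕP.*-comm Q 2) (ℕDM.m/n*n≤m (t ℕ.∸ c) 2))
      , λ q h → subst (ℕ._≤ Q) (ℕDM.m*n/n≡m q 2)
          (ℕDM./-monoˡ-≤ {q ℕ.* 2} {t ℕ.∸ c} 2 (ℕP.m+n≤o⇒m≤o∸n (q ℕ.* 2) {c} (subst (λ k → k ℕ.+ c ℕ.≤ t) (ℕP.*-comm 2 q) h)))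
      where
      Q = (t ℕ.∸ c) ℕDM./ 2

  AtMost-interval : ∀ y L → AtMost L (λ w → ∃[ i ] (i ℕ.< L × w ≡ y + + i))
  AtMost-interval y L ws u all = pigeonhole (λ w i → w ≡ y + + i) u
    (λ w∈ → let i , i< , eq = All.lookup all w∈ in i , eq , i<) (λ _ _ p r → trans p (sym r)) (AtMost-< L)

  unit-residue : ∀ L x w → 0 ℕ.< L → ∃[ v ] (w ≈[ + L ] v × ∃[ i ] (i ℕ.< L × v ≡ x + + i))
  unit-residue L x w L>0 =
    let i , i< , p = residue L 1 {w} {x} {{ℕ.>-nonZero L>0}} (congruent (divides (w - x) (sym (ℤP.*-identityʳ (w - x)))))
    in x + + i , subst₂ (λ L i → w ≈[ + L ] x + + i) (ℕP.*-identityʳ L) (ℕP.*-identityʳ i) p , i , i< , refl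

  class-count-unit : (C : Config) → let open Config C in ∀ {aL aR} L z₀ → aL ∈ A → aR ∈ A → aR - aL ≡ + L → 0 ℕ.< L →
    (∀ k → k ℕ.< L → Representations C (+ L) (z₀ + + k) (suc e)) → L ℕ.+ length B ℕ.≤ s ℕ.+ 3 ℕ.* e
  class-count-unit C L z₀ aL∈ aR∈ gap L>0 reps =
    class-count C L 1 z₀ aL∈ aR∈ (trans gap (cong +_ (sym L1))) (subst (0 ℕ.<_) (sym L1) L>0)
      (λ k k< → subst₂ (λ L k → Representations C (+ L) (z₀ + + k) (suc (Config.e C))) (sym L1) (sym (ℕP.*-identityʳ k)) (reps k k<))
    where
    L1 = ℕP.*-identityʳ L

  -- Hull bounds when B is the smaller set

  record Dominant (C : Config) : Set where
    open Config C
    field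
      e-positive : 1 ℕ.≤ e
      smaller : length B ℕ.≤ length A
      -- Here `21 e` is the `17 e` of the equal-size case and twice the loss `2 e` of `block-sums`.
      few-sums : 2 ℕ.* s ℕ.+ 21 ℕ.* e ℕ.+ 1 ℕ.≤ 2 ℕ.* length A ℕ.+ 3 ℕ.* length B

  module _ (C : Config) (D : Dominant C) {aL aR bL bR : ℤ}
           (hA : Hull (Config.A C) aL aR) (hB : Hull (Config.B C) bL bR) where
    open Config C
    open Dominant D

    private
      n = length B
      m = length A

    -- The general lower bound for the sumset leaves a gap of about `n / 2` below the bound of
    -- `few-sums`, and the multiples of `e` must fit into it.
    B-large : 16 ℕ.* e ℕ.≤ n
    B-large = lin 0 (2 ⊛ sumset-lower-bound C hA hB ⊕ few-sums ⊕ e-positive) (arith m n s e)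
      where
      arith : ∀ m n s e → 16 ℕ.* e ℕ.+ (2 ℕ.* (s ℕ.+ 2 ℕ.* e ℕ.+ 1) ℕ.+ (2 ℕ.* m ℕ.+ 3 ℕ.* n) ℕ.+ e) ℕ.+ 0
        ≡ n ℕ.+ (2 ℕ.* (m ℕ.+ n) ℕ.+ (2 ℕ.* s ℕ.+ 21 ℕ.* e ℕ.+ 1) ℕ.+ 1)
      arith = ℕ-solve

    -- The `11 e` is the `17 e` of the block less twice the `3 e` of `Progressions`. What matters is
    -- that `k` stays below `3 n / 2`.
    block-structure : ∀ {p q} → p ∈ A → q ∈ A → p ℤ.≤ q → length (segment A p q) ≡ n →
      ∃[ d ] ∃[ k ] (0 ℕ.< d × (∀ {b} → b ∈ B → b ≈[ + d ] bL) × q ℤ.≤ p + + (k ℕ.* d) × bR ℤ.≤ bL + + (k ℕ.* d)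
        × 2 ℕ.* k ℕ.+ (11 ℕ.* e ℕ.+ 1) ℕ.≤ 3 ℕ.* n)
    block-structure {p} {q} p∈ q∈ p≤q len =
      let d , k , d>0 , _ , b≈ , q≤ , bR≤ , k≤ = equal-size-structure (block C hB p q) n len refl e-positive B-large small (segment-hull p∈ q∈ p≤q) hB
      in d , k , d>0 , b≈ , q≤ , bR≤ , lin 0 (2 ⊛ k≤ ⊕ small) (arith′ k n s₁ e)
      where
      s₁ = s ℕ.+ 2 ℕ.* e ℕ.+ length (segment A p q) ℕ.∸ m
      s₁-eq : s₁ ℕ.+ m ≡ s ℕ.+ 2 ℕ.* e ℕ.+ n
      s₁-eq = trans (ℕP.m∸n+n≡m (block-sums C hB p q [] [] [])) (cong (s ℕ.+ 2 ℕ.* e ℕ.+_) len)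
      small : 2 ℕ.* s₁ ℕ.+ 17 ℕ.* e ℕ.+ 1 ℕ.≤ 5 ℕ.* n
      small = lin 0 (2 ⊛ ℕP.≤-reflexive s₁-eq ⊕ few-sums) (arith s₁ m n s e)
        where
        arith : ∀ t m n s e → 2 ℕ.* t ℕ.+ 17 ℕ.* e ℕ.+ 1 ℕ.+ (2 ℕ.* (s ℕ.+ 2 ℕ.* e ℕ.+ n) ℕ.+ (2 ℕ.* m ℕ.+ 3 ℕ.* n)) ℕ.+ 0
          ≡ 5 ℕ.* n ℕ.+ (2 ℕ.* (t ℕ.+ m) ℕ.+ (2 ℕ.* s ℕ.+ 21 ℕ.* e ℕ.+ 1))
        arith = ℕ-solve
      arith′ : ∀ k n t e → 2 ℕ.* k ℕ.+ (11 ℕ.* e ℕ.+ 1) ℕ.+ (2 ℕ.* (t ℕ.+ 3 ℕ.* e) ℕ.+ 5 ℕ.* n) ℕ.+ 0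
        ≡ 3 ℕ.* n ℕ.+ (2 ℕ.* (k ℕ.+ n) ℕ.+ (2 ℕ.* t ℕ.+ 17 ℕ.* e ℕ.+ 1))
      arith′ = ℕ-solve

    first-block : ∃[ p ] ∃[ q ] (p ∈ A × q ∈ A × p ℤ.≤ q × length (segment A p q) ≡ n)
    first-block =
      let p , q , p∈ , q∈ , p≤ , ≤q , len = extend-segment (n ℕ.∸ length point) uniqueA (Hull.left hA) (Hull.left hA) ℤP.≤-refl
                                              (subst (ℕ._≤ m) (sym n-eq) smaller)
      in p , q , p∈ , q∈ , ℤP.≤-trans p≤ ≤q , trans len n-eq
      where
      point = segment A aL aL
      point≤1 : length point ℕ.≤ 1
      point≤1 = length-⊆ {ys = aL ∷ []} (segment-unique uniqueA)
        (λ x∈ → let _ , lo , hi = segment⁻ {A} {aL} {aL} x∈ in here (ℤP.≤-antisym hi lo))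
      n-eq : n ℕ.∸ length point ℕ.+ length point ≡ n
      n-eq = ℕP.m∸n+n≡m (ℕP.≤-trans point≤1 (∈-length (Hull.left hB)))

    module _ {b₀ : ℤ} (b₀∈ : b₀ ∈ B) (b₁∈ : b₀ + + 1 ∈ B) where

      private
        -- The common difference of each block divides all differences of `B`, hence divides 1.
        short-block : ∀ {p q} → p ∈ A → q ∈ A → p ℤ.≤ q → length (segment A p q) ≡ n →
          ∃[ k ] (q ℤ.≤ p + + k × bR ℤ.≤ bL + + k × 2 ℕ.* k ℕ.+ (11 ℕ.* e ℕ.+ 1) ℕ.≤ 3 ℕ.* n)
        short-block {p} {q} p∈ q∈ p≤q len =
          let d , k , d>0 , b≈ , q≤ , bR≤ , k≤ = block-structure p∈ q∈ p≤q len
              d≡1 = ℕD.∣1⇒≡1 (∣⇒∣ᵤ (subst (+ d ∣_) (unit b₀) (_≈[_]_.difference (≈-trans (b≈ b₁∈) (≈-sym (b≈ b₀∈))))))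
              kd≡k = trans (cong (k ℕ.*_) d≡1) (ℕP.*-identityʳ k)
          in k , subst (λ i → q ℤ.≤ p + + i) kd≡k q≤ , subst (λ i → bR ℤ.≤ bL + + i) kd≡k bR≤ , k≤
          where
          unit : ∀ b → b + + 1 - b ≡ + 1
          unit = ℤ-solve

        bounds : ∃[ Q ] (2 ℕ.* Q ℕ.+ (11 ℕ.* e ℕ.+ 1) ℕ.≤ 3 ℕ.* n × (∀ q → 2 ℕ.* q ℕ.+ (11 ℕ.* e ℕ.+ 1) ℕ.≤ 3 ℕ.* n → q ℕ.≤ Q))
        bounds = half-bound (11 ℕ.* e ℕ.+ 1) (3 ℕ.* n) (lin (4 ℕ.+ 2 ℕ.* n) (B-large ⊕ 5 ⊛ e-positive) (arith e n))
          where
          arith : ∀ e n → 11 ℕ.* e ℕ.+ 1 ℕ.+ (n ℕ.+ 5 ℕ.* e) ℕ.+ (4 ℕ.+ 2 ℕ.* n) ≡ 3 ℕ.* n ℕ.+ (16 ℕ.* e ℕ.+ 5)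
          arith = ℕ-solve
        Q = proj₁ bounds
        Q-small = proj₁ (proj₂ bounds)
        Q-max = proj₂ (proj₂ bounds)

        gapB = hull-gap hB
        w = proj₁ gapB
        bR≡ : bR ≡ bL + + w
        bR≡ = add-gap (proj₂ gapB)
        gapA = hull-gap hA
        K = proj₁ gapA
        aR≡ : aR ≡ aL + + K
        aR≡ = add-gap (proj₂ gapA)
        drop-base : ∀ x {i j} → x + + i ℤ.≤ x + + j → i ℕ.≤ j
        drop-base x {i} {j} h = ℤP.drop‿+≤+ (subst₂ ℤ._≤_ (cancel x (+ i)) (cancel x (+ j)) (ℤP.+-monoˡ-≤ (- x) h))
          where
          cancel : ∀ x y → x + y - x ≡ y
          cancel = ℤ-solve
        w-small : 2 ℕ.* w ℕ.+ (11 ℕ.* e ℕ.+ 1) ℕ.≤ 3 ℕ.* n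
        w-small = let p , q , p∈ , q∈ , p≤q , len = first-block ; k , _ , bR≤ , k≤ = short-block p∈ q∈ p≤q len in
          ℕP.≤-trans (ℕP.+-monoˡ-≤ _ (ℕP.*-monoʳ-≤ 2 (drop-base bL (subst (ℤ._≤ bL + + k) bR≡ bR≤)))) k≤
        n≤w+1 : n ℕ.≤ suc w
        n≤w+1 = hull-length uniqueB hB (proj₂ gapB)
        w>0 : 0 ℕ.< w
        w>0 = ℕP.≤-pred (ℕP.≤-trans (lin 14 (B-large ⊕ 16 ⊛ e-positive) (arith e n)) n≤w+1)
          where
          arith : ∀ e n → 2 ℕ.+ (n ℕ.+ 16 ℕ.* e) ℕ.+ 14 ≡ n ℕ.+ (16 ℕ.* e ℕ.+ 16)
          arith = ℕ-solve

        -- The second alternative bounds the number of holes `L - c` by half of `n + 1 - 11 e`. This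
        -- is `Q + 1 - n` from `dense-windows` with the bound on `Q` inserted.
        Dense : ℕ → ℕ → Set
        Dense L c = n ℕ.≤ c ℕ.+ 1 ⊎ 2 ℕ.* L ℕ.+ 11 ℕ.* e ℕ.≤ 2 ℕ.* c ℕ.+ n ℕ.+ 1
        dense : ∀ x L → aL ℤ.≤ x → x + + L ℤ.≤ aR → Dense L (length (window A x L))
        dense x zero _ _ = inj₂ (lin (5 ℕ.* e ℕ.+ 2 ℕ.* length (window A x 0) ℕ.+ 1) B-large (arith e n (length (window A x 0))))
          where
          arith : ∀ e n c → 2 ℕ.* 0 ℕ.+ 11 ℕ.* e ℕ.+ n ℕ.+ (5 ℕ.* e ℕ.+ 2 ℕ.* c ℕ.+ 1) ≡ 2 ℕ.* c ℕ.+ n ℕ.+ 1 ℕ.+ 16 ℕ.* e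
          arith = ℕ-solve
        dense x (suc L) aL≤x ≤aR = translate (dense-windows n Q uniqueA hA smaller
            (λ {p} p∈ q∈ p≤q len → let k , q≤ , _ , k≤ = short-block p∈ q∈ p≤q len in ℤP.≤-trans q≤ (ℤP.+-monoʳ-≤ p (ℤ.+≤+ (Q-max k k≤))))
            x L aL≤x (ℤP.≤-trans (ℤP.+-monoʳ-≤ x (ℤ.+≤+ (ℕP.n≤1+n L))) ≤aR))
          where
          c = length (window A x (suc L))
          arith : ∀ L n c Q e → 2 ℕ.* suc L ℕ.+ 11 ℕ.* e ℕ.+ (2 ℕ.* (c ℕ.+ suc Q) ℕ.+ 3 ℕ.* n) ℕ.+ 0
            ≡ 2 ℕ.* c ℕ.+ n ℕ.+ 1 ℕ.+ (2 ℕ.* (suc L ℕ.+ n) ℕ.+ (2 ℕ.* Q ℕ.+ (11 ℕ.* e ℕ.+ 1)))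
          arith = ℕ-solve
          translate : n ℕ.≤ c ℕ.+ 1 ⊎ suc L ℕ.+ n ℕ.≤ c ℕ.+ suc Q → Dense (suc L) c
          translate (inj₁ h) = inj₁ h
          translate (inj₂ h) = inj₂ (lin 0 (2 ⊛ h ⊕ Q-small) (arith L n c Q e))

        B° = trim bR B
        B°⊆ : ∀ {b} → b ∈ B° → b ∈ B
        B°⊆ = proj₁ ∘ trim⁻ {bR} {B}
        B°-index : ∀ {b} → b ∈ B° → ∃[ i ] (i ℕ.< w × b ≡ bL + + i)
        B°-index b∈ = let lo , hi = trim-window w hB (ℤP.≤-reflexive bR≡) b∈ in index lo hi
        n≤B° : n ℕ.≤ length B° ℕ.+ 1
        n≤B° = trim-length uniqueB

        -- The second alternative is the sum of two bounds of type `Dense`, because a window that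
        -- wraps around consists of two pieces.
        Enough : ℕ → Set
        Enough c = n ℕ.≤ c ℕ.+ 1 ⊎ 2 ℕ.* w ℕ.+ 22 ℕ.* e ℕ.≤ 2 ℕ.* c ℕ.+ 2 ℕ.* n ℕ.+ 2
        dense⇒enough : ∀ c → Dense w c → Enough c
        dense⇒enough c (inj₁ h) = inj₁ h
        dense⇒enough c (inj₂ h) = inj₂ (lin (5 ℕ.* e ℕ.+ 1) (h ⊕ B-large) (arith w e n c))
          where
          arith : ∀ w e n c → 2 ℕ.* w ℕ.+ 22 ℕ.* e ℕ.+ (2 ℕ.* c ℕ.+ n ℕ.+ 1 ℕ.+ n) ℕ.+ (5 ℕ.* e ℕ.+ 1)
            ≡ 2 ℕ.* c ℕ.+ 2 ℕ.* n ℕ.+ 2 ℕ.+ (2 ℕ.* w ℕ.+ 11 ℕ.* e ℕ.+ 16 ℕ.* e)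
          arith = ℕ-solve
        enough : ∀ c → Enough c → suc e ℕ.+ w ℕ.≤ c ℕ.+ length B°
        enough c (inj₁ h) = ℕP.*-cancelˡ-≤ 2 (lin 20 (2 ⊛ h ⊕ 2 ⊛ n≤B° ⊕ w-small ⊕ B-large ⊕ 25 ⊛ e-positive) (arith w e n c (length B°)))
          where
          arith : ∀ w e n c b → 2 ℕ.* (suc e ℕ.+ w) ℕ.+ (2 ℕ.* (c ℕ.+ 1) ℕ.+ 2 ℕ.* (b ℕ.+ 1) ℕ.+ 3 ℕ.* n ℕ.+ n ℕ.+ 25 ℕ.* e) ℕ.+ 20
            ≡ 2 ℕ.* (c ℕ.+ b) ℕ.+ (2 ℕ.* n ℕ.+ 2 ℕ.* n ℕ.+ (2 ℕ.* w ℕ.+ (11 ℕ.* e ℕ.+ 1)) ℕ.+ 16 ℕ.* e ℕ.+ 25)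
          arith = ℕ-solve
        enough c (inj₂ h) = ℕP.*-cancelˡ-≤ 2 (lin 14 (h ⊕ 2 ⊛ n≤B° ⊕ 20 ⊛ e-positive) (arith w e n c (length B°)))
          where
          arith : ∀ w e n c b → 2 ℕ.* (suc e ℕ.+ w) ℕ.+ (2 ℕ.* c ℕ.+ 2 ℕ.* n ℕ.+ 2 ℕ.+ 2 ℕ.* (b ℕ.+ 1) ℕ.+ 20 ℕ.* e) ℕ.+ 14
            ≡ 2 ℕ.* (c ℕ.+ b) ℕ.+ (2 ℕ.* w ℕ.+ 22 ℕ.* e ℕ.+ 2 ℕ.* n ℕ.+ 20)
          arith = ℕ-solve

        prefix-enough : Enough (length (window A aL w))
        prefix-enough with w ℕP.≤? K
        ... | yes w≤K = dense⇒enough _ (dense aL w ℤP.≤-refl (subst (aL + + w ℤ.≤_) (sym aR≡) (ℤP.+-monoʳ-≤ aL (ℤ.+≤+ w≤K))))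
        ... | no w≰K = inj₁ (ℕP.≤-trans smaller (ℕP.≤-trans (length-⊆ {ys = window A aL w} uniqueA everything) (ℕP.m≤m+n _ 1)))
          where
          everything : ∀ {a} → a ∈ A → a ∈ window A aL w
          everything {a} a∈ = window⁺ a∈ (Hull.lower hA a∈)
            (ℤP.≤-<-trans (subst (a ℤ.≤_) aR≡ (Hull.upper hA a∈)) (ℤP.+-monoʳ-< aL (ℤ.+<+ (ℕP.≰⇒> w≰K))))

      -- Modulo `w` an interval of `w` integers meets every class once, so `B°` and the window of
      -- `A` at `aL` compete for only `w` classes whatever the target is.
      hull-bound-B : ∣ bR - bL ∣ ℕ.+ length A ℕ.≤ s ℕ.+ 3 ℕ.* e
      hull-bound-B = class-count-unit (flip C) w (bL + aL) (Hull.left hB) (Hull.right hB) (proj₂ gapB) w>0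
        (λ k _ → representations (flip C) {Q = λ v → ∃[ i ] (i ℕ.< w × v ≡ aL + + i)} (trim-unique {bR} uniqueB) (window-unique uniqueA) B°⊆ (proj₁ ∘ window⁻ {A} {aL} {w})
          (incongruent-window (trim-window w hB (ℤP.≤-reflexive bR≡))) (incongruent-window (proj₂ ∘ window⁻ {A} {aL} {w}))
          (λ {b} _ → unit-residue w aL b w>0) (λ {a} _ → unit-residue w aL (bL + aL + + k - a) w>0) (AtMost-interval aL w)
          (subst (suc e ℕ.+ w ℕ.≤_) (ℕP.+-comm (length (window A aL w)) (length B°)) (enough _ prefix-enough)))

      -- Modulo the longer hull, the window of A facing a target may wrap around the ends of A.
      hull-bound-A : ∣ aR - aL ∣ ℕ.+ length B ℕ.≤ s ℕ.+ 3 ℕ.* e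
      hull-bound-A with ℕP.≤-total w K
      ... | inj₂ K≤w = ℕP.≤-trans (ℕP.+-mono-≤ K≤w smaller) hull-bound-B
      ... | inj₁ w≤K = class-count-unit C K (aL + bL) (Hull.left hA) (Hull.right hA) (proj₂ gapA) (ℕP.<-≤-trans w>0 w≤K) reps
        where
        incB° : Incongruent (+ K) B°
        incB° = incongruent-window (trim-window K hB (subst (ℤ._≤ bL + + K) (sym bR≡) (ℤP.+-monoʳ-≤ bL (ℤ.+≤+ w≤K))))
        Place : ℤ → ℤ → Set
        Place y v = ∃[ i ] (i ℕ.< w × v ≡ y + + i)
        from : ∀ y xs k → Unique xs → (∀ {a} → a ∈ xs → a ∈ A) → Incongruent (+ K) xs →
          (∀ {a} → a ∈ xs → ∃[ v ] (a ≈[ + K ] v × Place y v)) → (∀ {i} → i ℕ.< w → Place y (aL + bL + + k - (bL + + i))) →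
          Enough (length xs) → Representations C (+ K) (aL + bL + + k) (suc e)
        from y xs k u ⊆A inc cover coverB large = representations C {Q = Place y} u (trim-unique {bR} uniqueB) ⊆A B°⊆ inc incB° cover
          (λ b∈ → _ , ≈-refl _ , cover-B° (B°-index b∈)) (AtMost-interval y w) (enough (length xs) large)
          where
          cover-B° : ∀ {b} → ∃[ i ] (i ℕ.< w × b ≡ bL + + i) → Place y (aL + bL + + k - b)
          cover-B° (i , i< , refl) = coverB i<
        -- As `b` runs over the `w` places from `bL` on, the target less `b` runs over `w`
        -- consecutive integers ending at `aL + k`. They start at `aL + t` with `w + t` equal to
        -- `k + 1`.
        inner-window : ∀ t {k} → w ℕ.+ t ≡ suc k → k ℕ.< K → Representations C (+ K) (aL + bL + + k) (suc e)
        inner-window t {k} eq k<K = from x (window A x w) k (window-unique uniqueA) (proj₁ ∘ window⁻ {A} {x} {w})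
          (incongruent-window (λ m → let _ , lo , hi = window⁻ {A} {x} {w} m in lo , ℤP.<-≤-trans hi (ℤP.+-monoʳ-≤ x (ℤ.+≤+ w≤K))))
          (λ {a} m → let _ , lo , hi = window⁻ {A} {x} {w} m in a , ≈-refl a , index lo hi)
          place
          (dense⇒enough _ (dense x w (ℤP.i≤i+j aL (+ t)) (subst₂ ℤ._≤_ (sym reach) (sym aR≡) (ℤP.+-monoʳ-≤ aL (ℤ.+≤+ k<K)))))
          where
          x = aL + + t
          reach : x + + w ≡ aL + + suc k
          reach = trans (identity aL (+ t) (+ w)) (cong (λ j → aL + + j) eq)
            where
            identity : ∀ a t w → (a + t) + w ≡ a + (w + t)
            identity = ℤ-solve
          identity : ∀ a b i j t → (a + b + (i + j + t)) - (b + i) ≡ (a + t) + j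
          identity = ℤ-solve
          place : ∀ {i} → i ℕ.< w → Place x (aL + bL + + k - (bL + + i))
          place {i} i<w with ℕP.m≤n⇒∃[o]m+o≡n i<w
          ... | j , eq′ = j , subst (j ℕ.<_) eq′ (s≤s (ℕP.m≤n+m j i)) ,
            subst (λ k → aL + bL + + k - (bL + + i) ≡ x + + j) (ℕP.suc-injective (trans (cong (ℕ._+ t) eq′) eq)) (identity aL bL (+ i) (+ j) (+ t))
        -- Now the `w` integers facing the target start at `aL - j`. Adding `K` moves the `j` of
        -- them below `aL` to the last `j` places before `aR`.
        wrapped-window : ∀ j r {k} → suc k ℕ.+ j ≡ w → j ℕ.+ r ≡ K → k ℕ.< K → Representations C (+ K) (aL + bL + + k) (suc e)
        wrapped-window j r {k} eqw eqK k<K = from y (front ++ back) k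
          (++-unique (window-unique uniqueA) (window-unique uniqueA) disj) (proj₁ ∘ located) (incongruent-window (proj₂ ∘ located))
          cover place total
          where
          y = aL - + j
          x = aL + + r
          front = window A aL (suc k)
          back = window A x j
          x+j : x + + j ≡ aR
          x+j = trans (identity aL (+ r) (+ j)) (trans (cong (λ i → aL + + i) eqK) (sym aR≡))
            where
            identity : ∀ a r j → (a + r) + j ≡ a + (j + r)
            identity = ℤ-solve
          k<r : suc k ℕ.≤ r
          k<r = ℕP.+-cancelˡ-≤ j (suc k) r (subst₂ ℕ._≤_ (trans (sym eqw) (ℕP.+-comm (suc k) j)) (sym eqK) w≤K)
          located : ∀ {a} → a ∈ front ++ back → a ∈ A × aL ℤ.≤ a × a ℤ.< aL + + K
          located m with ∈-++⁻ front m
          ... | inj₁ m₁ = let a∈ , lo , hi = window⁻ {A} {aL} {suc k} m₁ in a∈ , lo , ℤP.<-≤-trans hi (ℤP.+-monoʳ-≤ aL (ℤ.+≤+ k<K))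
          ... | inj₂ m₂ = let a∈ , lo , hi = window⁻ {A} {x} {j} m₂ in a∈ , ℤP.≤-trans (ℤP.i≤i+j aL (+ r)) lo , subst (_ ℤ.<_) (trans x+j aR≡) hi
          disj : ∀ {a} → a ∈ front → a ∈ back → ⊥
          disj m₁ m₂ = ℤP.<-irrefl refl (ℤP.<-≤-trans (proj₂ (proj₂ (window⁻ {A} {aL} {suc k} m₁)))
            (ℤP.≤-trans (ℤP.+-monoʳ-≤ aL (ℤ.+≤+ k<r)) (proj₁ (proj₂ (window⁻ {A} {x} {j} m₂)))))
          cover : ∀ {a} → a ∈ front ++ back → ∃[ v ] (a ≈[ + K ] v × Place y v)
          cover {a} m with ∈-++⁻ front m
          ... | inj₁ m₁ = let _ , lo , hi = window⁻ {A} {aL} {suc k} m₁ ; i , i< , eq = index lo hi in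
                  a , ≈-refl a , j ℕ.+ i , subst (j ℕ.+ i ℕ.<_) (trans (ℕP.+-comm j (suc k)) eqw) (ℕP.+-monoʳ-< j i<) , trans eq (identity aL (+ i) (+ j))
            where
            identity : ∀ a i j → a + i ≡ (a - j) + (j + i)
            identity = ℤ-solve
          ... | inj₂ m₂ = let _ , lo , hi = window⁻ {A} {x} {j} m₂ ; i , i< , eq = index lo hi in
                  y + + i , congruent (divides (+ 1) (trans (cong (_- (y + + i)) eq) (trans (identity aL (+ r) (+ i) (+ j)) (cong (λ K → + 1 * + K) eqK))))
                  , i , ℕP.<-≤-trans i< (subst (j ℕ.≤_) eqw (ℕP.m≤n+m j (suc k))) , refl
            where
            identity : ∀ a r i j → (a + r + i) - ((a - j) + i) ≡ + 1 * (j + r)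
            identity = ℤ-solve
          place : ∀ {i} → i ℕ.< w → Place y (aL + bL + + k - (bL + + i))
          place {i} i<w with ℕP.m≤n⇒∃[o]m+o≡n i<w
          ... | j′ , eq = j′ , subst (j′ ℕ.<_) eq (s≤s (ℕP.m≤n+m j′ i))
                , identity aL bL (+ k) (+ i) (+ j) (+ j′) (cong +_ (ℕP.suc-injective (trans eqw (sym eq))))
            where
            identity : ∀ a b k i j j′ → k + j ≡ i + j′ → (a + b + k) - (b + i) ≡ (a - j) + j′
            identity a b k i j j′ h = trans (left a b k i j) (trans (cong (λ t → (a - j) + (t - i)) h) (right a i j j′))
              where
              left : ∀ a b k i j → (a + b + k) - (b + i) ≡ (a - j) + ((k + j) - i)
              left = ℤ-solve
              right : ∀ a i j j′ → (a - j) + ((i + j′) - i) ≡ (a - j) + j′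
              right = ℤ-solve
          c₁ = length front
          c₂ = length back
          arith : ∀ k j e n c₁ c₂ → 2 ℕ.* (suc k ℕ.+ j) ℕ.+ 22 ℕ.* e ℕ.+ (2 ℕ.* c₁ ℕ.+ n ℕ.+ 1 ℕ.+ (2 ℕ.* c₂ ℕ.+ n ℕ.+ 1)) ℕ.+ 0
            ≡ 2 ℕ.* (c₁ ℕ.+ c₂) ℕ.+ 2 ℕ.* n ℕ.+ 2 ℕ.+ (2 ℕ.* suc k ℕ.+ 11 ℕ.* e ℕ.+ (2 ℕ.* j ℕ.+ 11 ℕ.* e))
          arith = ℕ-solve
          combine : Dense (suc k) c₁ → Dense j c₂ → Enough (c₁ ℕ.+ c₂)
          combine (inj₁ h) _ = inj₁ (ℕP.≤-trans h (ℕP.+-monoˡ-≤ 1 (ℕP.m≤m+n c₁ c₂)))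
          combine (inj₂ _) (inj₁ h) = inj₁ (ℕP.≤-trans h (ℕP.+-monoˡ-≤ 1 (ℕP.m≤n+m c₂ c₁)))
          combine (inj₂ h₁) (inj₂ h₂) = inj₂ (subst (λ w → 2 ℕ.* w ℕ.+ 22 ℕ.* e ℕ.≤ 2 ℕ.* (c₁ ℕ.+ c₂) ℕ.+ 2 ℕ.* n ℕ.+ 2) eqw
            (lin 0 (h₁ ⊕ h₂) (arith k j e n c₁ c₂)))
          total : Enough (length (front ++ back))
          total = subst Enough (sym (length-++ front)) (combine
            (dense aL (suc k) ℤP.≤-refl (subst (aL + + suc k ℤ.≤_) (sym aR≡) (ℤP.+-monoʳ-≤ aL (ℤ.+≤+ k<K))))
            (dense x j (ℤP.i≤i+j aL (+ r)) (ℤP.≤-reflexive x+j)))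
        reps : ∀ k → k ℕ.< K → Representations C (+ K) (aL + bL + + k) (suc e)
        reps k k<K with ℕP.≤-total w (suc k)
        ... | inj₁ w≤ = let t , eq = ℕP.m≤n⇒∃[o]m+o≡n w≤ in inner-window t eq k<K
        ... | inj₂ ≤w = let j , eq = ℕP.m≤n⇒∃[o]m+o≡n ≤w
                            r , eqK = ℕP.m≤n⇒∃[o]m+o≡n (ℕP.≤-trans (subst (j ℕ.≤_) eq (ℕP.m≤n+m j (suc k))) w≤K)
                        in wrapped-window j r eq eqK k<K

  -- Covering both sets by progressions

  Covered : Config → Set
  Covered C = ∃[ a ] ∃[ b ] ∃[ d ] ∃[ K ] ∃[ w ] (0 ℕ.< d
    × (∀ {x} → x ∈ A → x ∈ AP a d (suc K)) × (∀ {x} → x ∈ B → x ∈ AP b d (suc w))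
    × K ℕ.+ length B ℕ.≤ s ℕ.+ 3 ℕ.* e × w ℕ.+ length A ℕ.≤ s ℕ.+ 3 ℕ.* e)
    where open Config C

  scaled-hull-covers : ∀ {X X′ tL tR} d l → map (λ t → l + t * + d) X′ ≡ X → Hull X′ tL tR →
    ∀ {x} → x ∈ X → x ∈ AP (l + tL * + d) d (suc ∣ tR - tL ∣)
  scaled-hull-covers {X} {X′} {tL} {tR} d l eq h {x} x∈ = place (∈-map⁻ (λ t → l + t * + d) (subst (x ∈_) (sym eq) x∈))
    where
    K = ∣ tR - tL ∣
    identity : ∀ l t i d → l + (t + i) * d ≡ l + t * d + i * d
    identity = ℤ-solve
    place : ∃[ t ] (t ∈ X′ × x ≡ l + t * + d) → x ∈ AP (l + tL * + d) d (suc K)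
    place (t , t∈ , refl) =
      let i , i< , t≡ = index (Hull.lower h t∈) (<-window tL K (subst (t ℤ.≤_) (add-gap (proj₂ (hull-gap h))) (Hull.upper h t∈)))
      in subst (_∈ AP (l + tL * + d) d (suc K))
           (sym (trans (cong (λ t → l + t * + d) t≡) (identity l tL (+ i) (+ d))))
           (∈-map⁺ (λ i → l + tL * + d + + i * + d) (∈-upTo⁺ i<))

  dominant-covered : (C : Config) → Dominant C → 0 ℕ.< length (Config.B C) → Covered C
  dominant-covered C D B>0 = assemble (hull A (ℕP.≤-trans B>0 smaller)) (hull B B>0)
    where
    open Config C
    open Dominant D
    assemble : ∃[ aL ] ∃[ aR ] Hull A aL aR → ∃[ bL ] ∃[ bR ] Hull B bL bR → Covered C
    assemble (aL , aR , hA) (bL , bR , hB) =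
      -- Any segment with `n` elements can supply `d`. It controls all of `B`, and `same-class`
      -- extends the congruence to the whole of `A`.
      let p , q , p∈ , q∈ , p≤q , len = first-block C D hA hB
          d , k , d>0 , b≈ , _ , bR≤ , k≤ = block-structure C D hA hB p∈ q∈ p≤q len
      in rescaled d k d>0 b≈ bR≤ k≤
      where
      n = length B
      m = length A
      rescaled : ∀ d k → 0 ℕ.< d → (∀ {b} → b ∈ B → b ≈[ + d ] bL) → bR ℤ.≤ bL + + (k ℕ.* d) →
        2 ℕ.* k ℕ.+ (11 ℕ.* e ℕ.+ 1) ℕ.≤ 3 ℕ.* n → Covered C
      rescaled d k d>0 b≈ bR≤ k≤ = unscale (rescale d aL A a≈) (rescale d bL B b≈)
        where
        large = B-large C D hA hB
        few : s ℕ.+ 3 ℕ.* e ℕ.+ 2 ℕ.< m ℕ.+ 2 ℕ.* n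
        few = ℕP.*-cancelˡ-≤ 2 (lin 26 (few-sums ⊕ large ⊕ 31 ⊛ e-positive) (arith m n s e))
          where
          arith : ∀ m n s e → 2 ℕ.* suc (s ℕ.+ 3 ℕ.* e ℕ.+ 2) ℕ.+ (2 ℕ.* m ℕ.+ 3 ℕ.* n ℕ.+ n ℕ.+ 31 ℕ.* e) ℕ.+ 26
            ≡ 2 ℕ.* (m ℕ.+ 2 ℕ.* n) ℕ.+ (2 ℕ.* s ℕ.+ 21 ℕ.* e ℕ.+ 1 ℕ.+ 16 ℕ.* e ℕ.+ 31)
          arith = ℕ-solve
        a≈ : ∀ {a} → a ∈ A → a ≈[ + d ] aL
        a≈ a∈ = ≈-trans (same-class C hA hB d b≈ few a∈) (≈-sym (same-class C hA hB d b≈ few (Hull.left hA)))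
        thick : 2 ℕ.+ k ℕ.< 2 ℕ.* n
        thick = ℕP.*-cancelˡ-≤ 2 (lin 22 (k≤ ⊕ large ⊕ 27 ⊛ e-positive) (arith k n e))
          where
          arith : ∀ k n e → 2 ℕ.* suc (2 ℕ.+ k) ℕ.+ (3 ℕ.* n ℕ.+ n ℕ.+ 27 ℕ.* e) ℕ.+ 22
            ≡ 2 ℕ.* (2 ℕ.* n) ℕ.+ (2 ℕ.* k ℕ.+ (11 ℕ.* e ℕ.+ 1) ℕ.+ 16 ℕ.* e ℕ.+ 27)
          arith = ℕ-solve
        unscale : ∃[ A′ ] (map (λ t → aL + t * + d) A′ ≡ A) → ∃[ B′ ] (map (λ t → bL + t * + d) B′ ≡ B) → Covered C
        unscale (A′ , eqA) (B′ , eqB) = finish (hull A′ (subst (0 ℕ.<_) (sym lenA) (ℕP.≤-trans B>0 smaller))) (hull B′ (subst (0 ℕ.<_) (sym lenB) B>0))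
          where
          lenA : length A′ ≡ m
          lenA = trans (sym (length-map (λ t → aL + t * + d) A′)) (cong length eqA)
          lenB : length B′ ≡ n
          lenB = trans (sym (length-map (λ t → bL + t * + d) B′)) (cong length eqB)
          C′ : Config
          C′ = scale C d aL bL A′ B′ d>0 eqA eqB
          D′ : Dominant C′
          D′ = record
            { e-positive = e-positive
            ; smaller = subst₂ ℕ._≤_ (sym lenB) (sym lenA) smaller
            ; few-sums = subst₂ (λ m n → 2 ℕ.* s ℕ.+ 21 ℕ.* e ℕ.+ 1 ℕ.≤ 2 ℕ.* m ℕ.+ 3 ℕ.* n) (sym lenA) (sym lenB) few-sums }
          adjacent : ∃[ t ] (t ∈ B′ × t + + 1 ∈ B′)
          adjacent = let b , b∈ , b′∈ = consecutive uniqueB hB d>0 bR≤ b≈ thick in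
            pull (∈-map⁻ (λ t → bL + t * + d) (subst (b ∈_) (sym eqB) b∈)) (∈-map⁻ (λ t → bL + t * + d) (subst (b + + d ∈_) (sym eqB) b′∈))
            where
            identity : ∀ l t d → l + t * d + d ≡ l + (t + + 1) * d
            identity = ℤ-solve
            pull : ∀ {b} → ∃[ t ] (t ∈ B′ × b ≡ bL + t * + d) → ∃[ t ] (t ∈ B′ × b + + d ≡ bL + t * + d) → ∃[ t ] (t ∈ B′ × t + + 1 ∈ B′)
            pull (t , t∈ , refl) (t′ , t′∈ , eq) = t , t∈ ,
              subst (_∈ B′) (sym (affine-injective d bL d>0 (trans (sym (identity bL t (+ d))) eq))) t′∈
          finish : ∃[ tL ] ∃[ tR ] Hull A′ tL tR → ∃[ uL ] ∃[ uR ] Hull B′ uL uR → Covered C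
          finish (tL , tR , hA′) (uL , uR , hB′) =
            let t , t∈ , t′∈ = adjacent in
            aL + tL * + d , bL + uL * + d , d , ∣ tR - tL ∣ , ∣ uR - uL ∣ , d>0
            , scaled-hull-covers d aL eqA hA′ , scaled-hull-covers d bL eqB hB′
            , subst (λ k → ∣ tR - tL ∣ ℕ.+ k ℕ.≤ s ℕ.+ 3 ℕ.* e) lenB (hull-bound-A C′ D′ hA′ hB′ t∈ t′∈)
            , subst (λ k → ∣ uR - uL ∣ ℕ.+ k ℕ.≤ s ℕ.+ 3 ℕ.* e) lenA (hull-bound-B C′ D′ hA′ hB′ t∈ t′∈)

  covered : (C : Config) → let open Config C in 1 ℕ.≤ e → 0 ℕ.< length A → 0 ℕ.< length B →
    2 ℕ.* s ℕ.+ 21 ℕ.* e ℕ.+ 1 ℕ.≤ 2 ℕ.* length A ℕ.+ 2 ℕ.* length B ℕ.+ length A →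
    2 ℕ.* s ℕ.+ 21 ℕ.* e ℕ.+ 1 ℕ.≤ 2 ℕ.* length A ℕ.+ 2 ℕ.* length B ℕ.+ length B → Covered C
  covered C e>0 A>0 B>0 fewA fewB with ℕP.≤-total (length (Config.B C)) (length (Config.A C))
  ... | inj₁ B≤A = dominant-covered C (record { e-positive = e>0 ; smaller = B≤A
                     ; few-sums = ℕP.≤-trans fewB (ℕP.≤-reflexive (arith (length A) (length B))) }) B>0
    where
    open Config C
    arith : ∀ m n → 2 ℕ.* m ℕ.+ 2 ℕ.* n ℕ.+ n ≡ 2 ℕ.* m ℕ.+ 3 ℕ.* n
    arith = ℕ-solve
  ... | inj₂ A≤B =
    let b , a , d , w , K , d>0 , inB , inA , w≤ , K≤ = dominant-covered (flip C) (record { e-positive = e>0 ; smaller = A≤B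
                     ; few-sums = ℕP.≤-trans fewA (ℕP.≤-reflexive (arith (length A) (length B))) }) A>0
    in a , b , d , K , w , d>0 , inA , inB , K≤ , w≤
    where
    open Config C
    arith : ∀ m n → 2 ℕ.* m ℕ.+ 2 ℕ.* n ℕ.+ m ≡ 2 ℕ.* n ℕ.+ 3 ℕ.* m
    arith = ℕ-solve

  -- Typical elements

  module _ (U V : List ℤ) (Γ : List (ℤ × ℤ)) (uniqueU : Unique U) (uniqueV : Unique V) (uniqueΓ : Unique Γ)
           (Γ⊆ : All (λ p → proj₁ p ∈ U × proj₂ p ∈ V) Γ) where

    private
      Edge : ℤ → ℤ → Set
      Edge u v = (u , v) ∈ Γ

      edge? : ∀ u v → Dec (Edge u v)
      edge? u v = (u , v) ∈Γ? Γ
        where open import Data.List.Membership.DecPropositional (≡-dec ℤP._≟_ ℤP._≟_) using () renaming (_∈?_ to _∈Γ?_)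

      NonEdge : ℤ × ℤ → Set
      NonEdge (u , v) = u ∈ U × v ∈ V × ¬ Edge u v

      non-edges : AtMost (length U ℕ.* length V ℕ.∸ length Γ) NonEdge
      non-edges ps u all = ℕP.m+n≤o⇒m≤o∸n (length ps) (subst (ℕ._≤ length U ℕ.* length V) (length-++ ps)
        (AtMost-× U V (ps ++ Γ) (++-unique u uniqueΓ (λ p∈ p∈Γ → proj₂ (proj₂ (All.lookup all p∈)) p∈Γ))
          (AllP.++⁺ (All.map (λ (u∈ , v∈ , _) → u∈ , v∈) all) Γ⊆)))

      missingV : ℤ → List ℤ
      missingV u = filter (¬? ∘ edge? u) V

      missingU : ℤ → List ℤ
      missingU v = filter (λ u → ¬? (edge? u v)) U

    typicalU : ℕ → List ℤ
    typicalU k = filter (λ u → length (missingV u) ℕP.≤? k) U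

    typicalV : ℕ → List ℤ
    typicalV k = filter (λ v → length (missingU v) ℕP.≤? k) V

    typicalU⁻ : ∀ {k u} → u ∈ typicalU k → u ∈ U × length (missingV u) ℕ.≤ k
    typicalU⁻ {k} = ∈-filter⁻ (λ u → length (missingV u) ℕP.≤? k) {xs = U}

    typicalV⁻ : ∀ {k v} → v ∈ typicalV k → v ∈ V × length (missingU v) ℕ.≤ k
    typicalV⁻ {k} = ∈-filter⁻ (λ v → length (missingU v) ℕP.≤? k) {xs = V}

    private
      -- Each atypical element carries `suc j` missing pairs. The strict bound on all missing pairs
      -- is what gives `i` instead of `suc i`.
      few-rows : ∀ {i j l} → length U ℕ.* length V ℕ.< length Γ ℕ.+ suc i ℕ.* suc j → l ℕ.* suc j ℕ.≤ length U ℕ.* length V ℕ.∸ length Γ → l ℕ.≤ i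
      few-rows {i} {j} {l} dense h = ℕP.≤-pred (ℕP.*-cancelʳ-< (suc j) l (suc i) (ℕP.≤-<-trans h bound))
        where
        bound : length U ℕ.* length V ℕ.∸ length Γ ℕ.< suc i ℕ.* suc j
        bound = ℕP.m<n+o⇒m∸n<o (length U ℕ.* length V) (length Γ) dense

    typicalU-length : ∀ i j → length U ℕ.* length V ℕ.< length Γ ℕ.+ suc i ℕ.* suc j → length U ℕ.≤ length (typicalU j) ℕ.+ i
    typicalU-length i j dense = filter-most typical? uniqueU λ xs u all → few-rows dense
        (doubleCounting (λ x p → x ≡ proj₁ p) u
          (λ {x} x∈ → let x∈U , atypical = All.lookup all x∈ in
            map (x ,_) (missingV x) , Uniq.map⁺ (cong proj₂) (filter-unique (¬? ∘ edge? x) uniqueV)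
            , subst (suc j ℕ.≤_) (sym (length-map (x ,_) (missingV x))) (ℕP.≰⇒> atypical)
            , AllP.map⁺ (All.tabulate λ y∈ → let y∈V , ¬edge = ∈-filter⁻ (¬? ∘ edge? x) {xs = V} y∈ in refl , x∈U , y∈V , ¬edge))
          (λ _ _ p q → trans p (sym q)) non-edges)
      where
      typical? : Decidable (λ u → length (missingV u) ℕ.≤ j)
      typical? u = length (missingV u) ℕP.≤? j

    typicalV-length : ∀ i j → length U ℕ.* length V ℕ.< length Γ ℕ.+ suc i ℕ.* suc j → length V ℕ.≤ length (typicalV i) ℕ.+ j
    typicalV-length i j dense = filter-most typical? uniqueV λ xs u all →
        few-rows (subst (λ t → length U ℕ.* length V ℕ.< length Γ ℕ.+ t) (ℕP.*-comm (suc i) (suc j)) dense)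
        (doubleCounting (λ x p → x ≡ proj₂ p) u
          (λ {x} x∈ → let x∈V , atypical = All.lookup all x∈ in
            map (_, x) (missingU x) , Uniq.map⁺ (cong proj₁) (filter-unique (λ u → ¬? (edge? u x)) uniqueU)
            , subst (suc i ℕ.≤_) (sym (length-map (_, x) (missingU x))) (ℕP.≰⇒> atypical)
            , AllP.map⁺ (All.tabulate λ y∈ → let y∈U , ¬edge = ∈-filter⁻ (λ u → ¬? (edge? u x)) {xs = U} y∈ in refl , y∈U , x∈V , ¬edge))
          (λ _ _ p q → trans p (sym q)) non-edges)
      where
      typical? : Decidable (λ v → length (missingU v) ℕ.≤ i)
      typical? v = length (missingU v) ℕP.≤? i

    typical-config : ∀ i j e → i ℕ.≤ e → j ℕ.≤ e → length U ℕ.* length V ℕ.< length Γ ℕ.+ suc i ℕ.* suc j → Config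
    typical-config i j e i≤e j≤e dense = record
      { e = e ; s = length (restrictedSumset Γ) ; A = typicalU j ; B = typicalV i
      ; uniqueA = filter-unique (λ u → length (missingV u) ℕP.≤? j) uniqueU
      ; uniqueB = filter-unique (λ v → length (missingU v) ℕP.≤? i) uniqueV
      ; G = Edge ; G? = edge? ; S = _∈ restrictedSumset Γ ; S? = _∈? restrictedSumset Γ
      ; sums = λ _ _ g → ∈-deduplicate⁺ ℤP._≟_ (∈-map⁺ (λ p → proj₁ p + proj₂ p) g)
      ; sizeS = AtMost-∈ (restrictedSumset Γ)
      ; missA = λ {a} a∈ bs u all → ℕP.≤-trans (length-⊆ {ys = missingV a} u
          (λ b∈ → let b∈B , ¬g = All.lookup all b∈ in ∈-filter⁺ (¬? ∘ edge? a) (proj₁ (typicalV⁻ b∈B)) ¬g))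
          (ℕP.≤-trans (proj₂ (typicalU⁻ a∈)) j≤e)
      ; missB = λ {b} b∈ as u all → ℕP.≤-trans (length-⊆ {ys = missingU b} u
          (λ a∈ → let a∈A , ¬g = All.lookup all a∈ in ∈-filter⁺ (λ u → ¬? (edge? u b)) (proj₁ (typicalU⁻ a∈A)) ¬g))
          (ℕP.≤-trans (proj₂ (typicalV⁻ b∈)) i≤e)
      ; missing = λ ps u all → ℕP.≤-pred (ℕP.<-≤-trans
          (ℕP.≤-<-trans (non-edges ps u (All.map (λ (a∈ , b∈ , ¬g) → proj₁ (typicalU⁻ a∈) , proj₁ (typicalV⁻ b∈) , ¬g) all))
            (ℕP.m<n+o⇒m∸n<o (length U ℕ.* length V) (length Γ) dense))
          (ℕP.≤-trans (ℕP.*-mono-≤ (s≤s i≤e) (s≤s j≤e)) (ℕP.≤-reflexive (square e)))) }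
      where
      square : ∀ e → suc e ℕ.* suc e ≡ suc (e ℕ.* (2 ℕ.+ e))
      square = ℕ-solve

    -- i, j and e stand for the integer parts of √ε |U|, √ε |V| and √ε max(|U|, |V|).
    discrete-theorem : ∀ i j e → 1 ℕ.≤ e → i ℕ.≤ e → j ℕ.≤ e → i ℕ.< length U → j ℕ.< length V →
      length U ℕ.* length V ℕ.< length Γ ℕ.+ suc i ℕ.* suc j →
      let s = length (restrictedSumset Γ) in
      26 ℕ.* e ℕ.+ 2 ℕ.* s ℕ.< (length U ℕ.⊓ length V) ℕ.+ 2 ℕ.* length U ℕ.+ 2 ℕ.* length V →
      ∃[ a ] ∃[ b ] ∃[ d ] ∃[ L ] ∃[ K ] (1 ℕ.≤ d
        × L ℕ.+ length V ℕ.≤ s ℕ.+ 5 ℕ.* e × K ℕ.+ length U ℕ.≤ s ℕ.+ 5 ℕ.* e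
        × length U ℕ.≤ length (inter (AP a d L) U) ℕ.+ i × length V ℕ.≤ length (inter (AP b d K) V) ℕ.+ j)
    discrete-theorem i j e e>0 i≤e j≤e i<U j<V dense few =
      let a , b , d , K , w , d>0 , inA , inB , K≤ , w≤ = covered C e>0
            (ℕP.≰⇒> (λ h → ℕP.<⇒≱ i<U (ℕP.≤-trans U≤ (ℕP.+-monoˡ-≤ i h))))
            (ℕP.≰⇒> (λ h → ℕP.<⇒≱ j<V (ℕP.≤-trans V≤ (ℕP.+-monoˡ-≤ j h))))
            -- The atypical elements cost `3 i + 2 j`, at most `5 e`, which turns `26 e` into
            -- `21 e`; the next line has the multiplicities exchanged.
            (lin 0 (few ⊕ ℕP.m⊓n≤m u v ⊕ 3 ⊛ U≤ ⊕ 3 ⊛ i≤e ⊕ 2 ⊛ V≤ ⊕ 2 ⊛ j≤e) (arith₁ e s u v (u ℕ.⊓ v) m n i j))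
            (lin 0 (few ⊕ ℕP.m⊓n≤n u v ⊕ 2 ⊛ U≤ ⊕ 2 ⊛ i≤e ⊕ 3 ⊛ V≤ ⊕ 3 ⊛ j≤e) (arith₂ e s u v (u ℕ.⊓ v) m n i j))
      in a , b , d , suc K , suc w , d>0
        -- A hull of length `K` has `suc K` terms. To the `3 e` of the hull bound, `j ≤ e` is added
        -- for the atypical elements and `1 ≤ e` for the extra term.
        , lin 0 (K≤ ⊕ V≤ ⊕ j≤e ⊕ e>0) (arith₃ K v s e n j) , lin 0 (w≤ ⊕ U≤ ⊕ i≤e ⊕ e>0) (arith₃ w u s e m i)
        , ℕP.≤-trans U≤ (ℕP.+-monoˡ-≤ i (length-⊆ uA (λ x∈ → ∈-filter⁺ (_∈? AP a d (suc K)) (proj₁ (typicalU⁻ x∈)) (inA x∈))))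
        , ℕP.≤-trans V≤ (ℕP.+-monoˡ-≤ j (length-⊆ uB (λ x∈ → ∈-filter⁺ (_∈? AP b d (suc w)) (proj₁ (typicalV⁻ x∈)) (inB x∈))))
      where
      C = typical-config i j e i≤e j≤e dense
      uA = Config.uniqueA C
      uB = Config.uniqueB C
      s = length (restrictedSumset Γ)
      u = length U
      v = length V
      m = length (typicalU j)
      n = length (typicalV i)
      U≤ : u ℕ.≤ m ℕ.+ i
      U≤ = typicalU-length i j dense
      V≤ : v ℕ.≤ n ℕ.+ j
      V≤ = typicalV-length i j dense
      arith₁ : ∀ e s u v N m n i j →
        2 ℕ.* s ℕ.+ 21 ℕ.* e ℕ.+ 1 ℕ.+ (N ℕ.+ 2 ℕ.* u ℕ.+ 2 ℕ.* v ℕ.+ u ℕ.+ 3 ℕ.* (m ℕ.+ i) ℕ.+ 3 ℕ.* e ℕ.+ 2 ℕ.* (n ℕ.+ j) ℕ.+ 2 ℕ.* e) ℕ.+ 0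
        ≡ 2 ℕ.* m ℕ.+ 2 ℕ.* n ℕ.+ m ℕ.+ (suc (26 ℕ.* e ℕ.+ 2 ℕ.* s) ℕ.+ N ℕ.+ 3 ℕ.* u ℕ.+ 3 ℕ.* i ℕ.+ 2 ℕ.* v ℕ.+ 2 ℕ.* j)
      arith₁ = ℕ-solve
      arith₂ : ∀ e s u v N m n i j →
        2 ℕ.* s ℕ.+ 21 ℕ.* e ℕ.+ 1 ℕ.+ (N ℕ.+ 2 ℕ.* u ℕ.+ 2 ℕ.* v ℕ.+ v ℕ.+ 2 ℕ.* (m ℕ.+ i) ℕ.+ 2 ℕ.* e ℕ.+ 3 ℕ.* (n ℕ.+ j) ℕ.+ 3 ℕ.* e) ℕ.+ 0
        ≡ 2 ℕ.* m ℕ.+ 2 ℕ.* n ℕ.+ n ℕ.+ (suc (26 ℕ.* e ℕ.+ 2 ℕ.* s) ℕ.+ N ℕ.+ 2 ℕ.* u ℕ.+ 2 ℕ.* i ℕ.+ 3 ℕ.* v ℕ.+ 3 ℕ.* j)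
      arith₂ = ℕ-solve
      arith₃ : ∀ K v s e n j → suc K ℕ.+ v ℕ.+ (s ℕ.+ 3 ℕ.* e ℕ.+ (n ℕ.+ j) ℕ.+ e ℕ.+ e) ℕ.+ 0
        ≡ s ℕ.+ 5 ℕ.* e ℕ.+ (K ℕ.+ n ℕ.+ v ℕ.+ j ℕ.+ 1)
      arith₃ = ℕ-solve

open import Data.Rational using (ℚ; _/_; _≤_; _<_; _*_; _+_; _-_; 0ℚ; 1ℚ; toℚᵘ; nonNegative; positive)

-- Square roots of ε in integers

toℚᵘ-ℕ→ℚ : ∀ n → toℚᵘ (ℕ→ℚ n) ≡ mkℚᵘ (+ n) 0
toℚᵘ-ℕ→ℚ n = cong toℚᵘ (ℚP.normalize-coprime (Coprime.sym (Coprime.1-coprimeTo n)))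

ℕ→ℚ-+ : ∀ m n → ℕ→ℚ (m ℕ.+ n) ≡ ℕ→ℚ m + ℕ→ℚ n
ℕ→ℚ-+ m n = ℚP.toℚᵘ-injective (ℚᵘP.≃-trans
  (subst₂ (λ p q → p ≃ q) (sym (toℚᵘ-ℕ→ℚ (m ℕ.+ n))) (cong₂ ℚᵘ._+_ (sym (toℚᵘ-ℕ→ℚ m)) (sym (toℚᵘ-ℕ→ℚ n))) (*≡* (cong (ℤ._* + 1) (cong₂ ℤ._+_ (sym (ℤP.*-identityʳ (+ m))) (sym (ℤP.*-identityʳ (+ n)))))))
  (ℚᵘP.≃-sym (ℚP.toℚᵘ-homo-+ (ℕ→ℚ m) (ℕ→ℚ n))))

ℕ→ℚ-* : ∀ m n → ℕ→ℚ (m ℕ.* n) ≡ ℕ→ℚ m * ℕ→ℚ n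
ℕ→ℚ-* m n = ℚP.toℚᵘ-injective (ℚᵘP.≃-trans
  (subst₂ (λ p q → p ≃ q) (sym (toℚᵘ-ℕ→ℚ (m ℕ.* n))) (cong₂ ℚᵘ._*_ (sym (toℚᵘ-ℕ→ℚ m)) (sym (toℚᵘ-ℕ→ℚ n))) (*≡* (cong (ℤ._* + 1) (ℤP.pos-* m n))))
  (ℚᵘP.≃-sym (ℚP.toℚᵘ-homo-* (ℕ→ℚ m) (ℕ→ℚ n))))

ℕ→ℚ-mono : ∀ {m n} → m ℕ.≤ n → ℕ→ℚ m ≤ ℕ→ℚ n
ℕ→ℚ-mono {m} {n} m≤n = ℚP.toℚᵘ-cancel-≤ (subst₂ ℚᵘ._≤_ (sym (toℚᵘ-ℕ→ℚ m)) (sym (toℚᵘ-ℕ→ℚ n))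
  (*≤* (subst₂ ℤ._≤_ (sym (ℤP.*-identityʳ (+ m))) (sym (ℤP.*-identityʳ (+ n))) (ℤ.+≤+ m≤n))))

ℕ→ℚ-cancel-< : ∀ {m n} → ℕ→ℚ m < ℕ→ℚ n → m ℕ.< n
ℕ→ℚ-cancel-< h = ℕP.≰⇒> λ n≤m → ℚP.<-irrefl refl (ℚP.<-≤-trans h (ℕ→ℚ-mono n≤m))

square-mono : ∀ {x y} → 0ℚ ≤ x → x ≤ y → x * x ≤ y * y
square-mono {x} {y} 0≤x x≤y = ℚP.≤-trans (ℚP.*-monoˡ-≤-nonNeg x {{nonNegative 0≤x}} x≤y)
  (ℚP.*-monoʳ-≤-nonNeg y {{nonNegative (ℚP.≤-trans 0≤x x≤y)}} x≤y)

*-mono-< : ∀ {x y z w} → 0ℚ ≤ x → 0ℚ ≤ z → x < y → z < w → x * z < y * w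
*-mono-< {x} {y} {z} {w} 0≤x 0≤z x<y z<w = ℚP.≤-<-trans (ℚP.*-monoʳ-≤-nonNeg z {{nonNegative 0≤z}} (ℚP.<⇒≤ x<y))
  (ℚP.*-monoʳ-<-pos y {{positive (ℚP.≤-<-trans 0≤x x<y)}} z<w)

*-nonneg : ∀ {x y} → 0ℚ ≤ x → 0ℚ ≤ y → 0ℚ ≤ x * y
*-nonneg {x} {y} 0≤x 0≤y = subst (_≤ x * y) (ℚP.*-zeroʳ x) (ℚP.*-monoˡ-≤-nonNeg x {{nonNegative 0≤x}} 0≤y)

≤-rearrange : ∀ {x y L R} → L ≤ R → x + R ≡ y + L → x ≤ y
≤-rearrange {x} {y} {L} {R} h eq = subst₂ _≤_ (cancel x R) (cancel y R)
  (ℚP.+-monoˡ-≤ (0ℚ - R) (ℚP.≤-trans (ℚP.≤-reflexive eq) (ℚP.+-monoʳ-≤ y h)))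
  where
  open +-*-Solver
  cancel : ∀ x R → x + R + (0ℚ - R) ≡ x
  cancel = solve 2 (λ x R → x :+ R :+ (con 0ℚ :- R) := x) refl

ℕ→ℚ-nonneg : ∀ n → 0ℚ ≤ ℕ→ℚ n
ℕ→ℚ-nonneg n = ℕ→ℚ-mono {0} {n} z≤n

Below : ℚ → ℕ → ℕ → Set
Below ε k m = ℕ→ℚ (k ℕ.* k) ≤ ε * (ℕ→ℚ m * ℕ→ℚ m)

Floor√ : ℚ → ℕ → ℕ → Set
Floor√ ε m k = Below ε k m × ε * (ℕ→ℚ m * ℕ→ℚ m) < ℕ→ℚ (suc k ℕ.* suc k)

last-true : {P : ℕ → Set} → (∀ k → Dec (P k)) → ∀ m → P 0 → ¬ P m → ∃[ k ] (k ℕ.< m × P k × ¬ P (suc k))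
last-true P? zero p0 ¬pm = contradiction p0 ¬pm
last-true P? (suc m) p0 ¬pm with P? m
... | yes pm = m , ℕP.≤-refl , pm , ¬pm
... | no ¬p = let k , k<m , p , ¬p′ = last-true P? m p0 ¬p in k , ℕP.m<n⇒m<1+n k<m , p , ¬p′

-- The integer part is searched for below `m`, which succeeds because `ε` is less than 1. The strict
-- inequality `k < m` later keeps the typical sets nonempty.
floor√ : ∀ {ε} → 0ℚ ≤ ε → ε < 1ℚ → ∀ m → 0 ℕ.< m → ∃[ k ] (k ℕ.< m × Floor√ ε m k)
floor√ {ε} 0≤ε ε<1 m m>0 =
  let k , k<m , below , ¬below = last-true (λ k → ℕ→ℚ (k ℕ.* k) ℚP.≤? ε * (ℕ→ℚ m * ℕ→ℚ m)) m
        (*-nonneg 0≤ε (*-nonneg (ℕ→ℚ-nonneg m) (ℕ→ℚ-nonneg m))) not-m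
  in k , k<m , below , ℚP.≰⇒> ¬below
  where
  m²>0 : 0ℚ < ℕ→ℚ m * ℕ→ℚ m
  m²>0 = ℚP.<-≤-trans (toWitness {a? = 0ℚ ℚP.<? 1ℚ} tt)
    (ℚP.≤-trans (ℕ→ℚ-mono {1} {m ℕ.* m} (ℕP.*-mono-≤ m>0 m>0)) (ℚP.≤-reflexive (ℕ→ℚ-* m m)))
  not-m : ¬ Below ε m m
  not-m h = ℚP.<-irrefl (ℚP.*-identityˡ (ℕ→ℚ m * ℕ→ℚ m)) (ℚP.≤-<-trans (ℚP.≤-trans (ℚP.≤-reflexive (ℚP.*-identityˡ _)) (ℚP.≤-trans (ℚP.≤-reflexive (sym (ℕ→ℚ-* m m))) h))
    (ℚP.<-≤-trans (ℚP.*-monoˡ-<-pos (ℕ→ℚ m * ℕ→ℚ m) {{positive m²>0}} ε<1) (ℚP.≤-reflexive (ℚP.*-identityˡ _))))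

below-scale : ∀ ε c k m → Below ε k m → Below ε (c ℕ.* k) (c ℕ.* m)
below-scale ε c k m h = subst₂ _≤_
  (trans (sym (ℕ→ℚ-* (c ℕ.* c) (k ℕ.* k))) (cong ℕ→ℚ (regroup c k)))
  (trans (cong (_* (ε * (ℕ→ℚ m * ℕ→ℚ m))) (ℕ→ℚ-* c c))
    (trans (solve 3 (λ c ε m → c :* c :* (ε :* (m :* m)) := ε :* ((c :* m) :* (c :* m))) refl (ℕ→ℚ c) ε (ℕ→ℚ m))
      (cong (λ x → ε * (x * x)) (sym (ℕ→ℚ-* c m)))))
  (ℚP.*-monoˡ-≤-nonNeg (ℕ→ℚ (c ℕ.* c)) {{nonNegative (ℕ→ℚ-nonneg (c ℕ.* c))}} h)
  where
  open +-*-Solver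
  regroup : ∀ c k → (c ℕ.* c) ℕ.* (k ℕ.* k) ≡ (c ℕ.* k) ℕ.* (c ℕ.* k)
  regroup = ℕ-solve

floor√-mono : ∀ ε m m′ k k′ → 0ℚ ≤ ε → m ℕ.≤ m′ → Below ε k m → ε * (ℕ→ℚ m′ * ℕ→ℚ m′) < ℕ→ℚ (suc k′ ℕ.* suc k′) → k ℕ.≤ k′
floor√-mono ε m m′ k k′ 0≤ε m≤m′ below above = ℕP.≮⇒≥ λ k′<k → ℕP.<⇒≱ squares (ℕP.*-mono-≤ k′<k k′<k)
  where
  squares : k ℕ.* k ℕ.< suc k′ ℕ.* suc k′
  squares = ℕ→ℚ-cancel-< (ℚP.≤-<-trans (ℚP.≤-trans below
    (ℚP.*-monoˡ-≤-nonNeg ε {{nonNegative 0≤ε}} (square-mono (ℕ→ℚ-nonneg m) (ℕ→ℚ-mono m≤m′)))) above)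

√-bound : ∀ {x} ε k m → x ≤ ℕ→ℚ k → Below ε k m → x ≤√ ε · ℕ→ℚ m
√-bound {x} ε k m x≤k below with x ℚP.≤? 0ℚ
... | yes x≤0 = inj₁ x≤0
... | no x≰0 = inj₂ (ℚP.≤-trans (square-mono (ℚP.<⇒≤ (ℚP.≰⇒> x≰0)) x≤k) (ℚP.≤-trans (ℚP.≤-reflexive (sym (ℕ→ℚ-* k k))) below))

<-from-√ : ∀ {c} ε k m → Below ε k m → √ ε · ℕ→ℚ m < c → ℕ→ℚ k < c
<-from-√ {c} ε k m below (0<c , h) = ℚP.≰⇒> λ c≤k → ℚP.<-irrefl refl
  (ℚP.<-≤-trans h (ℚP.≤-trans (square-mono (ℚP.<⇒≤ 0<c) c≤k) (ℚP.≤-trans (ℚP.≤-reflexive (sym (ℕ→ℚ-* k k))) below)))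

-- The product of the two strict bounds is (εuv)² < (`suc i * suc j`)². If as many as
-- `suc i * suc j` pairs were missing, this number would be at most εuv.
few-missing : ∀ ε u v γ i j → 0ℚ ≤ ε → ε * (ℕ→ℚ u * ℕ→ℚ u) < ℕ→ℚ (suc i ℕ.* suc i) → ε * (ℕ→ℚ v * ℕ→ℚ v) < ℕ→ℚ (suc j ℕ.* suc j) →
  (1ℚ - ε) * ℕ→ℚ u * ℕ→ℚ v ≤ ℕ→ℚ γ → u ℕ.* v ℕ.< γ ℕ.+ suc i ℕ.* suc j
few-missing ε u v γ i j 0≤ε above-i above-j dense = ℕP.≰⇒> λ many → ℚP.<-irrefl refl (ℚP.≤-<-trans
    (square-mono (ℕ→ℚ-nonneg t) (missing-≤ many))
    (subst₂ _<_ (solve 3 (λ ε u v → (ε :* (u :* u)) :* (ε :* (v :* v)) := (ε :* (u :* v)) :* (ε :* (u :* v))) refl ε (ℕ→ℚ u) (ℕ→ℚ v))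
      (trans (sym (ℕ→ℚ-* (suc i ℕ.* suc i) (suc j ℕ.* suc j))) (trans (cong ℕ→ℚ (regroup (suc i) (suc j))) (ℕ→ℚ-* t t)))
      (*-mono-< (ε-square u) (ε-square v) above-i above-j)))
  where
  open +-*-Solver
  t = suc i ℕ.* suc j
  regroup : ∀ a b → (a ℕ.* a) ℕ.* (b ℕ.* b) ≡ (a ℕ.* b) ℕ.* (a ℕ.* b)
  regroup = ℕ-solve
  ε-square : ∀ x → 0ℚ ≤ ε * (ℕ→ℚ x * ℕ→ℚ x)
  ε-square x = *-nonneg 0≤ε (*-nonneg (ℕ→ℚ-nonneg x) (ℕ→ℚ-nonneg x))
  missing-≤ : γ ℕ.+ t ℕ.≤ u ℕ.* v → ℕ→ℚ t ≤ ε * (ℕ→ℚ u * ℕ→ℚ v)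
  missing-≤ many = ≤-rearrange
    (ℚP.+-mono-≤ (subst₂ _≤_ (ℕ→ℚ-+ γ t) (ℕ→ℚ-* u v) (ℕ→ℚ-mono many)) dense)
    (solve 5 (λ ε u v g t → t :+ (u :* v :+ g) := ε :* (u :* v) :+ (g :+ t :+ (con 1ℚ :- ε) :* u :* v)) refl ε (ℕ→ℚ u) (ℕ→ℚ v) (ℕ→ℚ γ) (ℕ→ℚ t))

-- Doubling clears the half of `N`. It is applied with `13 * e` as `k`, which is the origin of
-- `26 e`.
few-sums-ℕ : ∀ N s u v k → ℕ→ℚ k < ℕ→ℚ N * (+ 1 / 2) - (ℕ→ℚ s - ℕ→ℚ u - ℕ→ℚ v) → 2 ℕ.* k ℕ.+ 2 ℕ.* s ℕ.< N ℕ.+ 2 ℕ.* u ℕ.+ 2 ℕ.* v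
few-sums-ℕ N s u v k h = ℕ→ℚ-cancel-< (subst₂ _<_
  (sym (trans (ℕ→ℚ-+ (2 ℕ.* k) (2 ℕ.* s)) (cong₂ _+_ (ℕ→ℚ-* 2 k) (ℕ→ℚ-* 2 s))))
  (trans (solve 4 (λ N s u v → con (+ 2 / 1) :* (N :* con (+ 1 / 2) :- (s :- u :- v)) :+ con (+ 2 / 1) :* s
            := N :+ con (+ 2 / 1) :* u :+ con (+ 2 / 1) :* v) refl (ℕ→ℚ N) (ℕ→ℚ s) (ℕ→ℚ u) (ℕ→ℚ v))
    (sym (trans (ℕ→ℚ-+ (N ℕ.+ 2 ℕ.* u) (2 ℕ.* v)) (cong₂ _+_ (trans (ℕ→ℚ-+ N (2 ℕ.* u)) (cong (λ x → ℕ→ℚ N + x) (ℕ→ℚ-* 2 u))) (ℕ→ℚ-* 2 v)))))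
  (ℚP.+-monoˡ-< (ℕ→ℚ 2 * ℕ→ℚ s) (ℚP.*-monoʳ-<-pos (ℕ→ℚ 2) h)))
  where open +-*-Solver

excess-≤ : ∀ L u v s k → L ℕ.+ v ℕ.≤ s ℕ.+ k → ℕ→ℚ L - ℕ→ℚ u - (ℕ→ℚ s - ℕ→ℚ u - ℕ→ℚ v) ≤ ℕ→ℚ k
excess-≤ L u v s k h = ≤-rearrange (subst₂ _≤_ (ℕ→ℚ-+ L v) (ℕ→ℚ-+ s k) (ℕ→ℚ-mono h))
  (solve 5 (λ L u v s k → (L :- u :- (s :- u :- v)) :+ (s :+ k) := k :+ (L :+ v)) refl (ℕ→ℚ L) (ℕ→ℚ u) (ℕ→ℚ v) (ℕ→ℚ s) (ℕ→ℚ k))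
  where open +-*-Solver

excess-≤′ : ∀ L u v s k → L ℕ.+ u ℕ.≤ s ℕ.+ k → ℕ→ℚ L - ℕ→ℚ v - (ℕ→ℚ s - ℕ→ℚ u - ℕ→ℚ v) ≤ ℕ→ℚ k
excess-≤′ L u v s k h = subst (λ r → ℕ→ℚ L - ℕ→ℚ v - r ≤ ℕ→ℚ k)
  (solve 3 (λ s u v → s :- v :- u := s :- u :- v) refl (ℕ→ℚ s) (ℕ→ℚ u) (ℕ→ℚ v)) (excess-≤ L v u s k h)
  where open +-*-Solver

deficit-≤ : ∀ u t i → u ℕ.≤ t ℕ.+ i → ℕ→ℚ u - ℕ→ℚ t ≤ ℕ→ℚ i
deficit-≤ u t i h = ≤-rearrange (subst (ℕ→ℚ u ≤_) (ℕ→ℚ-+ t i) (ℕ→ℚ-mono h))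
  (solve 3 (λ u t i → (u :- t) :+ (t :+ i) := i :+ u) refl (ℕ→ℚ u) (ℕ→ℚ t) (ℕ→ℚ i))
  where open +-*-Solver

length-AP : ∀ a d L → length (AP a d L) ≡ L
length-AP a d L = trans (length-map _ (Data.List.upTo L)) (length-upTo L)

two-squared : ∀ ε b → (+ 2 / 1) ≤√ ε · b → (+ 4 / 1) ≤ ε * (b * b)
two-squared ε b (inj₁ 2≤0) = contradiction 2≤0 (toWitness {a? = ¬? ((+ 2 / 1) ℚP.≤? 0ℚ)} tt)
two-squared ε b (inj₂ h) = h

-- Return from integer parts to √ε

Conclusion : ℚ → List ℤ → List ℤ → List (ℤ × ℤ) → Set
Conclusion ε U V Γ = ∃[ a ] ∃[ b ] ∃[ d ] ∃[ L ] ∃[ K ]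
  (1 ℕ.≤ d
  × (ℕ→ℚ (length (AP a d L)) - ℕ→ℚ (length U) - r) ≤√ ε · ((+ 5 / 1) * M)
  × (ℕ→ℚ (length (AP b d K)) - ℕ→ℚ (length V) - r) ≤√ ε · ((+ 5 / 1) * M)
  × (ℕ→ℚ (length U) - ℕ→ℚ (length (inter (AP a d L) U))) ≤√ ε · ℕ→ℚ (length U)
  × (ℕ→ℚ (length V) - ℕ→ℚ (length (inter (AP b d K) V))) ≤√ ε · ℕ→ℚ (length V))
  where
  r = ℕ→ℚ (length (restrictedSumset Γ)) - ℕ→ℚ (length U) - ℕ→ℚ (length V)
  M = ℕ→ℚ (length U ⊔ length V)

conclude : ∀ ε U V Γ i j e → Below ε i (length U) → Below ε j (length V) → Below ε e (length U ⊔ length V) →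
  let s = length (restrictedSumset Γ) in
  ∃[ a ] ∃[ b ] ∃[ d ] ∃[ L ] ∃[ K ] (1 ℕ.≤ d
    × L ℕ.+ length V ℕ.≤ s ℕ.+ 5 ℕ.* e × K ℕ.+ length U ℕ.≤ s ℕ.+ 5 ℕ.* e
    × length U ℕ.≤ length (inter (AP a d L) U) ℕ.+ i × length V ℕ.≤ length (inter (AP b d K) V) ℕ.+ j) →
  Conclusion ε U V Γ
conclude ε U V Γ i j e below-i below-j below-e (a , b , d , L , K , d>0 , L≤ , K≤ , interU , interV) =
  a , b , d , L , K , d>0
  , width (subst (λ l → ℕ→ℚ l - ℕ→ℚ u - r ≤ ℕ→ℚ (5 ℕ.* e)) (sym (length-AP a d L)) (excess-≤ L u v s (5 ℕ.* e) L≤))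
  , width (subst (λ l → ℕ→ℚ l - ℕ→ℚ v - r ≤ ℕ→ℚ (5 ℕ.* e)) (sym (length-AP b d K)) (excess-≤′ K u v s (5 ℕ.* e) K≤))
  , √-bound ε i u (deficit-≤ u (length (inter (AP a d L) U)) i interU) below-i
  , √-bound ε j v (deficit-≤ v (length (inter (AP b d K) V)) j interV) below-j
  where
  u = length U
  v = length V
  M = u ⊔ v
  s = length (restrictedSumset Γ)
  r = ℕ→ℚ s - ℕ→ℚ u - ℕ→ℚ v
  width : ∀ {x} → x ≤ ℕ→ℚ (5 ℕ.* e) → x ≤√ ε · ((+ 5 / 1) * ℕ→ℚ M)
  width {x} x≤ = subst (λ y → x ≤√ ε · y) (ℕ→ℚ-* 5 M) (√-bound ε (5 ℕ.* e) (5 ℕ.* M) x≤ (below-scale ε 5 e M below-e))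

theorem3p3 : (ε : ℚ) → 0ℚ < ε → ε < (+ 1 / 2) →
    (U V : List ℤ) → Unique U → Unique V →
    3 Data.Nat.≤ (length U ⊓ length V) →
    (+ 2 / 1) ≤√ ε · ℕ→ℚ (length U ⊔ length V) →
    (Γ : List (ℤ × ℤ)) → Unique Γ → All (λ p → proj₁ p ∈ U × proj₂ p ∈ V) Γ →
    (1ℚ - ε) * ℕ→ℚ (length U) * ℕ→ℚ (length V) ≤ ℕ→ℚ (length Γ) →
    let r : ℚ
        r = ℕ→ℚ (length (restrictedSumset Γ)) - ℕ→ℚ (length U) - ℕ→ℚ (length V)
        M : ℚ
        M = ℕ→ℚ (length U ⊔ length V)
    in √ ε · ((+ 13 / 1) * M) < (ℕ→ℚ (length U ⊓ length V) * (+ 1 / 2) - r) →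
    ∃[ a ] ∃[ b ] ∃[ d ] ∃[ L ] ∃[ K ]
      (1 Data.Nat.≤ d
      × (ℕ→ℚ (length (AP a d L)) - ℕ→ℚ (length U) - r) ≤√ ε · ((+ 5 / 1) * M)
      × (ℕ→ℚ (length (AP b d K)) - ℕ→ℚ (length V) - r) ≤√ ε · ((+ 5 / 1) * M)
      × (ℕ→ℚ (length U) - ℕ→ℚ (length (inter (AP a d L) U))) ≤√ ε · ℕ→ℚ (length U)
      × (ℕ→ℚ (length V) - ℕ→ℚ (length (inter (AP b d K) V))) ≤√ ε · ℕ→ℚ (length V))
theorem3p3 ε 0<ε ε<½ U V uniqueU uniqueV N≥3 M-large Γ uniqueΓ Γ⊆ dense gap =
  from-floors (floor√ 0≤ε ε<1 u u>0) (floor√ 0≤ε ε<1 v v>0) (floor√ 0≤ε ε<1 M (ℕP.<-≤-trans u>0 (ℕP.m≤m⊔n u v)))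
  where
  u = length U
  v = length V
  M = u ⊔ v
  s = length (restrictedSumset Γ)
  0≤ε : 0ℚ ≤ ε
  0≤ε = ℚP.<⇒≤ 0<ε
  ε<1 : ε < 1ℚ
  ε<1 = ℚP.<-trans ε<½ (toWitness {a? = (+ 1 / 2) ℚP.<? 1ℚ} tt)
  u>0 : 0 ℕ.< u
  u>0 = ℕP.≤-trans (s≤s z≤n) (ℕP.≤-trans N≥3 (ℕP.m⊓n≤m u v))
  v>0 : 0 ℕ.< v
  v>0 = ℕP.≤-trans (s≤s z≤n) (ℕP.≤-trans N≥3 (ℕP.m⊓n≤n u v))
  e-positive : ∀ e → ε * (ℕ→ℚ M * ℕ→ℚ M) < ℕ→ℚ (suc e ℕ.* suc e) → 1 ℕ.≤ e
  -- For `e` equal to 0 the strict bound says ε M² < 1, against ε M² ≥ 4.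
  e-positive zero above = contradiction (ℕ→ℚ-cancel-< {4} {1} (ℚP.≤-<-trans (two-squared ε (ℕ→ℚ M) M-large) above)) λ { (s≤s ()) }
  e-positive (suc e) _ = s≤s z≤n
  few : ∀ e → Below ε e M → 26 ℕ.* e ℕ.+ 2 ℕ.* s ℕ.< u ⊓ v ℕ.+ 2 ℕ.* u ℕ.+ 2 ℕ.* v
  few e below = subst (λ x → x ℕ.+ 2 ℕ.* s ℕ.< u ⊓ v ℕ.+ 2 ℕ.* u ℕ.+ 2 ℕ.* v) (sym (ℕP.*-assoc 2 13 e))
    (few-sums-ℕ (u ⊓ v) s u v (13 ℕ.* e) (<-from-√ ε (13 ℕ.* e) (13 ℕ.* M) (below-scale ε 13 e M below)
      (subst (λ x → √ ε · x < (ℕ→ℚ (u ⊓ v) * (+ 1 / 2) - (ℕ→ℚ s - ℕ→ℚ u - ℕ→ℚ v))) (sym (ℕ→ℚ-* 13 M)) gap)))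
  from-floors : ∃[ i ] (i ℕ.< u × Floor√ ε u i) → ∃[ j ] (j ℕ.< v × Floor√ ε v j) → ∃[ e ] (e ℕ.< M × Floor√ ε M e) → Conclusion ε U V Γ
  from-floors (i , i<u , below-i , above-i) (j , j<v , below-j , above-j) (e , _ , below-e , above-e) =
    conclude ε U V Γ i j e below-i below-j below-e
      (IntegerSumsets.discrete-theorem U V Γ uniqueU uniqueV uniqueΓ Γ⊆ i j e (e-positive e above-e)
        (floor√-mono ε u M i e 0≤ε (ℕP.m≤m⊔n u v) below-i above-e) (floor√-mono ε v M j e 0≤ε (ℕP.m≤n⊔m u v) below-j above-e)
        i<u j<v (few-missing ε u v (length Γ) i j 0≤ε above-i above-j dense) (few e below-e))
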